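{- For all positive integers $k\le n$, $$s(k,n)\le n+k^2\left(\frac14-\frac1{(\pi+2)^2}+o(1)\right),$$ where $o(1)$ denotes a quantity tending to $0$ as $n\to\infty$.
   Context: Write $[n]=\{1,\dots,n\}$. For a set $A$ of integers, $A+A=\{a+b: a,b\in A\}$. Define $s(k,n)=\max\{|A+A| : A\subseteq[n],\ |A|=k\}$, the maximum number of distinct pairwise sums of a $k$-element subset of $[n]$. -}

module Defs where

open import Data.Nat as ℕ using (ℕ; zero; suc)
open import Data.Nat.Properties using (_≟_)
open import Data.Integer as ℤ using (ℤ; +_)
open import Data.Rational as ℚ using (ℚ)
open import Data.List using (List; map; concatMap; length; deduplicate)

sums : List ℕ → List ℕ
sums A = concatMap (λ x → map (x ℕ.+_) A) A

sumsetCard : List ℕ → ℕ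
sumsetCard A = length (deduplicate _≟_ (sums A))

ℕtoℚ : ℕ → ℚ
ℕtoℚ n = + n ℚ./ 1

-- Leibniz partial sums: leibniz m = 4 * Σ_{i<m} (-1)^i / (2i+1).
-- The partial sums with an odd number of terms, leibniz (2m+1), are
-- strict upper bounds of π decreasing to π, so for rational q:
-- π < q  iff  ∃ m, leibniz (2m+1) < q.
sgn : ℕ → ℤ
sgn zero = + 1
sgn (suc zero) = ℤ.-[1+ 0 ]
sgn (suc (suc i)) = sgn i

leibniz : ℕ → ℚ
leibniz zero = ℚ.0ℚ
leibniz (suc i) = leibniz i ℚ.+ (sgn i ℤ.* + 4) ℚ./ suc (2 ℕ.* i)

GreaterThanπ : ℚ → Set
GreaterThanπ q = Σ ℕ λ m → leibniz (suc (2 ℕ.* m)) ℚ.< q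
  where open import Data.Product using (Σ)

-- For the positive rational q = a / (b+1):  1 / (q + 2)^2 = (b+1)^2 / (a + 2(b+1))^2.
invSqPlus2 : ℕ → ℕ → ℚ
invSqPlus2 a b = + (suc b ℕ.* suc b) ℚ./ ((2 ℕ.* suc b ℕ.+ a) ℕ.* (2 ℕ.* suc b ℕ.+ a))

module Submission where

-- Let f(θ) = Σ_{a ∈ A} e(aθ).  The representation function of A + A is within k² + 2k + 2K - 4|A + A| in ℓ¹ of twice the
-- indicator function of an interval of length K ≈ 2n.  The Fourier coefficients of the interval vanish at the nonzero
-- frequencies mod K, so |f|² ≤ k² + 4n - 4|A + A| + o(k²) there.  On the other hand A lies in a half circle, on which
-- sin θ + Σ_j b_j cos^{2j} θ ≈ 1, with b_j the Taylor coefficients of 1 - √(1 - x).  Summing this over A and expanding the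
-- cos^{2j} into harmonics forces |f| ≥ k U / (1 + U) - o(k) at one of these frequencies, where the mean of sin θ,
-- U = 1 - Σ_j b_j (2j choose j) / 4^j = (2J + 1) ((2J choose J) / 4^J)², is Wallis' product for 2/π; and U / (1 + U) ≥ 2 / (π + 2).
--
-- Everything is done over ℚ.  The roots of unity are replaced by the powers of a rational rotation ζ, constant on blocks
-- of consecutive integers, the half circle ending at the first power of ζ with negative imaginary part.  The partial
-- products of Wallis and the partial sums of Leibniz are compared through the convergents of Brouncker's continued fraction.

open import Defs

-- The two bounds on |f| give (2k / (π + 2))² ≤ k² + 4n - 4|A + A| up to o(k²), whence the constant.
-- If k² ≤ n, the trivial |A + A| ≤ k² suffices; so n < k² may be assumed, and errors o(n) are
-- o(k²). The upper bound on |f|² tests A + A against ψ(s) = Re(f̄² e(s)): summed over all pairs it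
-- gives |f|⁴, while |ψ| ≤ |f|², so one factor |f|² cancels. The bound must be uniform in k and in
-- the rational q > π. J only makes the Taylor error `C J`, of order J^(-1/2), small, which is why J
-- is of order ε^(-2). A rational rotation by about 2 / T has no exact period. After 2L steps, about
-- one full turn, it misses 1 by at most 2|ζ - 1|, so the geometric sum at frequency l is at most 2l
-- instead of 0; times the block length, about n / L, this is O(J n / T).

module Lemmas where

  open import Data.Empty using (⊥; ⊥-elim)
  open import Data.Integer as ℤ using (ℤ)
  import Data.Integer.Properties as ℤ
  open import Data.List using (List; []; _∷_; _++_; map; concatMap; length; deduplicate; upTo; applyUpTo)
  open import Data.List.Membership.Propositional using (_∈_; find)
  open import Data.List.Membership.Propositional.Properties using (∈-++⁺ˡ; ∈-++⁺ʳ; ∈-++⁻; ∈-map⁺; ∈-map⁻; ∈-∃++; ∈-concatMap⁻; ∈-deduplicate⁻; ∈-upTo⁺)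
  open import Data.List.Properties using (length-deduplicate; length-++; length-map; length-upTo)
  import Data.List.Relation.Unary.All as All
  open import Data.List.Relation.Unary.AllPairs using ([]; _∷_)
  open import Data.List.Relation.Unary.Any using (here; there)
  import Data.List.Relation.Unary.Unique.DecPropositional.Properties as UniqueDec
  open import Data.List.Relation.Unary.Unique.Propositional using (Unique)
  open import Data.Maybe using (Maybe; just; nothing)
  open import Data.Nat as ℕ using (ℕ; zero; suc)
  import Data.Nat.DivMod as ℕ
  open import Data.Nat.Divisibility using (n∣m*n; ∣-refl)
  import Data.Nat.Properties as ℕ
  import Data.Nat.Tactic.RingSolver as ℕ-RingSolver
  open import Data.Product using (_×_; _,_; proj₁; proj₂; ∃-syntax)
  open import Data.Rational
  open import Data.Rational.Properties
  import Data.Rational.Unnormalised as ℚᵘ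
  import Data.Rational.Unnormalised.Properties as ℚᵘ
  open import Data.Sum using (_⊎_; inj₁; inj₂)
  open import Function using (_∘_; id)
  open import Level using (0ℓ)
  open import Relation.Binary.PropositionalEquality hiding (J)
  open import Relation.Nullary using (¬_; Dec; yes; no)
  open import Tactic.RingSolver using (solve-∀)
  import Tactic.RingSolver.Core.AlmostCommutativeRing as ACR

  -- Rational inequalities and casts of naturals

  isZero : ∀ x → Maybe (0ℚ ≡ x)
  isZero x with 0ℚ ≟ x
  ... | yes p = just p
  ... | no _  = nothing

  ring : ACR.AlmostCommutativeRing 0ℓ 0ℓ
  ring = ACR.fromCommutativeRing +-*-commutativeRing isZero

  2ℚ 3ℚ 4ℚ : ℚ
  2ℚ = ℤ.+ 2 / 1
  3ℚ = ℤ.+ 3 / 1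
  4ℚ = ℤ.+ 4 / 1

  -- Most inequalities below are certified in this form: a visibly nonnegative difference of the two
  -- sides, and a polynomial identity.
  by-diff : ∀ {x y d} → 0ℚ ≤ d → y ≡ x + d → x ≤ y
  by-diff {x} {y} {d} 0≤d eq = subst (x ≤_) (sym eq) (subst (_≤ x + d) (+-identityʳ x) (+-monoʳ-≤ x 0≤d))

  by-diff< : ∀ {x y d} → 0ℚ < d → y ≡ x + d → x < y
  by-diff< {x} {y} {d} 0<d eq = subst (x <_) (sym eq) (subst (_< x + d) (+-identityʳ x) (+-monoʳ-< x 0<d))

  0≤diff : ∀ {x y} → x ≤ y → 0ℚ ≤ y - x
  0≤diff {x} {y} x≤y = subst (_≤ y - x) (+-inverseʳ x) (+-monoˡ-≤ (- x) x≤y)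

  0<diff : ∀ {x y} → x < y → 0ℚ < y - x
  0<diff {x} {y} x<y = subst (_< y - x) (+-inverseʳ x) (+-monoˡ-< (- x) x<y)

  0≤+ : ∀ {x y} → 0ℚ ≤ x → 0ℚ ≤ y → 0ℚ ≤ x + y
  0≤+ p q = +-mono-≤ p q

  0<+ : ∀ {x y} → 0ℚ < x → 0ℚ ≤ y → 0ℚ < x + y
  0<+ p q = +-mono-<-≤ p q

  0≤* : ∀ {x y} → 0ℚ ≤ x → 0ℚ ≤ y → 0ℚ ≤ x * y
  0≤* {x} {y} p q = subst (_≤ x * y) (*-zeroʳ x) (*-monoˡ-≤-nonNeg x {{nonNegative p}} q)

  0<* : ∀ {x y} → 0ℚ < x → 0ℚ < y → 0ℚ < x * y
  0<* {x} {y} p q = subst (_< x * y) (*-zeroʳ x) (*-monoʳ-<-pos x {{positive p}} q)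

  *-monoˡ : ∀ {x y z} → 0ℚ ≤ z → x ≤ y → z * x ≤ z * y
  *-monoˡ {z = z} 0≤z = *-monoˡ-≤-nonNeg z {{nonNegative 0≤z}}

  *-mono : ∀ {x y z w} → 0ℚ ≤ x → 0ℚ ≤ w → x ≤ y → z ≤ w → x * z ≤ y * w
  *-mono {x} {w = w} 0≤x 0≤w x≤y z≤w = ≤-trans (*-monoˡ 0≤x z≤w) (*-monoʳ-≤-nonNeg w {{nonNegative 0≤w}} x≤y)

  *-cancelˡ : ∀ {x y z} → 0ℚ < z → z * x ≤ z * y → x ≤ y
  *-cancelˡ {z = z} 0<z = *-cancelˡ-≤-pos z {{positive 0<z}}

  *-cancelˡ-< : ∀ {x y z} → 0ℚ ≤ z → z * x < z * y → x < y
  *-cancelˡ-< {z = z} 0≤z = *-cancelˡ-<-nonNeg z {{nonNegative 0≤z}}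

  0≤² : ∀ x → 0ℚ ≤ x * x
  0≤² x with ≤-total 0ℚ x
  ... | inj₁ 0≤x = 0≤* 0≤x 0≤x
  ... | inj₂ x≤0 = subst (0ℚ ≤_) (eq x) (0≤* (0≤diff x≤0) (0≤diff x≤0))
    where
    eq : ∀ x → (0ℚ - x) * (0ℚ - x) ≡ x * x
    eq = solve-∀ ring

  ≤-from-² : ∀ {x y} → 0ℚ ≤ y → x * x ≤ y * y → x ≤ y
  ≤-from-² {x} {y} 0≤y x²≤y² with x ≤? y
  ... | yes x≤y = x≤y
  ... | no x≰y  = ⊥-elim (<-irrefl refl (<-≤-trans y²<x² x²≤y²))
    where
    y<x = ≰⇒> x≰y
    eq : ∀ x y → x * x ≡ y * y + (x - y) * (x - y + y + y)
    eq = solve-∀ ring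
    y²<x² : y * y < x * x
    y²<x² = by-diff< (0<* (0<diff y<x) (0<+ (0<+ (0<diff y<x) 0≤y) 0≤y)) (eq x y)

  toℚᵘ-/ : ∀ i d → toℚᵘ (i / suc d) ℚᵘ.≃ ℚᵘ.mkℚᵘ i d
  toℚᵘ-/ i d = toℚᵘ-fromℚᵘ (ℚᵘ.mkℚᵘ i d)

  /1-+ : ∀ i j → (i ℤ.+ j) / 1 ≡ i / 1 + j / 1
  /1-+ i j = toℚᵘ-injective (ℚᵘ.≃-trans (toℚᵘ-/ (i ℤ.+ j) 0) (ℚᵘ.≃-sym
    (ℚᵘ.≃-trans (toℚᵘ-homo-+ (i / 1) (j / 1)) (ℚᵘ.≃-trans (ℚᵘ.+-cong (toℚᵘ-/ i 0) (toℚᵘ-/ j 0))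
      (ℚᵘ.*≡* (cong (ℤ._* ℤ.+ 1) (cong₂ ℤ._+_ (ℤ.*-identityʳ i) (ℤ.*-identityʳ j))))))))

  /1-* : ∀ i j → (i ℤ.* j) / 1 ≡ i / 1 * (j / 1)
  /1-* i j = toℚᵘ-injective (ℚᵘ.≃-trans (toℚᵘ-/ (i ℤ.* j) 0) (ℚᵘ.≃-sym
    (ℚᵘ.≃-trans (toℚᵘ-homo-* (i / 1) (j / 1)) (ℚᵘ.*-cong (toℚᵘ-/ i 0) (toℚᵘ-/ j 0)))))

  /-*-cancel : ∀ i d → i / suc d * ℕtoℚ (suc d) ≡ i / 1
  /-*-cancel i d = toℚᵘ-injective (ℚᵘ.≃-trans (toℚᵘ-homo-* (i / suc d) (ℕtoℚ (suc d)))
    (ℚᵘ.≃-trans (ℚᵘ.*-cong (toℚᵘ-/ i d) (toℚᵘ-/ (ℤ.+ suc d) 0)) (ℚᵘ.≃-trans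
      (ℚᵘ.*≡* (trans (ℤ.*-identityʳ _) (cong (i ℤ.*_) (cong ℤ.+_ (sym (ℕ.*-identityʳ (suc d)))))))
      (ℚᵘ.≃-sym (toℚᵘ-/ i 0)))))

  opaque
    -- Opaque, so that casts are atoms governed only by the laws of this block and the fractions
    -- behind them are never normalised.
    ι : ℕ → ℚ
    ι = ℕtoℚ

    ι≡ℕtoℚ : ∀ n → ι n ≡ ℕtoℚ n
    ι≡ℕtoℚ n = refl

    /-*-ι : ∀ i d → i / suc d * ι (suc d) ≡ i / 1
    /-*-ι = /-*-cancel

    ι-0 : ι 0 ≡ 0ℚ
    ι-0 = refl

    ι-1 : ι 1 ≡ 1ℚ
    ι-1 = refl

    ι-2 : ι 2 ≡ 2ℚ
    ι-2 = refl

    ι-+ : ∀ m n → ι (m ℕ.+ n) ≡ ι m + ι n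
    ι-+ m n = /1-+ (ℤ.+ m) (ℤ.+ n)

    ι-* : ∀ m n → ι (m ℕ.* n) ≡ ι m * ι n
    ι-* m n = trans (cong (_/ 1) (ℤ.pos-* m n)) (/1-* (ℤ.+ m) (ℤ.+ n))

    ι-suc : ∀ n → ι (suc n) ≡ 1ℚ + ι n
    ι-suc n = ι-+ 1 n

    ι-mono : ∀ {m n} → m ℕ.≤ n → ι m ≤ ι n
    ι-mono {m} {n} m≤n = toℚᵘ-cancel-≤ (ℚᵘ.≤-respˡ-≃ (ℚᵘ.≃-sym (toℚᵘ-/ (ℤ.+ m) 0))
      (ℚᵘ.≤-respʳ-≃ (ℚᵘ.≃-sym (toℚᵘ-/ (ℤ.+ n) 0)) (ℚᵘ.*≤* (ℤ.*-monoʳ-≤-nonNeg (ℤ.+ 1) (ℤ.+≤+ m≤n)))))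

    0≤ι : ∀ n → 0ℚ ≤ ι n
    0≤ι n = ι-mono {0} {n} ℕ.z≤n

  0<1 : 0ℚ < 1ℚ
  0<1 = positive⁻¹ 1ℚ

  0≤1 : 0ℚ ≤ 1ℚ
  0≤1 = <⇒≤ 0<1

  0<ι-suc : ∀ n → 0ℚ < ι (suc n)
  0<ι-suc n = <-≤-trans 0<1 (subst (_≤ ι (suc n)) ι-1 (ι-mono {1} {suc n} (ℕ.s≤s ℕ.z≤n)))

  odd : ℕ → ℚ
  odd n = ι (suc (2 ℕ.* n))

  odd≡ : ∀ n → odd n ≡ 1ℚ + 2ℚ * ι n
  odd≡ n = trans (ι-suc (2 ℕ.* n)) (cong (1ℚ +_) (trans (ι-* 2 n) (cong (_* ι n) ι-2)))

  odd-suc : ∀ n → odd (suc n) ≡ 2ℚ + odd n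
  odd-suc n = trans (odd≡ (suc n)) (trans (cong (λ t → 1ℚ + 2ℚ * t) (ι-suc n)) (trans (eq (ι n)) (cong (2ℚ +_) (sym (odd≡ n)))))
    where
    eq : ∀ n → 1ℚ + 2ℚ * (1ℚ + n) ≡ 2ℚ + (1ℚ + 2ℚ * n)
    eq = solve-∀ ring

  0<odd : ∀ n → 0ℚ < odd n
  0<odd n = 0<ι-suc (2 ℕ.* n)

  -- Equality modulo a relation such as c² + s² = 1: the multiplier of the relation is supplied and
  -- the rest is a ring identity.
  ≡-by : ∀ {x y p q} → p ≡ q → ∀ c → x ≡ y + c * (p - q) → x ≡ y
  ≡-by {x} {y} {p} refl c eq = trans eq (vanish y c p)
    where
    vanish : ∀ a c p → a + c * (p - p) ≡ a
    vanish = solve-∀ ring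

  -- Brouncker's continued fraction and Wallis' product

  -- P s n / Q s n are the convergents, with index shifted by one, of s + 1² / (2s + 3² / (2s + 5² / (2s + …))).
  -- At s = 1 they are the reciprocals of the partial sums of Leibniz' series for π / 4.
  cf : ℚ → ℚ → ℚ → ℕ → ℚ
  cf s a b zero          = a
  cf s a b (suc zero)    = b
  cf s a b (suc (suc n)) = 2ℚ * s * cf s a b (suc n) + odd n * odd n * cf s a b n

  P Q : ℚ → ℕ → ℚ
  P s = cf s 1ℚ s
  Q s = cf s 0ℚ 1ℚ

  -- This is (-1)^n (1 · 3 ⋯ (2n - 1))². It does not depend on `s`, so the identities at s and s + 2
  -- can be played against each other.
  defect : ℕ → ℚ
  defect zero    = 1ℚ
  defect (suc n) = - (odd n * odd n * defect n)

  module _ (s : ℚ) where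

    -- The failure, at the level of convergents, of Brouncker's functional equation b(s) b(s + 2) =
    -- (s + 1)².
    cross : ℕ → ℕ → ℚ
    cross m n = P s m * P (s + 2ℚ) n - (s + 1ℚ) * (s + 1ℚ) * (Q s m * Q (s + 2ℚ) n)

    Determinants : ℕ → Set
    Determinants n = cross n n ≡ defect n
      × cross (suc n) (suc n) ≡ defect (suc n)
      × cross (suc n) n ≡ defect n * (s - 2ℚ * ι n)
      × cross n (suc n) ≡ defect n * (s + 2ℚ + 2ℚ * ι n)

    -- One recurrence step in both continued fractions expresses the new diagonal `cross` through
    -- all four entries at n and n + 1, so the induction has to carry the two off-diagonal ones.
    determinants : ∀ n → Determinants n
    determinants zero = base₁ s , base₂ s odd0 , base₃ s ι-0 , base₄ s ι-0
      where
      odd0 : odd 0 ≡ 1ℚ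
      odd0 = ι-1
      base₁ : ∀ s → 1ℚ * 1ℚ - (s + 1ℚ) * (s + 1ℚ) * (0ℚ * 0ℚ) ≡ 1ℚ
      base₁ = solve-∀ ring
      base₂′ : ∀ s → s * (s + 2ℚ) - (s + 1ℚ) * (s + 1ℚ) * (1ℚ * 1ℚ) ≡ - (1ℚ * 1ℚ * 1ℚ)
      base₂′ = solve-∀ ring
      base₂ : ∀ s {o} → o ≡ 1ℚ → s * (s + 2ℚ) - (s + 1ℚ) * (s + 1ℚ) * (1ℚ * 1ℚ) ≡ - (o * o * 1ℚ)
      base₂ s refl = base₂′ s
      base₃′ : ∀ s → s * 1ℚ - (s + 1ℚ) * (s + 1ℚ) * (1ℚ * 0ℚ) ≡ 1ℚ * (s - 2ℚ * 0ℚ)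
      base₃′ = solve-∀ ring
      base₃ : ∀ s {z} → z ≡ 0ℚ → s * 1ℚ - (s + 1ℚ) * (s + 1ℚ) * (1ℚ * 0ℚ) ≡ 1ℚ * (s - 2ℚ * z)
      base₃ s refl = base₃′ s
      base₄′ : ∀ s → 1ℚ * (s + 2ℚ) - (s + 1ℚ) * (s + 1ℚ) * (0ℚ * 1ℚ) ≡ 1ℚ * (s + 2ℚ + 2ℚ * 0ℚ)
      base₄′ = solve-∀ ring
      base₄ : ∀ s {z} → z ≡ 0ℚ → 1ℚ * (s + 2ℚ) - (s + 1ℚ) * (s + 1ℚ) * (0ℚ * 1ℚ) ≡ 1ℚ * (s + 2ℚ + 2ℚ * z)
      base₄ s refl = base₄′ s
    determinants (suc n) with determinants n
    ... | c₀₀ , c₁₁ , c₁₀ , c₀₁ = c₁₁ , c₂₂ , c₂₁ , c₁₂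
      where
      p₀ = P s n
      p₁ = P s (suc n)
      p₀′ = P (s + 2ℚ) n
      p₁′ = P (s + 2ℚ) (suc n)
      q₀ = Q s n
      q₁ = Q s (suc n)
      q₀′ = Q (s + 2ℚ) n
      q₁′ = Q (s + 2ℚ) (suc n)

      expand : ∀ s o g p₀ p₁ p₀′ p₁′ q₀ q₁ q₀′ q₁′ →
        (2ℚ * s * p₁ + o * o * p₀) * (2ℚ * (s + 2ℚ) * p₁′ + o * o * p₀′)
          - g * ((2ℚ * s * q₁ + o * o * q₀) * (2ℚ * (s + 2ℚ) * q₁′ + o * o * q₀′))
        ≡ 4ℚ * s * (s + 2ℚ) * (p₁ * p₁′ - g * (q₁ * q₁′))
          + 2ℚ * s * (o * o) * (p₁ * p₀′ - g * (q₁ * q₀′))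
          + 2ℚ * (s + 2ℚ) * (o * o) * (p₀ * p₁′ - g * (q₀ * q₁′))
          + o * o * (o * o) * (p₀ * p₀′ - g * (q₀ * q₀′))
      expand = solve-∀ ring

      expandˡ : ∀ s o g p₀ p₁ p₁′ q₀ q₁ q₁′ →
        (2ℚ * s * p₁ + o * o * p₀) * p₁′ - g * ((2ℚ * s * q₁ + o * o * q₀) * q₁′)
        ≡ 2ℚ * s * (p₁ * p₁′ - g * (q₁ * q₁′)) + o * o * (p₀ * p₁′ - g * (q₀ * q₁′))
      expandˡ = solve-∀ ring

      expandʳ : ∀ s o g p₁ p₀′ p₁′ q₁ q₀′ q₁′ →
        p₁ * (2ℚ * s * p₁′ + o * o * p₀′) - g * (q₁ * (2ℚ * s * q₁′ + o * o * q₀′))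
        ≡ 2ℚ * s * (p₁ * p₁′ - g * (q₁ * q₁′)) + o * o * (p₁ * p₀′ - g * (q₁ * q₀′))
      expandʳ = solve-∀ ring

      c₂₂ : cross (suc (suc n)) (suc (suc n)) ≡ defect (suc (suc n))
      c₂₂ = trans (expand s (odd n) ((s + 1ℚ) * (s + 1ℚ)) p₀ p₁ p₀′ p₁′ q₀ q₁ q₀′ q₁′)
        (collect (ι n) (odd≡ n) (odd-suc n) c₁₁ c₁₀ c₀₁ c₀₀)
        where
        eq : ∀ s ν d → let o = 1ℚ + 2ℚ * ν in
          4ℚ * s * (s + 2ℚ) * (- (o * o * d))
          + 2ℚ * s * (o * o) * (d * (s - 2ℚ * ν))
          + 2ℚ * (s + 2ℚ) * (o * o) * (d * (s + 2ℚ + 2ℚ * ν))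
          + o * o * (o * o) * d
          ≡ - ((2ℚ + o) * (2ℚ + o) * (- (o * o * d)))
        eq = solve-∀ ring
        collect : ∀ ν {o o₁ d a b c e} → o ≡ 1ℚ + 2ℚ * ν → o₁ ≡ 2ℚ + o → a ≡ - (o * o * d) → b ≡ d * (s - 2ℚ * ν) →
          c ≡ d * (s + 2ℚ + 2ℚ * ν) → e ≡ d →
          4ℚ * s * (s + 2ℚ) * a + 2ℚ * s * (o * o) * b + 2ℚ * (s + 2ℚ) * (o * o) * c + o * o * (o * o) * e
          ≡ - (o₁ * o₁ * (- (o * o * d)))
        collect ν {d = d} refl refl refl refl refl refl = eq s ν d

      c₂₁ : cross (suc (suc n)) (suc n) ≡ defect (suc n) * (s - 2ℚ * ι (suc n))
      c₂₁ = trans (expandˡ s (odd n) ((s + 1ℚ) * (s + 1ℚ)) p₀ p₁ p₁′ q₀ q₁ q₁′)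
        (collect (ι n) (odd≡ n) (ι-suc n) c₁₁ c₀₁)
        where
        eq : ∀ s ν d → let o = 1ℚ + 2ℚ * ν in
          2ℚ * s * (- (o * o * d)) + o * o * (d * (s + 2ℚ + 2ℚ * ν)) ≡ - (o * o * d) * (s - 2ℚ * (1ℚ + ν))
        eq = solve-∀ ring
        collect : ∀ ν {o ν₁ d a c} → o ≡ 1ℚ + 2ℚ * ν → ν₁ ≡ 1ℚ + ν → a ≡ - (o * o * d) → c ≡ d * (s + 2ℚ + 2ℚ * ν) →
          2ℚ * s * a + o * o * c ≡ - (o * o * d) * (s - 2ℚ * ν₁)
        collect ν {d = d} refl refl refl refl = eq s ν d

      c₁₂ : cross (suc n) (suc (suc n)) ≡ defect (suc n) * (s + 2ℚ + 2ℚ * ι (suc n))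
      c₁₂ = trans (expandʳ (s + 2ℚ) (odd n) ((s + 1ℚ) * (s + 1ℚ)) p₁ p₀′ p₁′ q₁ q₀′ q₁′)
        (collect (ι n) (odd≡ n) (ι-suc n) c₁₁ c₁₀)
        where
        eq : ∀ s ν d → let o = 1ℚ + 2ℚ * ν in
          2ℚ * (s + 2ℚ) * (- (o * o * d)) + o * o * (d * (s - 2ℚ * ν)) ≡ - (o * o * d) * (s + 2ℚ + 2ℚ * (1ℚ + ν))
        eq = solve-∀ ring
        collect : ∀ ν {o ν₁ d a c} → o ≡ 1ℚ + 2ℚ * ν → ν₁ ≡ 1ℚ + ν → a ≡ - (o * o * d) → c ≡ d * (s - 2ℚ * ν) →
          2ℚ * (s + 2ℚ) * a + o * o * c ≡ - (o * o * d) * (s + 2ℚ + 2ℚ * ν₁)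
        collect ν {d = d} refl refl refl refl = eq s ν d

  0≤2 : 0ℚ ≤ 2ℚ
  0≤2 = nonNegative⁻¹ 2ℚ

  0<2 : 0ℚ < 2ℚ
  0<2 = positive⁻¹ 2ℚ

  cf-nonNeg : ∀ {s a b} → 0ℚ ≤ s → 0ℚ ≤ a → 0ℚ ≤ b → ∀ n → 0ℚ ≤ cf s a b n
  cf-nonNeg 0≤s 0≤a 0≤b zero = 0≤a
  cf-nonNeg 0≤s 0≤a 0≤b (suc zero) = 0≤b
  cf-nonNeg 0≤s 0≤a 0≤b (suc (suc n)) = 0≤+
    (0≤* (0≤* 0≤2 0≤s) (cf-nonNeg 0≤s 0≤a 0≤b (suc n))) (0≤* (0≤² (odd n)) (cf-nonNeg 0≤s 0≤a 0≤b n))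

  cf-pos : ∀ {s a b} → 0ℚ < s → 0ℚ ≤ a → 0ℚ < b → ∀ n → 0ℚ < cf s a b (suc n)
  cf-pos 0<s 0≤a 0<b zero = 0<b
  cf-pos 0<s 0≤a 0<b (suc n) = 0<+
    (0<* (0<* 0<2 0<s) (cf-pos 0<s 0≤a 0<b n)) (0≤* (0≤² (odd n)) (cf-nonNeg (<⇒≤ 0<s) 0≤a (<⇒≤ 0<b) n))

  cf-mono : ∀ {s t a b} → 0ℚ ≤ s → s ≤ t → 0ℚ ≤ a → 0ℚ ≤ b → ∀ n → cf s a b n ≤ cf t a b n
  cf-mono 0≤s s≤t 0≤a 0≤b zero = ≤-refl
  cf-mono 0≤s s≤t 0≤a 0≤b (suc zero) = ≤-refl
  cf-mono 0≤s s≤t 0≤a 0≤b (suc (suc n)) = +-mono-≤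
    (*-mono (0≤* 0≤2 0≤s) (cf-nonNeg (≤-trans 0≤s s≤t) 0≤a 0≤b (suc n)) (*-monoˡ 0≤2 s≤t) (cf-mono 0≤s s≤t 0≤a 0≤b (suc n)))
    (*-monoˡ (0≤² (odd n)) (cf-mono 0≤s s≤t 0≤a 0≤b n))

  -- Splits off the leading term s of the continued fraction; the remainder obeys the same
  -- recurrence and is nonnegative for s ≥ 0, so convergents are at least s.
  P-decomp : ∀ s n → P s n ≡ s * Q s n + cf s 1ℚ 0ℚ n
  P-decomp s zero = eq s
    where
    eq : ∀ s → 1ℚ ≡ s * 0ℚ + 1ℚ
    eq = solve-∀ ring
  P-decomp s (suc zero) = eq s
    where
    eq : ∀ s → s ≡ s * 1ℚ + 0ℚ
    eq = solve-∀ ring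
  P-decomp s (suc (suc n)) = trans (cong₂ (λ u v → 2ℚ * s * u + odd n * odd n * v) (P-decomp s (suc n)) (P-decomp s n))
    (eq s (odd n) (Q s (suc n)) (Q s n) (cf s 1ℚ 0ℚ (suc n)) (cf s 1ℚ 0ℚ n))
    where
    eq : ∀ s o a b c d → 2ℚ * s * (s * a + c) + o * o * (s * b + d)
      ≡ s * (2ℚ * s * a + o * o * b) + (2ℚ * s * c + o * o * d)
    eq = solve-∀ ring

  defect-even : ∀ m → 0ℚ ≤ defect (2 ℕ.* m)
  defect-even zero    = 0≤1
  defect-even (suc m) = subst (λ i → 0ℚ ≤ defect i) (sym (ℕ.*-suc 2 m))
    (subst (0ℚ ≤_) (eq (odd (suc (2 ℕ.* m))) (odd (2 ℕ.* m)) (defect (2 ℕ.* m)))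
      (0≤* (0≤² (odd (suc (2 ℕ.* m)))) (0≤* (0≤² (odd (2 ℕ.* m))) (defect-even m))))
    where
    eq : ∀ o p d → o * o * (p * p * d) ≡ - (o * o * (- (p * p * d)))
    eq = solve-∀ ring

  module _ (m : ℕ) where

    private
      N : ℕ
      N = suc (2 ℕ.* m)

      δ : ℚ
      δ = odd (2 ℕ.* m) * odd (2 ℕ.* m) * defect (2 ℕ.* m)

      0≤δ : 0ℚ ≤ δ
      0≤δ = 0≤* (0≤² (odd (2 ℕ.* m))) (defect-even m)

      cross-N : ∀ s → cross s N N ≡ - δ
      cross-N s = proj₁ (determinants s N)

    -- At an odd index the convergents at s and s + 2 have product at most (s + 1)², and the second
    -- is at least s + 2, hence at least s + 1.
    P≤ : ∀ s → 0ℚ < s → P s N ≤ (s + 1ℚ) * Q s N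
    P≤ s 0<s = *-cancelˡ (0<* 0<s+1 0<q′) (≤-trans lower upper)
      where
      0<s+1 : 0ℚ < s + 1ℚ
      0<s+1 = 0<+ 0<s 0≤1
      0<s+2 : 0ℚ < s + 2ℚ
      0<s+2 = 0<+ 0<s 0≤2
      0<p : 0ℚ < P s N
      0<p = cf-pos 0<s 0≤1 0<s (2 ℕ.* m)
      q′ = Q (s + 2ℚ) N
      0<q′ : 0ℚ < q′
      0<q′ = cf-pos 0<s+2 ≤-refl 0<1 (2 ℕ.* m)
      lower : (s + 1ℚ) * q′ * P s N ≤ P s N * P (s + 2ℚ) N
      lower = by-diff (0≤* (<⇒≤ 0<p) (0≤+ (<⇒≤ 0<q′) (cf-nonNeg (<⇒≤ 0<s+2) 0≤1 ≤-refl N)))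
        (trans (cong (P s N *_) (P-decomp (s + 2ℚ) N)) (eq s q′ (P s N) (cf (s + 2ℚ) 1ℚ 0ℚ N)))
        where
        eq : ∀ s q p r → p * ((s + 2ℚ) * q + r) ≡ (s + 1ℚ) * q * p + p * (q + r)
        eq = solve-∀ ring
      upper : P s N * P (s + 2ℚ) N ≤ (s + 1ℚ) * q′ * ((s + 1ℚ) * Q s N)
      upper = by-diff 0≤δ (eq (s + 1ℚ) (P s N * P (s + 2ℚ) N) (Q s N) q′ δ (cross-N s))
        where
        eq₁ : ∀ g x q q′ d → g * q′ * (g * q) ≡ x + (- (x - g * g * (q * q′)))
        eq₁ = solve-∀ ring
        eq₂ : ∀ x d → x + - (- d) ≡ x + d
        eq₂ = solve-∀ ring
        eq : ∀ g x q q′ d → x - g * g * (q * q′) ≡ - d → g * q′ * (g * q) ≡ x + d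
        eq g x q q′ d h = trans (eq₁ g x q q′ d) (trans (cong (λ t → x + - t) h) (eq₂ x d))

    Q-mono : ∀ s → 0ℚ < s → Q s N ≤ Q (s + 2ℚ + 2ℚ) N
    Q-mono s 0<s = cf-mono (<⇒≤ 0<s) (by-diff (0≤+ 0≤2 0≤2) (+-assoc s 2ℚ 2ℚ)) ≤-refl 0≤1 N

    -- The two determinant identities at s and s + 2 share the value - δ, so the convergent at s + 2 can be eliminated.
    shift : ∀ s κ → 0ℚ < s → s + 1ℚ ≡ κ * (s + 2ℚ + 1ℚ) →
      P s N * Q (s + 2ℚ + 2ℚ) N ≤ κ * κ * (P (s + 2ℚ + 2ℚ) N * Q s N)
    shift s κ 0<s s+1≡ = *-cancelˡ (0<* (0<* 0<g 0<g) 0<p′)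
      (by-diff (0≤* 0≤δ (0≤diff (*-mono (0≤² (s + 1ℚ)) (<⇒≤ 0<q″) g₁≤g₃ (Q-mono s 0<s))))
        (eq (P s N) p′ (P t+2 N) (Q s N) (Q t N) (Q t+2 N) (s + 1ℚ) (t + 1ℚ) δ κ (cross-N s) (cross-N t) s+1≡))
      where
      t = s + 2ℚ
      t+2 = t + 2ℚ
      p′ = P t N
      0<t : 0ℚ < t
      0<t = 0<+ 0<s 0≤2
      0<g : 0ℚ < t + 1ℚ
      0<g = 0<+ 0<t 0≤1
      0<p′ : 0ℚ < p′
      0<p′ = cf-pos 0<t 0≤1 0<t (2 ℕ.* m)
      0<q″ : 0ℚ < Q t+2 N
      0<q″ = cf-pos (0<+ 0<t 0≤2) ≤-refl 0<1 (2 ℕ.* m)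
      s+1≤t+1 : s + 1ℚ ≤ t + 1ℚ
      s+1≤t+1 = by-diff 0≤2 (eq s)
        where
        eq : ∀ s → s + 2ℚ + 1ℚ ≡ s + 1ℚ + 2ℚ
        eq = solve-∀ ring
      g₁≤g₃ : (s + 1ℚ) * (s + 1ℚ) ≤ (t + 1ℚ) * (t + 1ℚ)
      g₁≤g₃ = *-mono (0≤+ (<⇒≤ 0<s) 0≤1) (<⇒≤ 0<g) s+1≤t+1 s+1≤t+1
      eq₁ : ∀ p p′ p″ q q′ q″ g h κ →
        h * h * p′ * (κ * κ * (p″ * q)) ≡
        h * h * p′ * (p * q″)
          + (κ * h * (κ * h) * q * (p′ * p″ - h * h * (q′ * q″)) - h * h * q″ * (p * p′ - g * g * (q * q′)))
          + (κ * h * (κ * h) - g * g) * (q * (h * h) * (q′ * q″))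
      eq₁ = solve-∀ ring
      eq₂ : ∀ q q″ g h d r z → r + (g * g * q * (- d) - h * h * q″ * (- d)) + (g * g - g * g) * z
        ≡ r + d * (h * h * q″ - g * g * q)
      eq₂ = solve-∀ ring
      eq : ∀ p p′ p″ q q′ q″ g h d κ → p * p′ - g * g * (q * q′) ≡ - d → p′ * p″ - h * h * (q′ * q″) ≡ - d →
        g ≡ κ * h →
        h * h * p′ * (κ * κ * (p″ * q)) ≡ h * h * p′ * (p * q″) + d * (h * h * q″ - g * g * q)
      eq p p′ p″ q q′ q″ g h d κ e₁ e₂ e₃ = trans (eq₁ p p′ p″ q q′ q″ g h κ) (trans
        (cong₂ (λ u v → h * h * p′ * (p * q″) + (κ * h * (κ * h) * q * u - h * h * q″ * v)
          + (κ * h * (κ * h) - g * g) * (q * (h * h) * (q′ * q″))) e₂ e₁)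
        (trans (cong (λ u → h * h * p′ * (p * q″) + (u * u * q * (- d) - h * h * q″ * (- d))
          + (u * u - g * g) * (q * (h * h) * (q′ * q″))) (sym e₃))
        (eq₂ q q″ g h d (h * h * p′ * (p * q″)) (q * (h * h) * (q′ * q″)))))

  κ : ℕ → ℚ
  κ j = (ℤ.+ suc (2 ℕ.* j)) / suc (suc (2 ℕ.* j))

  κ-spec : ∀ j → κ j * (1ℚ + odd j) ≡ odd j
  κ-spec j = trans (cong (κ j *_) (sym (ι-suc (suc (2 ℕ.* j)))))
    (trans (/-*-ι (ℤ.+ suc (2 ℕ.* j)) (suc (2 ℕ.* j))) (sym (ι≡ℕtoℚ (suc (2 ℕ.* j)))))

  -- C j = (2j choose j) / 4^j
  C : ℕ → ℚ
  C zero    = 1ℚ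
  C (suc j) = C j * κ j

  -- node j = 4j + 1
  node : ℕ → ℚ
  node zero    = 1ℚ
  node (suc j) = node j + 2ℚ + 2ℚ

  node≡ : ∀ j → node j + 1ℚ ≡ 2ℚ * odd j
  node≡ zero = sym (cong (2ℚ *_) ι-1)
  node≡ (suc j) = trans (eq₁ (node j)) (trans (cong (λ t → t + 2ℚ + 2ℚ) (node≡ j))
    (trans (eq₂ (odd j)) (cong (2ℚ *_) (sym (odd-suc j)))))
    where
    eq₁ : ∀ s → s + 2ℚ + 2ℚ + 1ℚ ≡ s + 1ℚ + 2ℚ + 2ℚ
    eq₁ = solve-∀ ring
    eq₂ : ∀ o → 2ℚ * o + 2ℚ + 2ℚ ≡ 2ℚ * (2ℚ + o)
    eq₂ = solve-∀ ring

  0<node : ∀ j → 0ℚ < node j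
  0<node zero = 0<1
  0<node (suc j) = 0<+ (0<+ (0<node j) 0≤2) 0≤2

  -- At s = 4j + 1 the quotient (s + 1) / (s + 3) is (2j + 1) / (2j + 2), so that a shift of s by
  -- four costs the square of one Wallis factor.
  node-κ : ∀ j → node j + 1ℚ ≡ κ j * (node j + 2ℚ + 1ℚ)
  node-κ j = trans (node≡ j) (trans (cong (2ℚ *_) (sym (κ-spec j)))
    (trans (eq₁ (κ j) (odd j)) (trans (cong (λ t → κ j * (t + 2ℚ)) (sym (node≡ j))) (eq₂ (κ j) (node j)))))
    where
    eq₁ : ∀ k o → 2ℚ * (k * (1ℚ + o)) ≡ k * (2ℚ * o + 2ℚ)
    eq₁ = solve-∀ ring
    eq₂ : ∀ k s → k * (s + 1ℚ + 2ℚ) ≡ k * (s + 2ℚ + 1ℚ)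
    eq₂ = solve-∀ ring

  sgnℚ : ℕ → ℚ
  sgnℚ n = (sgn n ℤ.* ℤ.+ 4) / 1

  sgn-suc : ∀ n → sgn (suc n) ≡ ℤ.- sgn n
  sgn-suc zero          = refl
  sgn-suc (suc zero)    = refl
  sgn-suc (suc (suc n)) = sgn-suc n

  sgnℚ-suc : ∀ n → sgnℚ n + sgnℚ (suc n) ≡ 0ℚ
  sgnℚ-suc n = trans (sym (/1-+ (sgn n ℤ.* ℤ.+ 4) (sgn (suc n) ℤ.* ℤ.+ 4)))
    (cong (_/ 1) (trans (cong (λ t → sgn n ℤ.* ℤ.+ 4 ℤ.+ t)
        (trans (cong (ℤ._* ℤ.+ 4) (sgn-suc n)) (sym (ℤ.neg-distribˡ-* (sgn n) (ℤ.+ 4)))))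
      (ℤ.+-inverseʳ (sgn n ℤ.* ℤ.+ 4))))

  leibniz-suc : ∀ n → odd n * leibniz (suc n) ≡ odd n * leibniz n + sgnℚ n
  leibniz-suc n = trans (eq (odd n) (leibniz n) ((sgn n ℤ.* ℤ.+ 4) / suc (2 ℕ.* n)))
    (cong (odd n * leibniz n +_) (/-*-ι (sgn n ℤ.* ℤ.+ 4) (2 ℕ.* n)))
    where
    eq : ∀ o l t → o * (l + t) ≡ o * l + t * o
    eq = solve-∀ ring

  P-one : ∀ n → P 1ℚ (suc n) ≡ odd n * P 1ℚ n
  P-one zero    = sym (trans (*-identityʳ (odd 0)) ι-1)
  P-one (suc n) = trans (cong (λ t → 2ℚ * 1ℚ * P 1ℚ (suc n) + t)
      (trans (*-assoc (odd n) (odd n) (P 1ℚ n)) (cong (odd n *_) (sym (P-one n)))))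
    (trans (eq (odd n) (P 1ℚ (suc n))) (cong (_* P 1ℚ (suc n)) (sym (odd-suc n))))
    where
    eq : ∀ o p → 2ℚ * 1ℚ * p + o * p ≡ (2ℚ + o) * p
    eq = solve-∀ ring

  -- Euler's passage from a series to a continued fraction. Since `P 1ℚ` is a product of odd
  -- numbers, clearing denominators makes two consecutive terms of the alternating series cancel,
  -- and the right side obeys the recurrence of `cf`.
  Q-one : ∀ n → 4ℚ * Q 1ℚ n ≡ P 1ℚ n * leibniz n
  Q-one zero       = refl
  Q-one (suc zero) = refl
  Q-one (suc (suc n)) = eq (odd n) (odd (suc n)) (P 1ℚ n) (P 1ℚ (suc n)) (P 1ℚ (suc (suc n))) (Q 1ℚ n) (Q 1ℚ (suc n))
    (leibniz n) (leibniz (suc n)) (leibniz (suc (suc n))) (sgnℚ n) (sgnℚ (suc n))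
    (Q-one n) (Q-one (suc n)) (P-one n) (P-one (suc n)) (odd-suc n) (leibniz-suc n) (leibniz-suc (suc n)) (sgnℚ-suc n)
    where
    eq₁ : ∀ o p₁ q₀ q₁ → 4ℚ * (2ℚ * 1ℚ * q₁ + o * o * q₀) ≡ 2ℚ * (4ℚ * q₁) + o * o * (4ℚ * q₀)
    eq₁ = solve-∀ ring
    eq₂ : ∀ o p₀ l₀ l₁ l₂ c c′ →
      2ℚ * (o * p₀ * l₁) + o * o * (p₀ * l₀) ≡ (2ℚ + o) * (o * p₀) * l₂
        + (o * p₀ * (((2ℚ + o) * l₁ + c′) - (2ℚ + o) * l₂) + (- (o * p₀)) * (o * l₁ - (o * l₀ + c) + (c + c′)))
    eq₂ = solve-∀ ring
    eq₃ : ∀ a b c d e → a + (b * (c - c) + d * (e - e + 0ℚ)) ≡ a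
    eq₃ = solve-∀ ring
    eq : ∀ o o₁ p₀ p₁ p₂ q₀ q₁ l₀ l₁ l₂ c c′ → 4ℚ * q₀ ≡ p₀ * l₀ → 4ℚ * q₁ ≡ p₁ * l₁ → p₁ ≡ o * p₀ → p₂ ≡ o₁ * p₁ →
      o₁ ≡ 2ℚ + o → o * l₁ ≡ o * l₀ + c → o₁ * l₂ ≡ o₁ * l₁ + c′ → c + c′ ≡ 0ℚ →
      4ℚ * (2ℚ * 1ℚ * q₁ + o * o * q₀) ≡ p₂ * l₂
    eq o _ p₀ _ _ q₀ q₁ l₀ l₁ l₂ c c′ h₁ h₂ refl refl refl h₃ h₄ h₅ = trans (eq₁ o p₀ q₀ q₁)
      (trans (cong₂ (λ u v → 2ℚ * u + o * o * v) h₂ h₁) (trans (eq₂ o p₀ l₀ l₁ l₂ c c′)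
        (trans (cong₂ (λ u v → (2ℚ + o) * (o * p₀) * l₂ + (o * p₀ * u + (- (o * p₀)) * v))
            (cong (_- (2ℚ + o) * l₂) (sym h₄)) (cong₂ _+_ (cong (_- (o * l₀ + c)) h₃) h₅))
          (eq₃ ((2ℚ + o) * (o * p₀) * l₂) (o * p₀) ((2ℚ + o) * l₂) (- (o * p₀)) (o * l₀ + c)))))

  module _ (m : ℕ) where

    private
      N : ℕ
      N = suc (2 ℕ.* m)

      0<P : ∀ {s} → 0ℚ < s → 0ℚ < P s N
      0<P 0<s = cf-pos 0<s 0≤1 0<s (2 ℕ.* m)

      0<Q : ∀ {s} → 0ℚ < s → 0ℚ < Q s N
      0<Q 0<s = cf-pos 0<s ≤-refl 0<1 (2 ℕ.* m)

    -- For the convergents b = P / Q this reads b(1) ≤ C_j² b(4j + 1); the factors κ² of the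
    -- successive shifts accumulate to C_j².
    chain : ∀ j → P 1ℚ N * Q (node j) N ≤ C j * C j * (P (node j) N * Q 1ℚ N)
    chain zero    = ≤-reflexive (sym (*-identityˡ (P 1ℚ N * Q 1ℚ N)))
    chain (suc j) = *-cancelˡ (0<Q (0<node j)) (≤-trans
      (≤-trans (≤-reflexive (eq₁ q (P 1ℚ N) q⁺)) (*-monoˡ (<⇒≤ (0<Q (0<node (suc j)))) (chain j)))
      (≤-trans (≤-reflexive (eq₂ q⁺ (C j) (P (node j) N) (Q 1ℚ N)))
      (≤-trans (*-monoˡ (0≤* (0≤² (C j)) (<⇒≤ (0<Q 0<1))) (shift m (node j) (κ j) (0<node j) (node-κ j)))
        (≤-reflexive (eq₃ q (P (node (suc j)) N) (C j) (κ j) (Q 1ℚ N))))))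
      where
      q = Q (node j) N
      q⁺ = Q (node (suc j)) N
      eq₁ : ∀ q p r → q * (p * r) ≡ r * (p * q)
      eq₁ = solve-∀ ring
      eq₂ : ∀ r c p q → r * (c * c * (p * q)) ≡ c * c * q * (p * r)
      eq₂ = solve-∀ ring
      eq₃ : ∀ q p c k r → c * c * r * (k * k * (p * q)) ≡ q * (c * k * (c * k) * (p * r))
      eq₃ = solve-∀ ring

    -- By `chain` and `P≤`, 4 / `leibniz N` = b(1) ≤ C_j² (4j + 2). The odd index N is exactly the
    -- kind of partial sum that `GreaterThanπ` provides.
    wallis : ∀ j → 2ℚ ≤ C j * C j * odd j * leibniz N
    wallis j = *-cancelˡ (0<* 0<2 (0<* (0<P 0<1) (0<Q (0<node j)))) (begin
      2ℚ * (p * q) * 2ℚ                           ≡⟨ eq₁ p q ⟩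
      4ℚ * (p * q)                                ≤⟨ *-monoˡ 0≤4 (chain j) ⟩
      4ℚ * (c * (P (node j) N * Q 1ℚ N))           ≡⟨ eq₂ c (P (node j) N) (Q 1ℚ N) ⟩
      c * (4ℚ * Q 1ℚ N) * P (node j) N             ≤⟨ *-monoˡ 0≤cq (P≤ m (node j) (0<node j)) ⟩
      c * (4ℚ * Q 1ℚ N) * ((node j + 1ℚ) * q)      ≡⟨ cong₂ (λ u v → c * u * (v * q)) (Q-one N) (node≡ j) ⟩
      c * (p * leibniz N) * (2ℚ * odd j * q)      ≡⟨ eq₃ c p (leibniz N) (odd j) q ⟩
      2ℚ * (p * q) * (c * odd j * leibniz N)      ∎)
      where
      open ≤-Reasoning
      p = P 1ℚ N
      q = Q (node j) N
      c = C j * C j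
      0≤4 : 0ℚ ≤ 4ℚ
      0≤4 = nonNegative⁻¹ 4ℚ
      0≤cq : 0ℚ ≤ c * (4ℚ * Q 1ℚ N)
      0≤cq = 0≤* (0≤² (C j)) (0≤* 0≤4 (<⇒≤ (0<Q 0<1)))
      eq₁ : ∀ p q → 2ℚ * (p * q) * 2ℚ ≡ 4ℚ * (p * q)
      eq₁ = solve-∀ ring
      eq₂ : ∀ c p q → 4ℚ * (c * (p * q)) ≡ c * (4ℚ * q) * p
      eq₂ = solve-∀ ring
      eq₃ : ∀ c p l o q → c * (p * l) * (2ℚ * o * q) ≡ 2ℚ * (p * q) * (c * o * l)
      eq₃ = solve-∀ ring

  -- The dual trigonometric polynomial

  infixr 8 _↑_
  _↑_ : ℚ → ℕ → ℚ
  x ↑ zero  = 1ℚ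
  x ↑ suc n = x * x ↑ n

  ↑-+ : ∀ x m n → x ↑ (m ℕ.+ n) ≡ x ↑ m * x ↑ n
  ↑-+ x zero    n = sym (*-identityˡ (x ↑ n))
  ↑-+ x (suc m) n = trans (cong (x *_) (↑-+ x m n)) (sym (*-assoc x (x ↑ m) (x ↑ n)))

  0≤↑ : ∀ {x} → 0ℚ ≤ x → ∀ n → 0ℚ ≤ x ↑ n
  0≤↑ 0≤x zero    = 0≤1
  0≤↑ 0≤x (suc n) = 0≤* 0≤x (0≤↑ 0≤x n)

  ↑≤1 : ∀ {x} → 0ℚ ≤ x → x ≤ 1ℚ → ∀ n → x ↑ n ≤ 1ℚ
  ↑≤1 0≤x x≤1 zero    = ≤-refl
  ↑≤1 {x} 0≤x x≤1 (suc n) = subst (x * x ↑ n ≤_) (*-identityˡ 1ℚ) (*-mono 0≤x 0≤1 x≤1 (↑≤1 0≤x x≤1 n))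

  ∑ : ℕ → (ℕ → ℚ) → ℚ
  ∑ zero    f = 0ℚ
  ∑ (suc n) f = f 0 + ∑ n (f ∘ suc)

  ∑-cong : ∀ n {f g : ℕ → ℚ} → (∀ i → f i ≡ g i) → ∑ n f ≡ ∑ n g
  ∑-cong zero    f≡g = refl
  ∑-cong (suc n) f≡g = cong₂ _+_ (f≡g 0) (∑-cong n (f≡g ∘ suc))

  ∑-mono : ∀ n {f g : ℕ → ℚ} → (∀ i → i ℕ.< n → f i ≤ g i) → ∑ n f ≤ ∑ n g
  ∑-mono zero    f≤g = ≤-refl
  ∑-mono (suc n) f≤g = +-mono-≤ (f≤g 0 (ℕ.s≤s ℕ.z≤n)) (∑-mono n (λ i i<n → f≤g (suc i) (ℕ.s≤s i<n)))

  ∑-nonNeg : ∀ n {f : ℕ → ℚ} → (∀ i → 0ℚ ≤ f i) → 0ℚ ≤ ∑ n f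
  ∑-nonNeg zero    0≤f = ≤-refl
  ∑-nonNeg (suc n) 0≤f = 0≤+ (0≤f 0) (∑-nonNeg n (0≤f ∘ suc))

  ∑-last : ∀ n f → ∑ (suc n) f ≡ ∑ n f + f n
  ∑-last zero    f = +-comm (f 0) 0ℚ
  ∑-last (suc n) f = trans (cong (f 0 +_) (∑-last n (f ∘ suc))) (sym (+-assoc (f 0) (∑ n (f ∘ suc)) (f (suc n))))

  ∑-*ˡ : ∀ n c f → c * ∑ n f ≡ ∑ n (λ i → c * f i)
  ∑-*ˡ zero    c f = *-zeroʳ c
  ∑-*ˡ (suc n) c f = trans (*-distribˡ-+ c (f 0) (∑ n (f ∘ suc))) (cong (c * f 0 +_) (∑-*ˡ n c (f ∘ suc)))

  ∑-+ : ∀ n f g → ∑ n (λ i → f i + g i) ≡ ∑ n f + ∑ n g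
  ∑-+ zero    f g = refl
  ∑-+ (suc n) f g = trans (cong (f 0 + g 0 +_) (∑-+ n (f ∘ suc) (g ∘ suc))) (eq (f 0) (g 0) (∑ n (f ∘ suc)) (∑ n (g ∘ suc)))
    where
    eq : ∀ a b c d → a + b + (c + d) ≡ a + c + (b + d)
    eq = solve-∀ ring

  ∑-++ : ∀ m n f → ∑ (m ℕ.+ n) f ≡ ∑ m f + ∑ n (λ i → f (m ℕ.+ i))
  ∑-++ zero    n f = sym (+-identityˡ (∑ n f))
  ∑-++ (suc m) n f = trans (cong (f 0 +_) (∑-++ m n (f ∘ suc))) (sym (+-assoc (f 0) (∑ m (f ∘ suc)) (∑ n (λ i → f (suc (m ℕ.+ i))))))

  ∑-≤-++ : ∀ m n f → (∀ i → 0ℚ ≤ f i) → ∑ m f ≤ ∑ (m ℕ.+ n) f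
  ∑-≤-++ m n f 0≤f = by-diff (∑-nonNeg n (λ i → 0≤f (m ℕ.+ i))) (∑-++ m n f)

  -- Antidiagonal sums and the square of the series for 1 / √(1 - x)

  antidiag : ℕ → (ℕ → ℕ → ℚ) → ℚ
  antidiag zero    g = g 0 0
  antidiag (suc n) g = g 0 (suc n) + antidiag n (g ∘ suc)

  antidiag-cong : ∀ n {g h : ℕ → ℕ → ℚ} → (∀ i j → i ℕ.+ j ≡ n → g i j ≡ h i j) → antidiag n g ≡ antidiag n h
  antidiag-cong zero    g≡h = g≡h 0 0 refl
  antidiag-cong (suc n) g≡h = cong₂ _+_ (g≡h 0 (suc n) refl) (antidiag-cong n (λ i j eq → g≡h (suc i) j (cong suc eq)))

  antidiag-+ : ∀ n g h → antidiag n (λ i j → g i j + h i j) ≡ antidiag n g + antidiag n h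
  antidiag-+ zero    g h = refl
  antidiag-+ (suc n) g h = trans (cong (g 0 (suc n) + h 0 (suc n) +_) (antidiag-+ n (g ∘ suc) (h ∘ suc)))
    (eq (g 0 (suc n)) (h 0 (suc n)) (antidiag n (g ∘ suc)) (antidiag n (h ∘ suc)))
    where
    eq : ∀ a b c d → a + b + (c + d) ≡ a + c + (b + d)
    eq = solve-∀ ring

  antidiag-*ˡ : ∀ n c g → antidiag n (λ i j → c * g i j) ≡ c * antidiag n g
  antidiag-*ˡ zero    c g = refl
  antidiag-*ˡ (suc n) c g = trans (cong (c * g 0 (suc n) +_) (antidiag-*ˡ n c (g ∘ suc)))
    (sym (*-distribˡ-+ c (g 0 (suc n)) (antidiag n (g ∘ suc))))

  antidiag-last : ∀ n g → antidiag (suc n) g ≡ antidiag n (λ i j → g i (suc j)) + g (suc n) 0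
  antidiag-last zero    g = refl
  antidiag-last (suc n) g = trans (cong (g 0 (suc (suc n)) +_) (antidiag-last n (g ∘ suc)))
    (sym (+-assoc (g 0 (suc (suc n))) (antidiag n (λ i j → g (suc i) (suc j))) (g (suc (suc n)) 0)))

  antidiag-flip : ∀ n g → antidiag n (λ i j → g j i) ≡ antidiag n g
  antidiag-flip zero    g = refl
  antidiag-flip (suc n) g = trans (+-comm (g (suc n) 0) (antidiag n (λ i j → g j (suc i))))
    (trans (cong (_+ g (suc n) 0) (antidiag-flip n (λ i j → g i (suc j)))) (sym (antidiag-last n g)))

  C-suc : ∀ j → 2ℚ * ι (suc j) * C (suc j) ≡ odd j * C j
  C-suc j = trans (cong (λ t → 2ℚ * t * (C j * κ j)) (ι-suc j)) (eq (ι j) (odd j) (C j) (κ j) (odd≡ j) (κ-spec j))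
    where
    eq₁ : ∀ ν c k → 2ℚ * (1ℚ + ν) * (c * k) ≡ k * (1ℚ + (1ℚ + 2ℚ * ν)) * c
    eq₁ = solve-∀ ring
    eq : ∀ ν o c k → o ≡ 1ℚ + 2ℚ * ν → k * (1ℚ + o) ≡ o → 2ℚ * (1ℚ + ν) * (c * k) ≡ o * c
    eq ν _ c k refl h = trans (eq₁ ν c k) (cong (_* c) h)

  CC : ℕ → ℕ → ℚ
  CC i j = C i * C j

  -- Weighting the terms by i + j = n and using the recurrence for C reduces n + 1 to n.
  convolution : ∀ n → antidiag n CC ≡ 1ℚ
  convolution zero    = refl
  convolution (suc n) = ≤-antisym
    (*-cancelˡ (0<ι-suc n) (≤-reflexive eq)) (*-cancelˡ (0<ι-suc n) (≤-reflexive (sym eq)))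
    where
    weighted : ∀ m → ι m * antidiag m CC ≡ antidiag m (λ i j → ι i * CC i j) + antidiag m (λ i j → ι i * CC i j)
    weighted m = begin
      ι m * antidiag m CC                                                     ≡⟨ antidiag-*ˡ m (ι m) CC ⟨
      antidiag m (λ i j → ι m * CC i j)                                       ≡⟨ antidiag-cong m split ⟩
      antidiag m (λ i j → ι i * CC i j + ι j * CC j i)                        ≡⟨ antidiag-+ m (λ i j → ι i * CC i j)
          (λ i j → ι j * CC j i) ⟩
      antidiag m (λ i j → ι i * CC i j) + antidiag m (λ i j → ι j * CC j i)   ≡⟨ cong (antidiag m (λ i j → ι i * CC i j) +_)
          (antidiag-flip m (λ i j → ι i * CC i j)) ⟩
      antidiag m (λ i j → ι i * CC i j) + antidiag m (λ i j → ι i * CC i j)   ∎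
      where
      open ≡-Reasoning
      eq₁ : ∀ a b c d → (a + b) * (c * d) ≡ a * (c * d) + b * (d * c)
      eq₁ = solve-∀ ring
      split : ∀ i j → i ℕ.+ j ≡ m → ι m * CC i j ≡ ι i * CC i j + ι j * CC j i
      split i j refl = trans (cong (_* CC i j) (ι-+ i j)) (eq₁ (ι i) (ι j) (C i) (C j))

    lowered : antidiag (suc n) (λ i j → ι i * CC i j) + antidiag (suc n) (λ i j → ι i * CC i j) ≡ antidiag n (λ i j → odd i * CC i j)
    lowered = trans (cong (λ t → t + t) (trans (cong (_+ antidiag n (λ i j → ι (suc i) * CC (suc i) j)) (trans (cong (_* CC 0
        (suc n)) ι-0) (*-zeroˡ (CC 0 (suc n)))))
        (+-identityˡ (antidiag n (λ i j → ι (suc i) * CC (suc i) j)))))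
      (trans (sym (antidiag-+ n (λ i j → ι (suc i) * CC (suc i) j) (λ i j → ι (suc i) * CC (suc i) j)))
        (antidiag-cong n (λ i j _ → trans (eq₁ (ι (suc i)) (C (suc i)) (C j)) (trans (cong (_* C j) (C-suc i)) (*-assoc (odd i)
            (C i) (C j))))))
      where
      eq₁ : ∀ a c d → a * (c * d) + a * (c * d) ≡ 2ℚ * a * c * d
      eq₁ = solve-∀ ring

    raised : antidiag n (λ i j → odd i * CC i j) ≡ antidiag n CC + ι n * antidiag n CC
    raised = trans (antidiag-cong n (λ i j _ → trans (cong (_* CC i j) (odd≡ i)) (eq₁ (ι i) (CC i j))))
      (trans (antidiag-+ n CC (λ i j → ι i * CC i j + ι i * CC i j)) (cong (antidiag n CC +_)
        (trans (antidiag-+ n (λ i j → ι i * CC i j) (λ i j → ι i * CC i j)) (sym (weighted n)))))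
      where
      eq₁ : ∀ a c → (1ℚ + 2ℚ * a) * c ≡ c + (a * c + a * c)
      eq₁ = solve-∀ ring

    eq : ι (suc n) * antidiag (suc n) CC ≡ ι (suc n) * 1ℚ
    eq = trans (weighted (suc n)) (trans lowered (trans raised (trans
      (cong (λ t → t + ι n * t) (convolution n)) (eq₁ (ι n) (ι (suc n)) (ι-suc n)))))
      where
      eq₂ : ∀ a → 1ℚ + a * 1ℚ ≡ (1ℚ + a) * 1ℚ
      eq₂ = solve-∀ ring
      eq₁ : ∀ a b → b ≡ 1ℚ + a → 1ℚ + a * 1ℚ ≡ b * 1ℚ
      eq₁ a _ refl = eq₂ a

  triangle : ℕ → (ℕ → ℕ → ℚ) → ℚ
  triangle zero    g = 0ℚ
  triangle (suc n) g = ∑ (suc n) (g 0) + triangle n (g ∘ suc)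

  triangle-antidiag : ∀ n g → triangle n g ≡ ∑ n (λ m → antidiag m g)
  triangle-antidiag zero    g = refl
  triangle-antidiag (suc n) g = trans
    (cong (g 0 0 + ∑ n (g 0 ∘ suc) +_) (triangle-antidiag n (g ∘ suc)))
    (trans (+-assoc (g 0 0) (∑ n (g 0 ∘ suc)) (∑ n (λ m → antidiag m (g ∘ suc))))
      (cong (g 0 0 +_) (sym (∑-+ n (g 0 ∘ suc) (λ m → antidiag m (g ∘ suc))))))

  rectangle≤triangle : ∀ m n g → (∀ i j → 0ℚ ≤ g i j) → ∑ m (λ i → ∑ n (g i)) ≤ triangle (m ℕ.+ n) g
  rectangle≤triangle zero zero g 0≤g = ≤-refl
  rectangle≤triangle zero (suc n) g 0≤g = 0≤+ (∑-nonNeg (suc n) (0≤g 0)) (rectangle≤triangle zero n (g ∘ suc) (0≤g ∘ suc))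
  rectangle≤triangle (suc m) n g 0≤g = +-mono-≤
    (subst (λ i → ∑ n (g 0) ≤ ∑ i (g 0)) (trans (ℕ.+-suc n m) (cong suc (ℕ.+-comm n m))) (∑-≤-++ n (suc m) (g 0) (0≤g 0)))
    (rectangle≤triangle m n (g ∘ suc) (0≤g ∘ suc))

  geometric : ∀ x n → (1ℚ - x) * ∑ n (x ↑_) ≡ 1ℚ - x ↑ n
  geometric x zero = eq x
    where
    eq : ∀ x → (1ℚ - x) * 0ℚ ≡ 1ℚ - 1ℚ
    eq = solve-∀ ring
  geometric x (suc n) = trans (cong ((1ℚ - x) *_) (∑-last n (x ↑_))) (trans
    (*-distribˡ-+ (1ℚ - x) (∑ n (x ↑_)) (x ↑ n)) (trans (cong (_+ (1ℚ - x) * x ↑ n) (geometric x n)) (eq x (x ↑ n))))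
    where
    eq : ∀ x y → 1ℚ - y + (1ℚ - x) * y ≡ 1ℚ - x * y
    eq = solve-∀ ring

  -- Taylor polynomials of 1 / √(1 - x), and of 1 - √(1 - x)
  V W : ℕ → ℚ → ℚ
  V j x = ∑ j (λ i → C i * x ↑ i)
  W j x = ∑ j (λ i → (C i - C (suc i)) * x ↑ suc i)

  0≤odd : ∀ j → 0ℚ ≤ odd j
  0≤odd j = <⇒≤ (0<odd j)

  0<κ : ∀ j → 0ℚ < κ j
  0<κ j = *-cancelˡ-< (0≤+ 0≤1 (0≤odd j)) (subst₂ _<_ (sym (*-zeroʳ (1ℚ + odd j))) (trans (sym (κ-spec j)) (*-comm (κ j)
      (1ℚ + odd j))) (0<odd j))

  0<C : ∀ j → 0ℚ < C j
  0<C zero    = 0<1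
  0<C (suc j) = 0<* (0<C j) (0<κ j)

  -- The square of index pairs below j lies in the triangle i + k < 2j, and all terms are
  -- nonnegative. On each antidiagonal `convolution` leaves a plain power of x, as the full series
  -- squares to 1 / (1 - x).
  V² : ∀ j x → 0ℚ ≤ x → V j x * V j x ≤ ∑ (j ℕ.+ j) (x ↑_)
  V² j x 0≤x = begin
    V j x * V j x                          ≡⟨ ∑-*ˡ j (V j x) a ⟩
    ∑ j (λ i → V j x * a i)                ≡⟨ ∑-cong j (λ i → trans (*-comm (V j x) (a i)) (∑-*ˡ j (a i) a)) ⟩
    ∑ j (λ i → ∑ j (λ k → a i * a k))      ≤⟨ rectangle≤triangle j j (λ i k → a i * a k) (λ i k → 0≤* (0≤a i) (0≤a k)) ⟩
    triangle (j ℕ.+ j) (λ i k → a i * a k) ≡⟨ triangle-antidiag (j ℕ.+ j) (λ i k → a i * a k) ⟩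
    ∑ (j ℕ.+ j) (λ n → antidiag n (λ i k → a i * a k)) ≡⟨ ∑-cong (j ℕ.+ j) diagonal ⟩
    ∑ (j ℕ.+ j) (x ↑_)                     ∎
    where
    open ≤-Reasoning
    a : ℕ → ℚ
    a i = C i * x ↑ i
    0≤a : ∀ i → 0ℚ ≤ a i
    0≤a i = 0≤* (<⇒≤ (0<C i)) (0≤↑ 0≤x i)
    eq : ∀ a b c d → a * b * (c * d) ≡ b * d * (a * c)
    eq = solve-∀ ring
    diagonal : ∀ n → antidiag n (λ i k → a i * a k) ≡ x ↑ n
    diagonal n = trans (antidiag-cong n (λ i k i+k≡n → trans (eq (C i) (x ↑ i) (C k) (x ↑ k))
        (cong (_* CC i k) (trans (sym (↑-+ x i k)) (cong (x ↑_) i+k≡n)))))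
      (trans (antidiag-*ˡ n (x ↑ n) CC) (trans (cong (x ↑ n *_) (convolution n)) (*-identityʳ (x ↑ n))))

  -- Truncation of 1 - √(1 - x) = 1 - (1 - x) / √(1 - x); only the boundary term `C j * x ↑ j`
  -- survives.
  W≡ : ∀ j x → W j x ≡ 1ℚ - (1ℚ - x) * V j x - C j * x ↑ j
  W≡ zero x = eq x
    where
    eq : ∀ x → 0ℚ ≡ 1ℚ - (1ℚ - x) * 0ℚ - 1ℚ * 1ℚ
    eq = solve-∀ ring
  W≡ (suc j) x = trans (∑-last j (λ i → (C i - C (suc i)) * x ↑ suc i)) (trans
    (cong (_+ (C j - C (suc j)) * x ↑ suc j) (W≡ j x)) (trans (eq x (V j x) (C j) (C (suc j)) (x ↑ j))
      (cong (λ t → 1ℚ - (1ℚ - x) * t - C (suc j) * x ↑ suc j) (sym (∑-last j (λ i → C i * x ↑ i))))))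
    where
    eq : ∀ x v c d y → 1ℚ - (1ℚ - x) * v - c * y + (c - d) * (x * y) ≡ 1ℚ - (1ℚ - x) * (v + c * y) - d * (x * y)
    eq = solve-∀ ring

  -- As 1 - c² = s², the right side exceeds the left by s (1 - s V) + C_j (1 - c^(2j)). Here s V ≤
  -- 1, since s² V² is at most s² times a truncated geometric series in c². The sign of s enters in
  -- the first term.
  certificate : ∀ j c s → c * c + s * s ≡ 1ℚ → 0ℚ ≤ s → 1ℚ - C j ≤ s + W j (c * c)
  certificate j c s c²+s²≡1 0≤s = by-diff (0≤+ (0≤* 0≤s (0≤diff sV≤1)) (0≤* (<⇒≤ (0<C j)) (0≤diff (↑≤1 (0≤² c) x≤1 j))))
    (trans (cong (s +_) (W≡ j c²)) (trans (cong (λ t → s + (1ℚ - t * V j c² - C j * c² ↑ j)) 1-x≡)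
      (eq s (V j c²) (C j) (c² ↑ j))))
    where
    c² : ℚ
    c² = c * c
    eq₁ : ∀ x y → 1ℚ - x ≡ y + - 1ℚ * (x + y - 1ℚ)
    eq₁ = solve-∀ ring
    1-x≡ : 1ℚ - c² ≡ s * s
    1-x≡ = ≡-by c²+s²≡1 (- 1ℚ) (eq₁ c² (s * s))
    x≤1 : c² ≤ 1ℚ
    x≤1 = by-diff (0≤² s) (sym c²+s²≡1)
    eq₂ : ∀ s v → s * v * (s * v) ≡ s * s * (v * v)
    eq₂ = solve-∀ ring
    sV≤1 : s * V j c² ≤ 1ℚ
    sV≤1 = ≤-from-² 0≤1 (begin
      s * V j c² * (s * V j c²)             ≡⟨ eq₂ s (V j c²) ⟩
      s * s * (V j c² * V j c²)             ≤⟨ *-monoˡ (0≤² s) (V² j c² (0≤² c)) ⟩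
      s * s * ∑ (j ℕ.+ j) (c² ↑_)          ≡⟨ cong (_* ∑ (j ℕ.+ j) (c² ↑_)) 1-x≡ ⟨
      (1ℚ - c²) * ∑ (j ℕ.+ j) (c² ↑_)       ≡⟨ geometric c² (j ℕ.+ j) ⟩
      1ℚ - c² ↑ (j ℕ.+ j)                  ≤⟨ by-diff (0≤↑ (0≤² c) (j ℕ.+ j)) (eq₃ (c² ↑ (j ℕ.+ j))) ⟩
      1ℚ * 1ℚ                             ∎)
      where
      open ≤-Reasoning
      eq₃ : ∀ y → 1ℚ * 1ℚ ≡ 1ℚ - y + y
      eq₃ = solve-∀ ring
    eq : ∀ s v c y → s + (1ℚ - s * s * v - c * y) ≡ 1ℚ - c + (s * (1ℚ - s * v) + c * (1ℚ - y))
    eq = solve-∀ ring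

  -- Complex numbers with rational coordinates, and sums over lists

  record 𝔾 : Set where
    constructor _,i_
    field
      re im : ℚ

  open 𝔾

  𝟙 : 𝔾
  𝟙 = 1ℚ ,i 0ℚ

  infixl 7 _⊗_
  infixl 6 _⊖_

  _⊗_ : 𝔾 → 𝔾 → 𝔾
  u ⊗ v = (re u * re v - im u * im v) ,i (re u * im v + im u * re v)

  _⊖_ : 𝔾 → 𝔾 → 𝔾
  u ⊖ v = (re u - re v) ,i (im u - im v)

  conj : 𝔾 → 𝔾
  conj u = re u ,i (- im u)

  norm : 𝔾 → ℚ
  norm u = re u * re u + im u * im u

  infixr 8 _^_
  _^_ : 𝔾 → ℕ → 𝔾
  u ^ zero  = 𝟙
  u ^ suc n = u ⊗ u ^ n

  ⊗-assoc : ∀ u v w → u ⊗ v ⊗ w ≡ u ⊗ (v ⊗ w)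
  ⊗-assoc u v w = cong₂ _,i_ (eq₁ (re u) (im u) (re v) (im v) (re w) (im w)) (eq₂ (re u) (im u) (re v) (im v) (re w) (im w))
    where
    eq₁ : ∀ a b c d e f → (a * c - b * d) * e - (a * d + b * c) * f ≡ a * (c * e - d * f) - b * (c * f + d * e)
    eq₁ = solve-∀ ring
    eq₂ : ∀ a b c d e f → (a * c - b * d) * f + (a * d + b * c) * e ≡ a * (c * f + d * e) + b * (c * e - d * f)
    eq₂ = solve-∀ ring

  ⊗-comm : ∀ u v → u ⊗ v ≡ v ⊗ u
  ⊗-comm u v = cong₂ _,i_ (eq₁ (re u) (im u) (re v) (im v)) (eq₂ (re u) (im u) (re v) (im v))
    where
    eq₁ : ∀ a b c d → a * c - b * d ≡ c * a - d * b
    eq₁ = solve-∀ ring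
    eq₂ : ∀ a b c d → a * d + b * c ≡ c * b + d * a
    eq₂ = solve-∀ ring

  ⊗-identityˡ : ∀ u → 𝟙 ⊗ u ≡ u
  ⊗-identityˡ u = cong₂ _,i_ (eq₁ (re u) (im u)) (eq₂ (re u) (im u))
    where
    eq₁ : ∀ a b → 1ℚ * a - 0ℚ * b ≡ a
    eq₁ = solve-∀ ring
    eq₂ : ∀ a b → 1ℚ * b + 0ℚ * a ≡ b
    eq₂ = solve-∀ ring

  ^-+ : ∀ u m n → u ^ (m ℕ.+ n) ≡ u ^ m ⊗ u ^ n
  ^-+ u zero    n = sym (⊗-identityˡ (u ^ n))
  ^-+ u (suc m) n = trans (cong (u ⊗_) (^-+ u m n)) (sym (⊗-assoc u (u ^ m) (u ^ n)))

  ^-* : ∀ u m n → u ^ (m ℕ.* n) ≡ (u ^ n) ^ m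
  ^-* u zero    n = refl
  ^-* u (suc m) n = trans (^-+ u n (m ℕ.* n)) (cong (u ^ n ⊗_) (^-* u m n))

  norm-⊗ : ∀ u v → norm (u ⊗ v) ≡ norm u * norm v
  norm-⊗ u v = eq (re u) (im u) (re v) (im v)
    where
    eq : ∀ a b c d → (a * c - b * d) * (a * c - b * d) + (a * d + b * c) * (a * d + b * c) ≡ (a * a + b * b) * (c * c + d * d)
    eq = solve-∀ ring

  norm-^ : ∀ {u} → norm u ≡ 1ℚ → ∀ n → norm (u ^ n) ≡ 1ℚ
  norm-^ h zero    = refl
  norm-^ {u} h (suc n) = trans (norm-⊗ u (u ^ n)) (cong₂ _*_ h (norm-^ h n))

  norm-conj : ∀ u → norm (conj u) ≡ norm u
  norm-conj u = eq (re u) (im u)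
    where
    eq : ∀ a b → a * a + - b * - b ≡ a * a + b * b
    eq = solve-∀ ring

  0≤norm : ∀ u → 0ℚ ≤ norm u
  0≤norm u = 0≤+ (0≤² (re u)) (0≤² (im u))

  re²≤norm : ∀ u → re u * re u ≤ norm u
  re²≤norm u = by-diff (0≤² (im u)) refl

  im²≤norm : ∀ u → im u * im u ≤ norm u
  im²≤norm u = by-diff (0≤² (re u)) (+-comm (re u * re u) (im u * im u))

  re-unit : ∀ u v → norm v ≡ 1ℚ → re (u ⊗ v ⊗ conj v) ≡ re u
  re-unit u v h = ≡-by h (re u) (eq (re u) (im u) (re v) (im v))
    where
    eq : ∀ a b c d → (a * c - b * d) * c - (a * d + b * c) * - d ≡ a + a * (c * c + d * d - 1ℚ)
    eq = solve-∀ ring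

  ∑ₗ : ∀ {X : Set} → List X → (X → ℚ) → ℚ
  ∑ₗ []       f = 0ℚ
  ∑ₗ (a ∷ as) f = f a + ∑ₗ as f

  module _ {X : Set} where

    ∑ₗ-cong : ∀ (as : List X) {f g : X → ℚ} → (∀ a → f a ≡ g a) → ∑ₗ as f ≡ ∑ₗ as g
    ∑ₗ-cong []       f≡g = refl
    ∑ₗ-cong (a ∷ as) f≡g = cong₂ _+_ (f≡g a) (∑ₗ-cong as f≡g)

    ∑ₗ-mono : ∀ (as : List X) {f g : X → ℚ} → (∀ {a} → a ∈ as → f a ≤ g a) → ∑ₗ as f ≤ ∑ₗ as g
    ∑ₗ-mono []       f≤g = ≤-refl
    ∑ₗ-mono (a ∷ as) f≤g = +-mono-≤ (f≤g (here refl)) (∑ₗ-mono as (f≤g ∘ there))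

    ∑ₗ-++ : ∀ (as bs : List X) f → ∑ₗ (as ++ bs) f ≡ ∑ₗ as f + ∑ₗ bs f
    ∑ₗ-++ []       bs f = sym (+-identityˡ (∑ₗ bs f))
    ∑ₗ-++ (a ∷ as) bs f = trans (cong (f a +_) (∑ₗ-++ as bs f)) (sym (+-assoc (f a) (∑ₗ as f) (∑ₗ bs f)))

    ∑ₗ-nonNeg : ∀ (as : List X) {f : X → ℚ} → (∀ a → 0ℚ ≤ f a) → 0ℚ ≤ ∑ₗ as f
    ∑ₗ-nonNeg []       0≤f = ≤-refl
    ∑ₗ-nonNeg (a ∷ as) 0≤f = 0≤+ (0≤f a) (∑ₗ-nonNeg as 0≤f)

    ∑ₗ-+ : ∀ (as : List X) (f g : X → ℚ) → ∑ₗ as (λ a → f a + g a) ≡ ∑ₗ as f + ∑ₗ as g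
    ∑ₗ-+ []       f g = refl
    ∑ₗ-+ (a ∷ as) f g = trans (cong (f a + g a +_) (∑ₗ-+ as f g)) (eq (f a) (g a) (∑ₗ as f) (∑ₗ as g))
      where
      eq : ∀ a b c d → a + b + (c + d) ≡ a + c + (b + d)
      eq = solve-∀ ring

    ∑ₗ-*ˡ : ∀ (as : List X) c (f : X → ℚ) → ∑ₗ as (λ a → c * f a) ≡ c * ∑ₗ as f
    ∑ₗ-*ˡ []       c f = sym (*-zeroʳ c)
    ∑ₗ-*ˡ (a ∷ as) c f = trans (cong (c * f a +_) (∑ₗ-*ˡ as c f)) (sym (*-distribˡ-+ c (f a) (∑ₗ as f)))

    ∑ₗ-const : ∀ (as : List X) c → ∑ₗ as (λ _ → c) ≡ c * ι (length as)
    ∑ₗ-const []       c = sym (trans (cong (c *_) ι-0) (*-zeroʳ c))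
    ∑ₗ-const (a ∷ as) c = trans (cong (c +_) (∑ₗ-const as c)) (trans (eq c (ι (length as))) (cong (c *_) (sym (ι-suc (length as)))))
      where
      eq : ∀ c n → c + c * n ≡ c * (1ℚ + n)
      eq = solve-∀ ring

    ∑ₗ-swap : ∀ (as : List X) n (f : ℕ → X → ℚ) → ∑ₗ as (λ a → ∑ n (λ i → f i a)) ≡ ∑ n (λ i → ∑ₗ as (f i))
    ∑ₗ-swap as zero    f = trans (∑ₗ-const as 0ℚ) (*-zeroˡ (ι (length as)))
    ∑ₗ-swap as (suc n) f = trans (∑ₗ-+ as (f 0) (λ a → ∑ n (λ i → f (suc i) a))) (cong (∑ₗ as (f 0) +_) (∑ₗ-swap as n (f ∘ suc)))

  -- Constant terms of powers of the cosine

  fact invFact : ℕ → ℚ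
  fact zero    = 1ℚ
  fact (suc n) = ι (suc n) * fact n
  invFact zero    = 1ℚ
  invFact (suc n) = invFact n * ((ℤ.+ 1) / suc n)

  invFact-suc : ∀ n → ι (suc n) * invFact (suc n) ≡ invFact n
  invFact-suc n = trans (eq (ι (suc n)) (invFact n) ((ℤ.+ 1) / suc n))
    (trans (cong (invFact n *_) (/-*-ι (ℤ.+ 1) n)) (*-identityʳ (invFact n)))
    where
    eq : ∀ a b c → a * (b * c) ≡ b * (c * a)
    eq = solve-∀ ring

  fact-invFact : ∀ n → fact n * invFact n ≡ 1ℚ
  fact-invFact zero = refl
  fact-invFact (suc n) = trans (eq (ι (suc n)) (fact n) (invFact (suc n)))
    (trans (cong (fact n *_) (invFact-suc n)) (fact-invFact n))
    where
    eq : ∀ a b c → a * b * c ≡ b * (a * c)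
    eq = solve-∀ ring

  -- β u v = (u + v choose u) / 2 ^ (u + v)
  β : ℕ → ℕ → ℚ
  β u v = fact (u ℕ.+ v) * ½ ↑ (u ℕ.+ v) * (invFact u * invFact v)

  β-sym : ∀ u v → β u v ≡ β v u
  β-sym u v = cong₂ (λ m t → fact m * ½ ↑ m * t) (ℕ.+-comm u v) (*-comm (invFact u) (invFact v))

  β-0 : ∀ v → β 0 v ≡ ½ ↑ v
  β-0 v = trans (eq (fact v) (½ ↑ v) (invFact v)) (trans (cong (½ ↑ v *_) (fact-invFact v)) (*-identityʳ (½ ↑ v)))
    where
    eq : ∀ f h g → f * h * (1ℚ * g) ≡ h * (f * g)
    eq = solve-∀ ring

  β-edge : ∀ v → β 0 (suc v) ≡ ½ * β 0 v
  β-edge v = trans (β-0 (suc v)) (cong (½ *_) (sym (β-0 v)))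

  β-pascal : ∀ u v → β (suc u) (suc v) ≡ ½ * (β u (suc v) + β (suc u) v)
  β-pascal u v = trans
    (eq (ι (suc u)) (ι (suc v)) _ (fact m) (½ ↑ m) _ (invFact (suc u)) _ (invFact (suc v))
      (ι-+ (suc u) (suc v))
      (invFact-suc u) (invFact-suc v))
    (cong (λ i → ½ * (β u (suc v) + fact i * ½ ↑ i * (invFact (suc u) * invFact v))) (ℕ.+-suc u v))
    where
    m = u ℕ.+ suc v
    eq₁ : ∀ a b f h p q → (a + b) * f * (½ * h) * (p * q) ≡ ½ * (f * h * (a * p * q) + f * h * (p * (b * q)))
    eq₁ = solve-∀ ring
    eq : ∀ a b c f h p′ p q′ q → c ≡ a + b → a * p ≡ p′ → b * q ≡ q′ →
      c * f * (½ * h) * (p * q) ≡ ½ * (f * h * (p′ * q) + f * h * (p * q′))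
    eq a b _ f h _ p _ q refl refl refl = eq₁ a b f h p q

  β-diagonal : ∀ j → β j j ≡ C j
  β-diagonal zero    = refl
  β-diagonal (suc j) = ≤-antisym (*-cancelˡ 0<2ι (≤-reflexive eq)) (*-cancelˡ 0<2ι (≤-reflexive (sym eq)))
    where
    0<2ι : 0ℚ < 2ℚ * ι (suc j)
    0<2ι = 0<* 0<2 (0<ι-suc j)
    double : j ℕ.+ suc j ≡ suc (j ℕ.+ j)
    double = ℕ.+-suc j j
    eq₁ : ∀ a o f h p → 2ℚ * a * (((a + a) * (o * f)) * (½ * (½ * h)) * (p * p)) ≡ o * (f * h * (a * p * (a * p)))
    eq₁ = solve-∀ ring
    eq₂ : ∀ a b o o′ f h p p′ → b ≡ a + a → o′ ≡ o → a * p ≡ p′ →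
      2ℚ * a * ((b * (o′ * f)) * (½ * (½ * h)) * (p * p)) ≡ o * (f * h * (p′ * p′))
    eq₂ a _ o _ f h p _ refl refl refl = eq₁ a o f h p
    eq : 2ℚ * ι (suc j) * β (suc j) (suc j) ≡ 2ℚ * ι (suc j) * C (suc j)
    eq = trans (cong (λ m → 2ℚ * ι (suc j) * (ι (suc (j ℕ.+ suc j)) * fact m * ½ ↑ suc m * (invFact (suc j) * invFact (suc j)))) double)
      (trans (eq₂ (ι (suc j)) (ι (suc (j ℕ.+ suc j))) (odd j) (ι (suc (j ℕ.+ j))) (fact (j ℕ.+ j)) (½ ↑ (j ℕ.+ j)) (invFact
          (suc j)) (invFact j)
        (ι-+ (suc j) (suc j)) (cong (λ t → ι (suc (j ℕ.+ t))) (sym (ℕ.+-identityʳ j))) (invFact-suc j))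
      (trans (cong (odd j *_) (β-diagonal j)) (sym (C-suc j))))

  κ≤1 : ∀ j → κ j ≤ 1ℚ
  κ≤1 j = *-cancelˡ (0<+ 0<1 (0≤odd j)) (by-diff 0≤1 (eq (κ j) (odd j) (κ-spec j)))
    where
    eq₁ : ∀ k o → (1ℚ + o) * 1ℚ ≡ o + 1ℚ
    eq₁ = solve-∀ ring
    eq : ∀ k o → k * (1ℚ + o) ≡ o → (1ℚ + o) * 1ℚ ≡ (1ℚ + o) * k + 1ℚ
    eq k o h = trans (eq₁ k o) (cong (_+ 1ℚ) (trans (sym h) (*-comm k (1ℚ + o))))

  C-decreasing : ∀ j → C (suc j) ≤ C j
  C-decreasing j = subst (C (suc j) ≤_) (*-identityʳ (C j)) (*-monoˡ (<⇒≤ (0<C j)) (κ≤1 j))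

  -- decreases to 2 / π
  U : ℕ → ℚ
  U j = odd j * (C j * C j)

  ∑-telescope : ∀ n (f : ℕ → ℚ) → ∑ n (λ i → f i - f (suc i)) ≡ f 0 - f n
  ∑-telescope zero    f = sym (+-inverseʳ (f 0))
  ∑-telescope (suc n) f = trans (∑-last n (λ i → f i - f (suc i))) (trans (cong (_+ (f n - f (suc n))) (∑-telescope n f)) (eq
      (f 0) (f n) (f (suc n))))
    where
    eq : ∀ a b c → a - b + (b - c) ≡ a - c
    eq = solve-∀ ring

  -- Taylor coefficient times the constant term `C (suc j)` of the corresponding power of the
  -- cosine; the mean of the whole polynomial therefore telescopes to 1 - U.
  U-step : ∀ j → (C j - C (suc j)) * C (suc j) ≡ U j - U (suc j)
  U-step j = eq (C j) (κ j) (odd j) (odd (suc j)) (odd-suc j) (κ-spec j)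
    where
    eq₁ : ∀ c k o → (c - c * k) * (c * k) ≡ o * (c * c) - (2ℚ + o) * (c * k * (c * k)) + (c * c * (k + 1ℚ)) * (k * (1ℚ + o) - o)
    eq₁ = solve-∀ ring
    eq : ∀ c k o o′ → o′ ≡ 2ℚ + o → k * (1ℚ + o) ≡ o → (c - c * k) * (c * k) ≡ o * (c * c) - o′ * (c * k * (c * k))
    eq c k o _ refl h = ≡-by h (c * c * (k + 1ℚ)) (eq₁ c k o)

  module Dual {X : Set} (A : List X) (u : X → 𝔾) (unit : ∀ a → norm (u a) ≡ 1ℚ) (J : ℕ) (r : ℚ)
    (re-bound : ∀ l → 1 ℕ.≤ l → l ℕ.≤ J ℕ.+ J → ∑ₗ A (λ a → re (u a ^ l)) ≤ r) where

    private
      k : ℚ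
      k = ι (length A)

    -- The factors u and ū are counted separately by `x` and `y`, so harmonics of either sign need
    -- only natural exponents. Each factor re u = (u + ū) / 2 is then traded for a step in `x` or in
    -- `y`.
    moment : ℕ → ℕ → ℕ → ℚ
    moment m x y = ∑ₗ A (λ a → re (u a) ↑ m * re (u a ^ x ⊗ conj (u a ^ y)))

    moment-suc : ∀ m x y → moment (suc m) x y ≡ ½ * (moment m (suc x) y + moment m x (suc y))
    moment-suc m x y = trans (∑ₗ-cong A (λ a → eq (re (u a)) (im (u a)) (re (u a) ↑ m) (re (u a ^ x)) (im (u a ^ x)) (re
        (u a ^ y)) (im (u a ^ y))))
      (trans (∑ₗ-*ˡ A ½ _) (cong (½ *_) (∑ₗ-+ A _ _)))
      where
      eq : ∀ c s t a b p q → c * t * (a * p - b * - q) ≡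
        ½ * (t * ((c * a - s * b) * p - (c * b + s * a) * - q) + t * (a * (c * p - s * q) - b * - (c * q + s * p)))
      eq = solve-∀ ring

    moment-diagonal : ∀ x → moment 0 x x ≡ k
    moment-diagonal x = trans (∑ₗ-cong A (λ a → trans (eq (re (u a ^ x)) (im (u a ^ x))) (norm-^ (unit a) x)))
      (trans (∑ₗ-const A 1ℚ) (*-identityˡ k))
      where
      eq : ∀ a b → 1ℚ * (a * a - b * - b) ≡ a * a + b * b
      eq = solve-∀ ring

    moment-sym : ∀ m x y → moment m x y ≡ moment m y x
    moment-sym m x y = ∑ₗ-cong A (λ a → cong (re (u a) ↑ m *_) (eq (re (u a ^ x)) (im (u a ^ x)) (re (u a ^ y)) (im (u a ^ y))))
      where
      eq : ∀ a b c d → a * c - b * - d ≡ c * a - d * - b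
      eq = solve-∀ ring

    average : ∀ {p q s} → p ≤ s → q ≤ s → ½ * (p + q) ≤ s
    average {p} {q} {s} p≤s q≤s = subst (½ * (p + q) ≤_) (eq s) (*-monoˡ (nonNegative⁻¹ ½) (+-mono-≤ p≤s q≤s))
      where
      eq : ∀ s → ½ * (s + s) ≡ s
      eq = solve-∀ ring

    -- u ^ x ū ^ y with x - y > m has no constant term, even after multiplication by (re u) ^ m.
    off-diagonal : ∀ m x y d → x ≡ suc d ℕ.+ (m ℕ.+ y) → m ℕ.+ (x ℕ.+ y) ℕ.≤ J ℕ.+ J → moment m x y ≤ r
    off-diagonal zero x y d refl bound = ≤-trans
      (≤-reflexive (∑ₗ-cong A (λ a → trans (*-identityˡ (re (u a ^ x ⊗ conj (u a ^ y))))
        (trans (cong (λ t → re (t ⊗ conj (u a ^ y))) (^-+ (u a) (suc d) y)) (re-unit (u a ^ suc d) (u a ^ y) (norm-^ (unit a) y))))))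
      (re-bound (suc d) (ℕ.s≤s ℕ.z≤n) (ℕ.≤-trans (ℕ.m≤m+n (suc d) y) (ℕ.≤-trans (ℕ.m≤m+n x y) bound)))
    off-diagonal (suc m) x y d x≡ bound = ≤-trans (≤-reflexive (moment-suc m x y)) (average
      (off-diagonal m (suc x) y (suc (suc d)) (trans (cong suc x≡) (cong suc (cong suc (ℕ.+-suc d (m ℕ.+ y)))))
        (ℕ.≤-trans (ℕ.≤-reflexive (ℕ.+-suc m (x ℕ.+ y))) bound))
      (off-diagonal m x (suc y) d (trans x≡ (cong (suc d ℕ.+_) (sym (ℕ.+-suc m y))))
        (ℕ.≤-trans (ℕ.≤-reflexive (trans (cong (m ℕ.+_) (ℕ.+-suc x y)) (ℕ.+-suc m (x ℕ.+ y)))) bound)))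

    -- A share b of the expansion is constant and contributes k; the remaining share consists of
    -- nonconstant harmonics, each summing to at most r.
    mix : ℚ → ℚ
    mix b = b * k + (1ℚ - b) * r

    moment-edge : ∀ v x y → x ≡ v ℕ.+ y → v ℕ.+ (x ℕ.+ y) ℕ.≤ J ℕ.+ J → moment v x y ≤ mix (β 0 v)
    moment-edge zero x y refl bound = ≤-reflexive (trans (moment-diagonal x) (eq k r))
      where
      eq : ∀ k r → k ≡ 1ℚ * k + (1ℚ - 1ℚ) * r
      eq = solve-∀ ring
    moment-edge (suc v) x y x≡ bound = ≤-trans (≤-reflexive (moment-suc v x y)) (≤-trans
      (*-monoˡ (nonNegative⁻¹ ½) (+-mono-≤
        (off-diagonal v (suc x) y 1 (cong suc x≡) (ℕ.≤-trans (ℕ.≤-reflexive (ℕ.+-suc v (x ℕ.+ y))) bound))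
        (moment-edge v x (suc y) (trans x≡ (sym (ℕ.+-suc v y)))
          (ℕ.≤-trans (ℕ.≤-reflexive (trans (cong (v ℕ.+_) (ℕ.+-suc x y)) (ℕ.+-suc v (x ℕ.+ y)))) bound))))
      (≤-reflexive (trans (eq k r (β 0 v)) (cong mix (sym (β-edge v))))))
      where
      eq : ∀ k r b → ½ * (r + (b * k + (1ℚ - b) * r)) ≡ ½ * b * k + (1ℚ - ½ * b) * r
      eq = solve-∀ ring

    -- Expanding the power of re u is a simple random walk of p + q steps from frequency x - y. It
    -- ends at 0 exactly when p steps go up and q down, with probability `β p q`; the last
    -- hypothesis keeps every end point within 2J.
    moment-bound : ∀ p q x y → x ℕ.+ p ≡ y ℕ.+ q → p ℕ.+ q ℕ.+ (x ℕ.+ y) ℕ.≤ J ℕ.+ J → moment (p ℕ.+ q) x y ≤ mix (β p q)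
    moment-bound zero q x y eq bound = moment-edge q x y
      (trans (sym (ℕ.+-identityʳ x)) (trans eq (ℕ.+-comm y q))) bound
    moment-bound (suc p) zero x y eq bound = subst₂ _≤_ (trans (moment-sym (suc p) y x) (cong (λ t → moment t x y) (sym
        (ℕ.+-identityʳ (suc p))))) (cong mix (β-sym 0 (suc p)))
      (moment-edge (suc p) y x (trans (sym (ℕ.+-identityʳ y)) (trans (sym eq) (ℕ.+-comm x (suc p))))
        (ℕ.≤-trans (ℕ.≤-reflexive (cong₂ ℕ._+_ (sym (ℕ.+-identityʳ (suc p))) (ℕ.+-comm y x))) bound))
    moment-bound (suc p) (suc q) x y eq bound = ≤-trans (≤-reflexive (moment-suc (p ℕ.+ suc q) x y)) (≤-trans
      (*-monoˡ (nonNegative⁻¹ ½) (+-mono-≤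
        (moment-bound p (suc q) (suc x) y (trans (sym (ℕ.+-suc x p)) eq)
          (ℕ.≤-trans (ℕ.≤-reflexive (ℕ.+-suc (p ℕ.+ suc q) (x ℕ.+ y))) bound))
        (subst (λ t → moment t x (suc y) ≤ mix (β (suc p) q)) (sym (ℕ.+-suc p q))
          (moment-bound (suc p) q x (suc y) (trans eq (ℕ.+-suc y q))
            (ℕ.≤-trans (ℕ.≤-reflexive (trans (cong₂ ℕ._+_ (sym (ℕ.+-suc p q)) (ℕ.+-suc x y)) (ℕ.+-suc (p ℕ.+ suc q)
                (x ℕ.+ y)))) bound)))))
      (≤-reflexive (trans (eq₁ k r (β p (suc q)) (β (suc p) q)) (cong mix (sym (β-pascal p q))))))
      where
      eq₁ : ∀ k r b c → ½ * (b * k + (1ℚ - b) * r + (c * k + (1ℚ - c) * r)) ≡ ½ * (b + c) * k + (1ℚ - ½ * (b + c)) * r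
      eq₁ = solve-∀ ring

    power-bound : ∀ j → j ℕ.≤ J → ∑ₗ A (λ a → (re (u a) * re (u a)) ↑ j) ≤ mix (C j)
    power-bound j j≤J = subst₂ _≤_ (∑ₗ-cong A (λ a → trans (eq₁ (re (u a) ↑ (j ℕ.+ j))) (square (re (u a)) j))) (cong mix
        (β-diagonal j))
      (moment-bound j j 0 0 refl (ℕ.≤-trans (ℕ.≤-reflexive (ℕ.+-identityʳ (j ℕ.+ j))) (ℕ.+-mono-≤ j≤J j≤J)))
      where
      eq₁ : ∀ c → c * (1ℚ * 1ℚ - 0ℚ * - 0ℚ) ≡ c
      eq₁ = solve-∀ ring
      eq₂ : ∀ c t → c * (c * t) ≡ c * c * t
      eq₂ = solve-∀ ring
      square : ∀ c j → c ↑ (j ℕ.+ j) ≡ (c * c) ↑ j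
      square c zero    = refl
      square c (suc j) = trans (cong (λ t → c * c ↑ t) (ℕ.+-suc j j)) (trans (eq₂ c (c ↑ (j ℕ.+ j))) (cong (c * c *_) (square c j)))

    -- Sums `certificate` over A. The sine costs at most r, the constant terms give (1 - U J) k, and
    -- the nonconstant harmonics, of total weight U J - C J, cost r each.
    dual-bound : (∀ {a} → a ∈ A → 0ℚ ≤ im (u a)) → ∑ₗ A (λ a → im (u a)) ≤ r → k * (U J - C J) ≤ r * (1ℚ + (U J - C J))
    dual-bound 0≤im im-bound = by-diff (0≤diff main) (eq k r (U J) (C J) (trans (cong (_- U J) U0) refl))
      where
      U0 : U 0 ≡ 1ℚ
      U0 = trans (*-identityʳ (odd 0)) ι-1
      0≤b : ∀ i → 0ℚ ≤ C i - C (suc i)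
      0≤b i = 0≤diff (C-decreasing i)
      main : (1ℚ - C J) * k ≤ r + ((U 0 - U J) * (k - r) + (1ℚ - C J) * r)
      main = begin
        (1ℚ - C J) * k                                                          ≡⟨ ∑ₗ-const A (1ℚ - C J) ⟨
        ∑ₗ A (λ _ → 1ℚ - C J)                                                    ≤⟨ ∑ₗ-mono A (λ {a} a∈A → certificate J (re
            (u a)) (im (u a)) (unit a) (0≤im a∈A)) ⟩
        ∑ₗ A (λ a → im (u a) + W J (re (u a) * re (u a)))                        ≡⟨ ∑ₗ-+ A _ _ ⟩
        ∑ₗ A (λ a → im (u a)) + ∑ₗ A (λ a → W J (re (u a) * re (u a)))            ≡⟨ cong (∑ₗ A (λ a → im (u a)) +_) (trans
            (∑ₗ-swap A J (λ i a → (C i - C (suc i)) * (re (u a) * re (u a)) ↑ suc i)) (∑-cong J (λ i → ∑ₗ-*ˡ A (C i - C (suc i))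
            (λ a → (re (u a) * re (u a)) ↑ suc i)))) ⟩
        ∑ₗ A (λ a → im (u a)) + ∑ J (λ i → (C i - C (suc i)) * ∑ₗ A (λ a → (re (u a) * re (u a)) ↑ suc i))
                                                                                ≤⟨ +-mono-≤ im-bound (∑-mono J (λ i i<J → *-monoˡ
                                                                                    (0≤b i) (power-bound (suc i) i<J))) ⟩
        r + ∑ J (λ i → (C i - C (suc i)) * mix (C (suc i)))                     ≡⟨ cong (r +_) (trans (∑-cong J expand) (trans
            (∑-+ J _ _) (cong₂ _+_ (trans (sym (∑-*ˡ J (k - r) _)) (*-comm (k - r) _)) (trans (sym (∑-*ˡ J r _)) (*-comm r _))))) ⟩
        r + (∑ J (λ i → U i - U (suc i)) * (k - r) + ∑ J (λ i → C i - C (suc i)) * r)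
                                                                                ≡⟨ cong₂ (λ s t → r + (s * (k - r) + t * r))
                                                                                    (∑-telescope J U) (∑-telescope J C) ⟩
        r + ((U 0 - U J) * (k - r) + (1ℚ - C J) * r)                            ∎
        where
        open ≤-Reasoning
        eq₁ : ∀ b c k r → b * (c * k + (1ℚ - c) * r) ≡ (k - r) * (b * c) + r * b
        eq₁ = solve-∀ ring
        expand : ∀ i → (C i - C (suc i)) * mix (C (suc i)) ≡ (k - r) * (U i - U (suc i)) + r * (C i - C (suc i))
        expand i = trans (eq₁ (C i - C (suc i)) (C (suc i)) k r) (cong (λ t → (k - r) * t + r * (C i - C (suc i))) (U-step i))
      eq₁ : ∀ k r u c → r * (1ℚ + (u - c)) ≡ k * (u - c) + (r + ((1ℚ - u) * (k - r) + (1ℚ - c) * r) - (1ℚ - c) * k)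
      eq₁ = solve-∀ ring
      eq : ∀ k r u c {t} → t ≡ 1ℚ - u → r * (1ℚ + (u - c)) ≡ k * (u - c) + (r + (t * (k - r) + (1ℚ - c) * r) - (1ℚ - c) * k)
      eq k r u c refl = eq₁ k r u c

  -- The test inequality for sumsets

  ∑ₗ-map : ∀ {X Y : Set} (g : X → Y) as f → ∑ₗ (map g as) f ≡ ∑ₗ as (f ∘ g)
  ∑ₗ-map g []       f = refl
  ∑ₗ-map g (a ∷ as) f = cong (f (g a) +_) (∑ₗ-map g as f)

  ∑ₗ-upTo : ∀ n f → ∑ₗ (upTo n) f ≡ ∑ n f
  ∑ₗ-upTo n f = go n id
    where
    go : ∀ n (g : ℕ → ℕ) → ∑ₗ (applyUpTo g n) f ≡ ∑ n (f ∘ g)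
    go zero    g = refl
    go (suc n) g = cong (f (g 0) +_) (go n (g ∘ suc))

  -- Distinct members of D can be struck from distinct places of E; what remains of E is
  -- nonnegative.
  ∑ₗ-⊆ : ∀ {D E : List ℕ} {f : ℕ → ℚ} → (∀ s → 0ℚ ≤ f s) → Unique D → (∀ {s} → s ∈ D → s ∈ E) → ∑ₗ D f ≤ ∑ₗ E f
  ∑ₗ-⊆ {E = E} 0≤f [] D⊆E = ∑ₗ-nonNeg E 0≤f
  ∑ₗ-⊆ {s ∷ D} {f = f} 0≤f (s∉D ∷ unique) D⊆E with ∈-∃++ (D⊆E (here refl))
  ... | E₁ , E₂ , refl = subst (f s + ∑ₗ D f ≤_)
    (trans (cong (f s +_) (∑ₗ-++ E₁ E₂ f)) (trans (eq (f s) (∑ₗ E₁ f) (∑ₗ E₂ f)) (sym (∑ₗ-++ E₁ (s ∷ E₂) f))))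
    (+-monoʳ-≤ (f s) (∑ₗ-⊆ 0≤f unique D⊆E′))
    where
    eq : ∀ a b c → a + (b + c) ≡ b + (a + c)
    eq = solve-∀ ring
    D⊆E′ : ∀ {t} → t ∈ D → t ∈ E₁ ++ E₂
    D⊆E′ t∈D with ∈-++⁻ E₁ (D⊆E (there t∈D))
    ... | inj₁ t∈E₁           = ∈-++⁺ˡ t∈E₁
    ... | inj₂ (here refl)    = ⊥-elim (All.lookup s∉D t∈D refl)
    ... | inj₂ (there t∈E₂)   = ∈-++⁺ʳ E₁ t∈E₂

  unorderedSums : List ℕ → List ℕ
  unorderedSums []       = []
  unorderedSums (a ∷ as) = a ℕ.+ a ∷ map (a ℕ.+_) as ++ unorderedSums as

  ∈-unorderedSums : ∀ {A a b} → a ∈ A → b ∈ A → a ℕ.+ b ∈ unorderedSums A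
  ∈-unorderedSums (here refl) (here refl) = here refl
  ∈-unorderedSums (here refl) (there b∈A) = there (∈-++⁺ˡ (∈-map⁺ (_ ℕ.+_) b∈A))
  ∈-unorderedSums {a ∷ A} {b = b} (there {x = x} b∈A) (here refl) =
    there (∈-++⁺ˡ (subst (_∈ map (b ℕ.+_) A) (ℕ.+-comm b _) (∈-map⁺ (b ℕ.+_) b∈A)))
  ∈-unorderedSums {a ∷ A} (there a∈A) (there b∈A) = there (∈-++⁺ʳ (map (a ℕ.+_) A) (∈-unorderedSums a∈A b∈A))

  ∈-sums⁻ : ∀ {A s} → s ∈ sums A → ∃[ a ] ∃[ b ] a ∈ A × b ∈ A × s ≡ a ℕ.+ b
  ∈-sums⁻ {A} s∈ with find (∈-concatMap⁻ (λ x → map (x ℕ.+_) A) {xs = A} s∈)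
  ... | a , a∈A , s∈map with ∈-map⁻ (a ℕ.+_) s∈map
  ... | b , b∈A , s≡ = a , b , a∈A , b∈A , s≡

  ∑∑ : List ℕ → (ℕ → ℕ → ℚ) → ℚ
  ∑∑ A f = ∑ₗ A (λ a → ∑ₗ A (f a))

  -- Ordered pairs with the diagonal added once more cover every unordered pair exactly twice.
  ∑-unorderedSums : ∀ A v → ∑∑ A (λ a b → v (a ℕ.+ b)) + ∑ₗ A (λ a → v (a ℕ.+ a)) ≡ 2ℚ * ∑ₗ (unorderedSums A) v
  ∑-unorderedSums []      v = refl
  ∑-unorderedSums (a ∷ A) v = trans
    (cong (λ t → v (a ℕ.+ a) + row + t + (v (a ℕ.+ a) + ∑ₗ A (λ b → v (b ℕ.+ b)))) (∑ₗ-+ A (λ b → v (b ℕ.+ a)) (λ b → ∑ₗ A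
        (λ c → v (b ℕ.+ c)))))
    (eq (v (a ℕ.+ a)) row (∑ₗ A (λ b → v (b ℕ.+ a))) (∑∑ A (λ b c → v (b ℕ.+ c))) (∑ₗ A (λ b → v (b ℕ.+ b))) (∑ₗ
        (unorderedSums A) v) (∑ₗ (map (a ℕ.+_) A ++ unorderedSums A) v)
      (∑ₗ-cong A (λ b → cong v (ℕ.+-comm b a))) (∑-unorderedSums A v)
      (trans (∑ₗ-++ (map (a ℕ.+_) A) (unorderedSums A) v) (cong (_+ ∑ₗ (unorderedSums A) v) (∑ₗ-map (a ℕ.+_) A v))))
    where
    row = ∑ₗ A (λ b → v (a ℕ.+ b))
    eq₁ : ∀ p r t → 2ℚ * (p + (r + t)) ≡ p + r + (r + 2ℚ * t) + p
    eq₁ = solve-∀ ring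
    eq₂ : ∀ p r m g → p + r + (r + m) + (p + g) ≡ p + r + (r + (m + g)) + p
    eq₂ = solve-∀ ring
    eq : ∀ p r r′ m g t l → r′ ≡ r → m + g ≡ 2ℚ * t → l ≡ r + t → p + r + (r′ + m) + (p + g) ≡ 2ℚ * (p + l)
    eq p r _ m g t _ refl h refl = trans (eq₂ p r m g) (trans (cong (λ z → p + r + (r + z) + p) h) (sym (eq₁ p r t)))

  -- A sum s = a + b is hit by (a , b) and (b , a), or twice after doubling the k diagonal pairs; the last factor bounds the
  -- ℓ¹ distance between the representation function of A + A and twice the indicator function of [0, K).
  sumset-test : ∀ A K X (ψ : ℕ → ℚ) → (∀ {a b} → a ∈ A → b ∈ A → a ℕ.+ b ℕ.< K) →
    (∀ s → - X ≤ ψ s) → (∀ s → ψ s ≤ X) →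
    ∑∑ A (λ a b → ψ (a ℕ.+ b)) ≤ 2ℚ * ∑ K ψ +
      X * (ι (length A) * ι (length A) + 2ℚ * ι (length A) + 2ℚ * ι K - 4ℚ * ι (sumsetCard A))
  sumset-test A K X ψ bound -X≤ψ ψ≤X = by-diff
    (0≤+ (0≤+ (0≤diff (∑ₗ-⊆ 0≤v unique D⊆sums)) (0≤diff (∑ₗ-⊆ 0≤v unique D⊆sums)))
      (0≤+ (0≤+ (0≤diff (∑ₗ-⊆ 0≤w unique D⊆upTo)) (0≤diff (∑ₗ-⊆ 0≤w unique D⊆upTo))) (0≤diff diagonal)))
    (eq X k (ι K) S (∑ₗ D ψ) (∑ K ψ) (∑∑ A (λ a b → ψ (a ℕ.+ b))) (∑∑ A (λ a b → v (a ℕ.+ b))) (∑ₗ A (λ a → v (a ℕ.+ a))) (∑ₗ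
        (unorderedSums A) v) (∑ₗ D v) (∑ₗ D w) (∑ₗ (upTo K) w)
      (linear D (- 1ℚ) S refl) pairs (∑-unorderedSums A v)
      (linear D 1ℚ S refl) (trans (linear (upTo K) 1ℚ (ι (length (upTo K))) refl) (cong₂ (λ s t → X * ι s + 1ℚ * t)
          (length-upTo K) (∑ₗ-upTo K ψ))))
    where
    D = deduplicate ℕ._≟_ (sums A)
    k = ι (length A)
    S = ι (length D)
    v w : ℕ → ℚ
    -- Both `v` and `w` are nonnegative as |ψ| ≤ X. Enlarging D to the unordered sums uses `v`,
    -- enlarging it to [0, K) uses `w`, and in the total the sums of ψ over D cancel.
    v s = X + - 1ℚ * ψ s
    w s = X + 1ℚ * ψ s
    unique = UniqueDec.deduplicate-! ℕ._≟_ (sums A)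
    D⊆sums : ∀ {s} → s ∈ D → s ∈ unorderedSums A
    D⊆sums s∈D with ∈-sums⁻ {A} (∈-deduplicate⁻ ℕ._≟_ (sums A) s∈D)
    ... | a , b , a∈A , b∈A , refl = ∈-unorderedSums a∈A b∈A
    D⊆upTo : ∀ {s} → s ∈ D → s ∈ upTo K
    D⊆upTo s∈D with ∈-sums⁻ {A} (∈-deduplicate⁻ ℕ._≟_ (sums A) s∈D)
    ... | a , b , a∈A , b∈A , refl = ∈-upTo⁺ (bound a∈A b∈A)
    eqv : ∀ x p → x + - 1ℚ * p ≡ x - p
    eqv = solve-∀ ring
    eqw : ∀ x p → x + 1ℚ * p ≡ p - - x
    eqw = solve-∀ ring
    0≤v : ∀ s → 0ℚ ≤ v s
    0≤v s = subst (0ℚ ≤_) (sym (eqv X (ψ s))) (0≤diff (ψ≤X s))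
    0≤w : ∀ s → 0ℚ ≤ w s
    0≤w s = subst (0ℚ ≤_) (sym (eqw X (ψ s))) (0≤diff (-X≤ψ s))
    linear : ∀ B c s → s ≡ ι (length B) → ∑ₗ B (λ t → X + c * ψ t) ≡ X * s + c * ∑ₗ B ψ
    linear B c _ refl = trans (∑ₗ-+ B (λ _ → X) (λ t → c * ψ t)) (cong₂ _+_ (∑ₗ-const B X) (∑ₗ-*ˡ B c ψ))
    pairs : ∑∑ A (λ a b → v (a ℕ.+ b)) ≡ X * k * k + - 1ℚ * ∑∑ A (λ a b → ψ (a ℕ.+ b))
    pairs = trans (∑ₗ-cong A (λ a → trans (∑ₗ-+ A (λ _ → X) (λ b → - 1ℚ * ψ (a ℕ.+ b)))
        (cong₂ _+_ (∑ₗ-const A X) (∑ₗ-*ˡ A (- 1ℚ) (λ b → ψ (a ℕ.+ b))))))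
      (trans (∑ₗ-+ A (λ _ → X * k) (λ a → - 1ℚ * ∑ₗ A (λ b → ψ (a ℕ.+ b))))
        (cong₂ _+_ (∑ₗ-const A (X * k)) (∑ₗ-*ˡ A (- 1ℚ) (λ a → ∑ₗ A (λ b → ψ (a ℕ.+ b))))))
    diagonal : ∑ₗ A (λ a → v (a ℕ.+ a)) ≤ 2ℚ * X * k
    diagonal = subst (∑ₗ A (λ a → v (a ℕ.+ a)) ≤_) (∑ₗ-const A (2ℚ * X))
      (∑ₗ-mono A (λ {a} _ → by-diff (0≤w (a ℕ.+ a)) (eq₀ X (ψ (a ℕ.+ a)))))
      where
      eq₀ : ∀ x p → 2ℚ * x ≡ x + - 1ℚ * p + (x + 1ℚ * p)
      eq₀ = solve-∀ ring
    eq₁ : ∀ X k K S dψ kψ pψ g →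
      2ℚ * kψ + X * (k * k + 2ℚ * k + 2ℚ * K - 4ℚ * S) ≡ pψ + ((X * k * k + - 1ℚ * pψ + g - (X * S + - 1ℚ * dψ) - (X * S + - 1ℚ * dψ)) +
        ((X * K + 1ℚ * kψ - (X * S + 1ℚ * dψ)) + (X * K + 1ℚ * kψ - (X * S + 1ℚ * dψ)) + (2ℚ * X * k - g)))
    eq₁ = solve-∀ ring
    eq₂ : ∀ t a b → 2ℚ * t - a - a + b ≡ ((t - a) + (t - a)) + b
    eq₂ = solve-∀ ring
    eq : ∀ X k K S dψ kψ pψ p g t dv dw kw → dv ≡ X * S + - 1ℚ * dψ → p ≡ X * k * k + - 1ℚ * pψ → p + g ≡ 2ℚ * t →
      dw ≡ X * S + 1ℚ * dψ → kw ≡ X * K + 1ℚ * kψ →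
      2ℚ * kψ + X * (k * k + 2ℚ * k + 2ℚ * K - 4ℚ * S) ≡ pψ + ((t - dv) + (t - dv) + ((kw - dw) + (kw - dw) + (2ℚ * X * k - g)))
    eq X k K S dψ kψ pψ _ g t _ _ _ refl refl h refl refl = trans (eq₁ X k K S dψ kψ pψ g)
      (cong (pψ +_) (trans (cong (λ z → z - (X * S + - 1ℚ * dψ) - (X * S + - 1ℚ * dψ) + rest) h) (eq₂ t (X * S + - 1ℚ * dψ) rest)))
      where
      rest : ℚ
      rest = (X * K + 1ℚ * kψ - (X * S + 1ℚ * dψ)) + (X * K + 1ℚ * kψ - (X * S + 1ℚ * dψ)) + (2ℚ * X * k - g)

  abs-bound : ∀ {u X} → 0ℚ ≤ X → norm u ≤ X * X → re u ≤ X × - X ≤ re u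
  abs-bound {u} {X} 0≤X h = ≤-from-² 0≤X (≤-trans (re²≤norm u) h) ,
    subst (- X ≤_) (eq₁ (re u)) (neg-antimono-≤ (≤-from-² {x = - re u} 0≤X (≤-trans (≤-reflexive (eq₂ (re u))) (≤-trans
        (re²≤norm u) h))))
    where
    eq₁ : ∀ a → - (- a) ≡ a
    eq₁ = solve-∀ ring
    eq₂ : ∀ a → - a * - a ≡ a * a
    eq₂ = solve-∀ ring

  cauchy-schwarz : ∀ {u v X Y} → 0ℚ ≤ X → 0ℚ ≤ Y → norm u ≤ X * X → norm v ≤ Y * Y → re (u ⊗ v) ≤ X * Y × - (X * Y) ≤ re (u ⊗ v)
  cauchy-schwarz {u} {v} {X} {Y} 0≤X 0≤Y hu hv = abs-bound {u ⊗ v} (0≤* 0≤X 0≤Y) (≤-trans (≤-reflexive (norm-⊗ u v))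
    (≤-trans (*-mono (0≤norm u) (0≤² Y) hu hv) (≤-reflexive (eq X Y))))
    where
    eq : ∀ x y → x * x * (y * y) ≡ x * y * (x * y)
    eq = solve-∀ ring

  geom : 𝔾 → ℕ → 𝔾
  geom u n = ∑ n (λ i → re (u ^ i)) ,i ∑ n (λ i → im (u ^ i))

  ∑𝔾 : List ℕ → (ℕ → 𝔾) → 𝔾
  ∑𝔾 A f = ∑ₗ A (λ a → re (f a)) ,i ∑ₗ A (λ a → im (f a))

  re-⊗-∑𝔾 : ∀ u A f → ∑ₗ A (λ a → re (u ⊗ f a)) ≡ re (u ⊗ ∑𝔾 A f)
  re-⊗-∑𝔾 u [] f = eq (re u) (im u)
    where
    eq : ∀ a b → 0ℚ ≡ a * 0ℚ - b * 0ℚ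
    eq = solve-∀ ring
  re-⊗-∑𝔾 u (a ∷ A) f = trans (cong (re (u ⊗ f a) +_) (re-⊗-∑𝔾 u A f))
    (eq (re u) (im u) (re (f a)) (im (f a)) (re (∑𝔾 A f)) (im (∑𝔾 A f)))
    where
    eq : ∀ a b c d e f → a * c - b * d + (a * e - b * f) ≡ a * (c + e) - b * (d + f)
    eq = solve-∀ ring

  re-⊗-geom : ∀ u v n → ∑ n (λ i → re (u ⊗ v ^ i)) ≡ re (u ⊗ geom v n)
  re-⊗-geom u v zero = eq (re u) (im u)
    where
    eq : ∀ a b → 0ℚ ≡ a * 0ℚ - b * 0ℚ
    eq = solve-∀ ring
  re-⊗-geom u v (suc n) = trans (∑-last n (λ i → re (u ⊗ v ^ i))) (trans (cong (_+ re (u ⊗ v ^ n)) (re-⊗-geom u v n))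
    (trans (eq (re u) (im u) (re (geom v n)) (im (geom v n)) (re (v ^ n)) (im (v ^ n)))
      (cong₂ (λ p q → re u * p - im u * q) (sym (∑-last n (λ i → re (v ^ i)))) (sym (∑-last n (λ i → im (v ^ i)))))))
    where
    eq : ∀ a b c d e f → a * c - b * d + (a * e - b * f) ≡ a * (c + e) - b * (d + f)
    eq = solve-∀ ring

  -- Fourier coefficients with characters constant on blocks

  module Blocks (h′ : ℕ) where

    h : ℕ
    h = suc h′

    block : ℕ → ℕ
    block a = a ℕ./ h

    -- The carry is the only failure of additivity, so s ↦ η^(block s) is multiplicative up to a
    -- single factor η.
    block-carry : ∀ a b → block (a ℕ.+ b) ≡ block a ℕ.+ block b ⊎ block (a ℕ.+ b) ≡ suc (block a ℕ.+ block b)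
    block-carry a b = cases (ℕ.m<n*o⇒m/o<n {n = 2} r<2h)
      where
      r = a ℕ.% h ℕ.+ b ℕ.% h
      q = block a ℕ.+ block b
      r<2h : r ℕ.< 2 ℕ.* h
      r<2h = subst (r ℕ.<_) (cong (h ℕ.+_) (sym (ℕ.+-identityʳ h))) (ℕ.+-mono-< (ℕ.m%n<n a h) (ℕ.m%n<n b h))
      interchange : ∀ x y u v → (x ℕ.+ y) ℕ.+ (u ℕ.+ v) ≡ (x ℕ.+ u) ℕ.+ (y ℕ.+ v)
      interchange x y u v = trans (ℕ.+-assoc x y (u ℕ.+ v)) (trans (cong (x ℕ.+_) (trans (sym (ℕ.+-assoc y u v))
        (trans (cong (ℕ._+ v) (ℕ.+-comm y u)) (ℕ.+-assoc u y v)))) (sym (ℕ.+-assoc x u (y ℕ.+ v))))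
      split : a ℕ.+ b ≡ r ℕ.+ q ℕ.* h
      split = trans (cong₂ ℕ._+_ (ℕ.m≡m%n+[m/n]*n a h) (ℕ.m≡m%n+[m/n]*n b h))
        (trans (interchange (a ℕ.% h) (block a ℕ.* h) (b ℕ.% h) (block b ℕ.* h))
          (cong (r ℕ.+_) (sym (ℕ.*-distribʳ-+ h (block a) (block b)))))
      block-sum : block (a ℕ.+ b) ≡ block r ℕ.+ q
      block-sum = trans (cong block split) (trans (ℕ.+-distrib-/-∣ʳ r (n∣m*n q)) (cong (block r ℕ.+_) (ℕ.m*n/n≡m q h)))
      cases : block r ℕ.< 2 → block (a ℕ.+ b) ≡ q ⊎ block (a ℕ.+ b) ≡ suc q
      cases r<2 with block r | block-sum | r<2
      ... | zero        | eq | _ = inj₁ eq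
      ... | suc zero    | eq | _ = inj₂ eq
      ... | suc (suc _) | _  | ℕ.s≤s (ℕ.s≤s ())

    ∑-blocks : ∀ m (f : ℕ → ℚ) → ∑ (m ℕ.* h) (λ s → f (block s)) ≡ ι h * ∑ m f
    ∑-blocks zero    f = sym (*-zeroʳ (ι h))
    ∑-blocks (suc m) f = trans (∑-++ h (m ℕ.* h) (λ s → f (block s))) (trans
      (cong₂ _+_ (trans (first h ℕ.≤-refl) (*-comm (f 0) (ι h)))
        (trans (∑-cong (m ℕ.* h) (λ s → cong f (trans (ℕ.+-distrib-/-∣ˡ s ∣-refl) (cong (ℕ._+ block s) (ℕ.n/n≡1 h)))))
          (∑-blocks m (f ∘ suc))))
      (sym (*-distribˡ-+ (ι h) (f 0) (∑ m (f ∘ suc)))))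
      where
      eq : ∀ c n → c * n + c ≡ c * (1ℚ + n)
      eq = solve-∀ ring
      first : ∀ i → i ℕ.≤ h → ∑ i (λ s → f (block s)) ≡ f 0 * ι i
      first zero    _   = sym (trans (cong (f 0 *_) ι-0) (*-zeroʳ (f 0)))
      first (suc i) i<h = trans (∑-last i (λ s → f (block s))) (trans
        (cong₂ _+_ (first i (ℕ.<⇒≤ i<h)) (cong f (ℕ.m<n⇒m/n≡0 i<h)))
        (trans (eq (f 0) (ι i)) (cong (f 0 *_) (sym (ι-suc i)))))

    module Fourier (A : List ℕ) (M : ℕ) (bound : ∀ {a b} → a ∈ A → b ∈ A → a ℕ.+ b ℕ.< M ℕ.* h)
      (η : 𝔾) (unit : norm η ≡ 1ℚ) (δ G : ℚ) (0≤δ : 0ℚ ≤ δ) (0≤G : 0ℚ ≤ G)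
      (step : norm (𝟙 ⊖ η) ≤ δ * δ) (geom-bound : norm (geom η M) ≤ G * G) where

      private
        k : ℚ
        k = ι (length A)

        e : ℕ → 𝔾
        e s = η ^ block s

        slack : ℚ
        slack = k * k + 2ℚ * k + 2ℚ * ι (M ℕ.* h) - 4ℚ * ι (sumsetCard A)

      F : 𝔾
      F = ∑𝔾 A e

      -- The test with ψ = 0 and X = 1. It settles the case F = 0, in which `norm F` cannot be
      -- cancelled.
      0≤slack : 0ℚ ≤ slack
      0≤slack = subst₂ _≤_ zeroˡ (trans (cong (λ t → 2ℚ * t + 1ℚ * slack) zeroʳ) (eq slack))
        (sumset-test A (M ℕ.* h) 1ℚ (λ _ → 0ℚ) bound (λ _ → nonPositive⁻¹ (- 1ℚ)) (λ _ → 0≤1))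
        where
        eq : ∀ s → 2ℚ * 0ℚ + 1ℚ * s ≡ s
        eq = solve-∀ ring
        zeroʳ : ∑ (M ℕ.* h) (λ _ → 0ℚ) ≡ 0ℚ
        zeroʳ = go (M ℕ.* h)
          where
          go : ∀ n → ∑ n (λ _ → 0ℚ) ≡ 0ℚ
          go zero    = refl
          go (suc n) = trans (+-identityˡ (∑ n (λ _ → 0ℚ))) (go n)
        zeroˡ : ∑∑ A (λ _ _ → 0ℚ) ≡ 0ℚ
        zeroˡ = trans (∑ₗ-const A (∑ₗ A (λ _ → 0ℚ))) (trans (cong (_* k) (trans (∑ₗ-const A 0ℚ) (*-zeroˡ k))) (*-zeroˡ k))

      -- The weight w = F̄² aligns the phases: the sum of w e(a) e(b) over all pairs is |F|⁴, while
      -- |w| = |F|² bounds ψ. Each of the three errors (slack, interval sum, carries) is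
      -- proportional to |F|², which is then cancelled.
      norm-bound : norm F ≤ slack + (2ℚ * (ι h * G) + δ * (k * k))
      norm-bound with ≤-total (norm F) 0ℚ | 0ℚ <? norm F
      ... | inj₁ X≤0 | _ = ≤-trans X≤0 (0≤+ 0≤slack (0≤+ (0≤* 0≤2 (0≤* (0≤ι h) 0≤G)) (0≤* 0≤δ (0≤² k))))
      ... | inj₂ 0≤X | no X≮0 = ≤-trans (≮⇒≥ X≮0) (0≤+ 0≤slack (0≤+ (0≤* 0≤2 (0≤* (0≤ι h) 0≤G)) (0≤* 0≤δ (0≤² k))))
      ... | inj₂ 0≤X | yes 0<X = *-cancelˡ 0<X (begin
        X * X                                                              ≡⟨ sym energy ⟩
        ∑∑ A (λ a b → re (w ⊗ e a ⊗ e b))                                  ≤⟨ ∑ₗ-mono A (λ {a} _ → ∑ₗ-mono A (λ {b} _ → carry a b)) ⟩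
        ∑∑ A (λ a b → ψ (a ℕ.+ b) + X * δ)                                 ≡⟨ split ⟩
        ∑∑ A (λ a b → ψ (a ℕ.+ b)) + X * δ * k * k                         ≤⟨ +-monoˡ-≤ (X * δ * k * k) (sumset-test A
            (M ℕ.* h) X ψ bound (λ s → proj₂ (ψ-bound s)) (λ s → proj₁ (ψ-bound s))) ⟩
        2ℚ * ∑ (M ℕ.* h) ψ + X * slack + X * δ * k * k                     ≤⟨ +-monoˡ-≤ (X * δ * k * k) (+-monoˡ-≤ (X * slack)
            (*-monoˡ 0≤2 total)) ⟩
        2ℚ * (ι h * (X * G)) + X * slack + X * δ * k * k                   ≡⟨ eq X δ k slack (ι h) G ⟩
        X * (slack + (2ℚ * (ι h * G) + δ * (k * k)))                       ∎)
        where
        open ≤-Reasoning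
        X = norm F
        w = conj F ⊗ conj F
        ψ : ℕ → ℚ
        ψ s = re (w ⊗ e s)
        norm-w : norm w ≡ X * X
        norm-w = trans (norm-⊗ (conj F) (conj F)) (cong₂ _*_ (norm-conj F) (norm-conj F))
        norm-e : ∀ s → norm (e s) ≡ 1ℚ * 1ℚ
        norm-e s = norm-^ unit (block s)
        ψ-bound : ∀ s → ψ s ≤ X × - X ≤ ψ s
        ψ-bound s = subst (λ t → ψ s ≤ t × - t ≤ ψ s) (*-identityʳ X)
          (cauchy-schwarz {w} {e s} 0≤X 0≤1 (≤-reflexive norm-w) (≤-reflexive (norm-e s)))
        eq : ∀ X d k s h g → 2ℚ * (h * (X * g)) + X * s + X * d * k * k ≡ X * (s + (2ℚ * (h * g) + d * (k * k)))
        eq = solve-∀ ring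
        total : ∑ (M ℕ.* h) ψ ≤ ι h * (X * G)
        total = ≤-trans (≤-reflexive (trans (∑-blocks M (λ i → re (w ⊗ η ^ i))) (cong (ι h *_) (re-⊗-geom w η M))))
          (*-monoˡ (0≤ι h) (proj₁ (cauchy-schwarz {w} {geom η M} 0≤X 0≤G (≤-reflexive norm-w) geom-bound)))
        split : ∑∑ A (λ a b → ψ (a ℕ.+ b) + X * δ) ≡ ∑∑ A (λ a b → ψ (a ℕ.+ b)) + X * δ * k * k
        split = trans (∑ₗ-cong A (λ a → trans (∑ₗ-+ A (λ b → ψ (a ℕ.+ b)) (λ _ → X * δ)) (cong (∑ₗ A (λ b → ψ (a ℕ.+ b)) +_)
            (∑ₗ-const A (X * δ)))))
          (trans (∑ₗ-+ A (λ a → ∑ₗ A (λ b → ψ (a ℕ.+ b))) (λ _ → X * δ * k))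
            (cong (∑∑ A (λ a b → ψ (a ℕ.+ b)) +_) (∑ₗ-const A (X * δ * k))))
        energy : ∑∑ A (λ a b → re (w ⊗ e a ⊗ e b)) ≡ X * X
        energy = trans (∑ₗ-cong A (λ a → trans (re-⊗-∑𝔾 (w ⊗ e a) A e)
            (cong re (trans (⊗-assoc w (e a) F) (trans (cong (w ⊗_) (⊗-comm (e a) F)) (sym (⊗-assoc w F (e a))))))))
          (trans (re-⊗-∑𝔾 (w ⊗ F) A e) (eq₁ (re F) (im F)))
          where
          eq₁ : ∀ a b → (((a * a - - b * - b) * a - (a * - b + - b * a) * b) * a - ((a * a - - b * - b) * b +
              (a * - b + - b * a) * a) * b)
            ≡ (a * a + b * b) * (a * a + b * b)
          eq₁ = solve-∀ ring
        carry : ∀ a b → re (w ⊗ e a ⊗ e b) ≤ ψ (a ℕ.+ b) + X * δ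
        carry a b with block-carry a b
        ... | inj₁ same = ≤-trans (≤-reflexive (cong re (trans (⊗-assoc w (e a) (e b)) (cong (w ⊗_)
                (trans (sym (^-+ η (block a) (block b))) (cong (η ^_) (sym same)))))))
              (by-diff (0≤* 0≤X 0≤δ) refl)
        -- After a carry, e(a) e(b) - e(a + b) = (1 - η) v with |v| = 1, so the loss is at most |w|
        -- δ = X δ.
        ... | inj₂ next = by-diff (0≤diff (proj₁ (cauchy-schwarz {w} {(𝟙 ⊖ η) ⊗ v} 0≤X 0≤δ (≤-reflexive norm-w) near)))
              (trans (cong (λ t → re (w ⊗ t) + X * δ) (cong (η ^_) next))
                (trans (eq₂ (re w) (im w) (re η) (im η) (re v) (im v) (X * δ))
                  (cong (λ t → t + (X * δ - re (w ⊗ ((𝟙 ⊖ η) ⊗ v)))) (cong re (sym (trans (⊗-assoc w (e a) (e b)) (cong (w ⊗_)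
                      (sym (^-+ η (block a) (block b))))))))))
          where
          v = η ^ (block a ℕ.+ block b)
          near : norm ((𝟙 ⊖ η) ⊗ v) ≤ δ * δ
          near = ≤-trans (≤-reflexive (trans (norm-⊗ (𝟙 ⊖ η) v)
            (trans (cong (norm (𝟙 ⊖ η) *_) (norm-^ unit (block a ℕ.+ block b))) (*-identityʳ (norm (𝟙 ⊖ η)))))) step
          eq₂ : ∀ p q c s a b z → (p * (c * a - s * b) - q * (c * b + s * a)) + z
            ≡ p * a - q * b + (z - (p * ((1ℚ - c) * a - (0ℚ - s) * b) - q * ((1ℚ - c) * b + (0ℚ - s) * a)))
          eq₂ = solve-∀ ring

  -- A rational rotation

  norm-+ : ∀ {u v X Y} → 0ℚ ≤ X → 0ℚ ≤ Y → norm u ≤ X * X → norm v ≤ Y * Y →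
    norm ((re u + re v) ,i (im u + im v)) ≤ (X + Y) * (X + Y)
  norm-+ {u} {v} {X} {Y} 0≤X 0≤Y hu hv = by-diff
    (0≤+ (0≤+ (0≤diff hu) (0≤diff hv)) (0≤* 0≤2 (0≤diff (proj₁ (cauchy-schwarz {u} {conj v} 0≤X 0≤Y hu
      (≤-trans (≤-reflexive (norm-conj v)) hv))))))
    (eq X Y (re u) (im u) (re v) (im v))
    where
    eq : ∀ X Y a b c d → (X + Y) * (X + Y) ≡ (a + c) * (a + c) + (b + d) * (b + d) +
      (X * X - (a * a + b * b) + (Y * Y - (c * c + d * d)) + 2ℚ * (X * Y - (a * c - b * - d)))
    eq = solve-∀ ring

  geom-suc : ∀ u n → geom u (suc n) ≡ (re (geom u n) + re (u ^ n)) ,i (im (geom u n) + im (u ^ n))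
  geom-suc u n = cong₂ _,i_ (∑-last n (λ i → re (u ^ i))) (∑-last n (λ i → im (u ^ i)))

  geom-telescope : ∀ u n → (u ⊖ 𝟙) ⊗ geom u n ≡ u ^ n ⊖ 𝟙
  geom-telescope u zero = cong₂ _,i_ (eq₁ (re u) (im u)) (eq₂ (re u) (im u))
    where
    eq₁ : ∀ a b → (a - 1ℚ) * 0ℚ - (b - 0ℚ) * 0ℚ ≡ 1ℚ - 1ℚ
    eq₁ = solve-∀ ring
    eq₂ : ∀ a b → (a - 1ℚ) * 0ℚ + (b - 0ℚ) * 0ℚ ≡ 0ℚ - 0ℚ
    eq₂ = solve-∀ ring
  geom-telescope u (suc n) = trans (cong ((u ⊖ 𝟙) ⊗_) (geom-suc u n)) (cong₂ _,i_
    (trans (eq₁ (re u) (im u) (re g) (im g) (re v) (im v)) (trans (cong (_+ re ((u ⊖ 𝟙) ⊗ v)) (cong re (geom-telescope u n))) (eq₃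
        (re u) (im u) (re v) (im v))))
    (trans (eq₂ (re u) (im u) (re g) (im g) (re v) (im v)) (trans (cong (_+ im ((u ⊖ 𝟙) ⊗ v)) (cong im (geom-telescope u n))) (eq₄
        (re u) (im u) (re v) (im v)))))
    where
    g = geom u n
    v = u ^ n
    eq₁ : ∀ a b c d e f → (a - 1ℚ) * (c + e) - (b - 0ℚ) * (d + f) ≡ (a - 1ℚ) * c - (b - 0ℚ) * d + ((a - 1ℚ) * e - (b - 0ℚ) * f)
    eq₁ = solve-∀ ring
    eq₂ : ∀ a b c d e f → (a - 1ℚ) * (d + f) + (b - 0ℚ) * (c + e) ≡ (a - 1ℚ) * d + (b - 0ℚ) * c + ((a - 1ℚ) * f + (b - 0ℚ) * e)
    eq₂ = solve-∀ ring
    eq₃ : ∀ a b e f → e - 1ℚ + ((a - 1ℚ) * e - (b - 0ℚ) * f) ≡ a * e - b * f - 1ℚ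
    eq₃ = solve-∀ ring
    eq₄ : ∀ a b e f → f - 0ℚ + ((a - 1ℚ) * f + (b - 0ℚ) * e) ≡ a * f + b * e - 0ℚ
    eq₄ = solve-∀ ring

  norm-geom : ∀ {u} → norm u ≡ 1ℚ → ∀ n → norm (geom u n) ≤ ι n * ι n
  norm-geom h zero = ≤-reflexive (sym (cong₂ _*_ ι-0 ι-0))
  norm-geom {u} h (suc n) = subst₂ _≤_ (cong norm (sym (geom-suc u n)))
    (cong (λ t → t * t) (trans (+-comm (ι n) 1ℚ) (sym (ι-suc n))))
    (norm-+ {geom u n} {u ^ n} (0≤ι n) 0≤1 (norm-geom h n) (≤-reflexive (norm-^ h n)))

  norm-chord : ∀ {u} → norm u ≡ 1ℚ → ∀ n → norm (u ^ n ⊖ 𝟙) ≤ ι n * ι n * norm (u ⊖ 𝟙)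
  norm-chord {u} h n = subst₂ _≤_ (trans (sym (norm-⊗ (u ⊖ 𝟙) (geom u n))) (cong norm (geom-telescope u n)))
    (*-comm (norm (u ⊖ 𝟙)) (ι n * ι n)) (*-monoˡ (0≤norm (u ⊖ 𝟙)) (norm-geom h n))

  -- On the unit circle |u - 1|² = 2 - 2 re u.
  re-chord : ∀ u → norm u ≡ 1ℚ → norm (u ⊖ 𝟙) ≤ 1ℚ → 0ℚ ≤ re u
  re-chord u h c≤1 = *-cancelˡ 0<2 (by-diff (0≤+ 0≤1 (0≤diff c≤1)) (≡-by h 1ℚ (eq (re u) (im u))))
    where
    eq : ∀ a b → 2ℚ * a ≡ 2ℚ * 0ℚ + (1ℚ + (1ℚ - ((a - 1ℚ) * (a - 1ℚ) + (b - 0ℚ) * (b - 0ℚ)))) + 1ℚ * (a * a + b * b - 1ℚ)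
    eq = solve-∀ ring

  module Rotation (t′ : ℕ) where

    T : ℕ
    T = suc t′

    t inv τ : ℚ
    t   = ι T
    inv = (ℤ.+ 1) / suc (T ℕ.* T)
    τ   = (ℤ.+ 1) / T

    0<t : 0ℚ < t
    0<t = 0<ι-suc t′

    1≤t : 1ℚ ≤ t
    1≤t = subst (_≤ t) ι-1 (ι-mono (ℕ.s≤s ℕ.z≤n))

    inv-spec : inv * (1ℚ + t * t) ≡ 1ℚ
    inv-spec = trans (cong (inv *_) (trans (cong (1ℚ +_) (sym (ι-* T T))) (sym (ι-suc (T ℕ.* T))))) (/-*-ι (ℤ.+ 1) (T ℕ.* T))

    τ-spec : τ * t ≡ 1ℚ
    τ-spec = /-*-ι (ℤ.+ 1) t′

    0<inverse : ∀ {x y} → 0ℚ < y → x * y ≡ 1ℚ → 0ℚ < x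
    0<inverse {x} {y} 0<y h = *-cancelˡ-< (<⇒≤ 0<y) (subst₂ _<_ (sym (*-zeroʳ y)) (trans (sym h) (*-comm x y)) 0<1)

    0<inv : 0ℚ < inv
    0<inv = 0<inverse (0<+ 0<1 (0≤² t)) inv-spec

    0<τ : 0ℚ < τ
    0<τ = 0<inverse 0<t τ-spec

    -- This is (T + i)² / (T² + 1), the rotation by 2 arctan(1 / T), roughly 2 / T.
    ζ : 𝔾
    ζ = ((t * t - 1ℚ) * inv) ,i (2ℚ * t * inv)

    ρ : ℚ
    ρ = norm (ζ ⊖ 𝟙)

    ζ-unit : norm ζ ≡ 1ℚ
    ζ-unit = trans (eq t inv) (cong (λ s → s * s) inv-spec)
      where
      eq : ∀ t i → (t * t - 1ℚ) * i * ((t * t - 1ℚ) * i) + 2ℚ * t * i * (2ℚ * t * i) ≡ i * (1ℚ + t * t) * (i * (1ℚ + t * t))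
      eq = solve-∀ ring

    ζ^-unit : ∀ n → norm (ζ ^ n) ≡ 1ℚ
    ζ^-unit = norm-^ ζ-unit

    ρ≡ : ρ ≡ 4ℚ * inv
    ρ≡ = ≡-by inv-spec (inv * (1ℚ + t * t) - 1ℚ) (eq t inv)
      where
      eq : ∀ t i → ((t * t - 1ℚ) * i - 1ℚ) * ((t * t - 1ℚ) * i - 1ℚ) + (2ℚ * t * i - 0ℚ) * (2ℚ * t * i - 0ℚ)
        ≡ 4ℚ * i + (i * (1ℚ + t * t) - 1ℚ) * (i * (1ℚ + t * t) - 1ℚ)
      eq = solve-∀ ring

    0<ρ : 0ℚ < ρ
    0<ρ = subst (0ℚ <_) (sym ρ≡) (0<* (positive⁻¹ 4ℚ) 0<inv)

    ρ≤ : ρ ≤ 2ℚ * τ * (2ℚ * τ)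
    ρ≤ = *-cancelˡ (0<+ 0<1 (0≤² t)) (by-diff (0≤* (nonNegative⁻¹ 4ℚ) (0≤² τ)) (eq₀ ρ t inv τ ρ≡ inv-spec τ-spec))
      where
      eq₁ : ∀ t i → (1ℚ + t * t) * (4ℚ * i) ≡ 4ℚ * (i * (1ℚ + t * t))
      eq₁ = solve-∀ ring
      eq₂ : ∀ t s → (1ℚ + t * t) * (2ℚ * s * (2ℚ * s)) ≡ 4ℚ * (s * t * (s * t)) + 4ℚ * (s * s)
      eq₂ = solve-∀ ring
      eq₀ : ∀ r t i s → r ≡ 4ℚ * i → i * (1ℚ + t * t) ≡ 1ℚ → s * t ≡ 1ℚ → (1ℚ + t * t) * (2ℚ * s * (2ℚ * s)) ≡
          (1ℚ + t * t) * r + 4ℚ * (s * s)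
      eq₀ _ t i s refl h₁ h₂ = trans (eq₂ t s) (cong (_+ 4ℚ * (s * s)) (trans (cong (λ z → 4ℚ * (z * z)) h₂)
        (trans (cong (4ℚ *_) (sym h₁)) (sym (eq₁ t i)))))

    chord : ∀ l → norm (ζ ^ l ⊖ 𝟙) ≤ ι l * (2ℚ * τ) * (ι l * (2ℚ * τ))
    chord l = ≤-trans (norm-chord ζ-unit l) (≤-trans (*-monoˡ (0≤² (ι l)) ρ≤) (≤-reflexive (eq (ι l) (2ℚ * τ))))
      where
      eq : ∀ l s → l * l * (s * s) ≡ l * s * (l * s)
      eq = solve-∀ ring

    0≤re : ∀ i → 2 ℕ.* i ℕ.≤ T → 0ℚ ≤ re (ζ ^ i)
    0≤re i 2i≤T = re-chord (ζ ^ i) (ζ^-unit i) (≤-trans (chord i) (*-mono {y = 1ℚ} {w = 1ℚ} 0≤c 0≤1 c≤1 c≤1))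
      where
      0≤c : 0ℚ ≤ ι i * (2ℚ * τ)
      0≤c = 0≤* (0≤ι i) (0≤* 0≤2 (<⇒≤ 0<τ))
      eq : ∀ i s → i * (2ℚ * s) ≡ s * (2ℚ * i)
      eq = solve-∀ ring
      c≤1 : ι i * (2ℚ * τ) ≤ 1ℚ
      c≤1 = subst₂ _≤_ (trans (cong (τ *_) (trans (ι-* 2 i) (cong (_* ι i) ι-2))) (sym (eq (ι i) τ))) τ-spec
        (*-monoˡ (<⇒≤ 0<τ) (ι-mono 2i≤T))

    0≤re-ζ : 0ℚ ≤ re ζ
    0≤re-ζ = 0≤* (by-diff (0≤+ (0≤* (0≤diff 1≤t) (0≤diff 1≤t)) (0≤+ (0≤diff 1≤t) (0≤diff 1≤t))) (eq t)) (<⇒≤ 0<inv)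
      where
      eq : ∀ t → t * t - 1ℚ ≡ 0ℚ + ((t - 1ℚ) * (t - 1ℚ) + (t - 1ℚ + (t - 1ℚ)))
      eq = solve-∀ ring

    0<im-ζ : 0ℚ < im ζ
    0<im-ζ = 0<* (0<* 0<2 0<t) 0<inv

    0≤im : ∀ i → 2 ℕ.* i ℕ.≤ T → 0ℚ ≤ im (ζ ^ i)
    0≤im zero    _ = ≤-refl
    0≤im (suc i) 2i+2≤T = 0≤+ (0≤* 0≤re-ζ (0≤im i 2i≤T)) (0≤* (<⇒≤ 0<im-ζ) (0≤re i 2i≤T))
      where
      2i≤T : 2 ℕ.* i ℕ.≤ T
      2i≤T = ℕ.≤-trans (ℕ.*-monoʳ-≤ 2 (ℕ.n≤1+n i)) 2i+2≤T

    UpperHalf : ℕ → Set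
    UpperHalf n = ∀ i → i ℕ.< n → 0ℚ ≤ im (ζ ^ i)

    Crossing : ℕ → Set
    Crossing L = UpperHalf L × im (ζ ^ L) < 0ℚ

    search : ∀ n → UpperHalf n ⊎ ∃[ L ] Crossing L
    search zero = inj₁ (λ i ())
    search (suc n) with search n
    ... | inj₂ found = inj₂ found
    ... | inj₁ upper with 0ℚ ≤? im (ζ ^ n)
    ...   | no im≱0  = inj₂ (n , upper , ≰⇒> im≱0)
    ...   | yes 0≤im-n = inj₁ extend
      where
      extend : UpperHalf (suc n)
      extend i i<1+n with ℕ.m≤n⇒m<n∨m≡n (ℕ.≤-pred i<1+n)
      ... | inj₁ i<n  = upper i i<n
      ... | inj₂ refl = 0≤im-n

    σ² : ℚ
    σ² = im ζ * im ζ

    pair : ℕ → ℚ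
    pair i = re (ζ ^ i) + re (ζ ^ suc i)

    re-bounds : ∀ n → re (ζ ^ n) ≤ 1ℚ × - 1ℚ ≤ re (ζ ^ n)
    re-bounds n = abs-bound {ζ ^ n} 0≤1 (≤-reflexive (ζ^-unit n))

    -- While two consecutive powers stay in the upper half plane, their imaginary parts add up to at least im ζ.
    descent : ∀ i → 0ℚ ≤ im (ζ ^ suc i) → 0ℚ ≤ im (ζ ^ suc (suc i)) → pair (suc (suc i)) + 2ℚ * σ² ≤ pair i
    descent i 0≤I 0≤I′ = by-diff
      (0≤* (0≤* 0≤2 (<⇒≤ 0<im-ζ)) (0≤+ (0≤* 0≤I (0≤diff (proj₂ (re-bounds (suc (suc i))))))
        (0≤* 0≤I′ (0≤diff (proj₁ (re-bounds (suc i)))))))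
      (eq (re ζ) (im ζ) (re (ζ ^ i)) (im (ζ ^ i)) ζ-unit (ζ^-unit (suc i)))
      where
      eq₁ : ∀ c s a b → a + (c * a - s * b) ≡
        c * (c * a - s * b) - s * (c * b + s * a) + (c * (c * (c * a - s * b) - s * (c * b + s * a)) - s * (c *
            (c * b + s * a) + s * (c * a - s * b))) + 2ℚ * (s * s)
        + (2ℚ * s * ((c * b + s * a) * (c * (c * a - s * b) - s * (c * b + s * a) - - 1ℚ) + (c * (c * b + s * a) + s *
            (c * a - s * b)) * (1ℚ - (c * a - s * b))))
          + 2ℚ * (s * s) * ((c * a - s * b) * (c * a - s * b) + (c * b + s * a) * (c * b + s * a) - 1ℚ)
          + (- (a + (c * a - s * b))) * (c * c + s * s - 1ℚ)
      eq₁ = solve-∀ ring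
      eq : ∀ c s a b → c * c + s * s ≡ 1ℚ → (c * a - s * b) * (c * a - s * b) + (c * b + s * a) * (c * b + s * a) ≡ 1ℚ →
        a + (c * a - s * b) ≡
        c * (c * a - s * b) - s * (c * b + s * a) + (c * (c * (c * a - s * b) - s * (c * b + s * a)) - s * (c *
            (c * b + s * a) + s * (c * a - s * b))) + 2ℚ * (s * s)
        + (2ℚ * s * ((c * b + s * a) * (c * (c * a - s * b) - s * (c * b + s * a) - - 1ℚ) + (c * (c * b + s * a) + s *
            (c * a - s * b)) * (1ℚ - (c * a - s * b))))
      eq c s a b h₁ h₂ = ≡-by h₂ (2ℚ * (s * s)) (≡-by h₁ (- (a + (c * a - s * b))) (eq₁ c s a b))

    descents : ∀ m → UpperHalf (suc (suc (2 ℕ.* m))) → pair (2 ℕ.* m) + 2ℚ * (ι m * σ²) ≤ 2ℚ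
    descents zero _ = subst (_≤ 2ℚ) (sym (trans (cong (λ z → pair 0 + 2ℚ * (z * σ²)) ι-0) (eq (pair 0) σ²)))
      (+-mono-≤ (proj₁ (re-bounds 0)) (proj₁ (re-bounds 1)))
      where
      eq : ∀ p s → p + 2ℚ * (0ℚ * s) ≡ p
      eq = solve-∀ ring
    descents (suc m) upper = ≤-trans (≤-reflexive (trans (cong₂ (λ i z → pair i + 2ℚ * (z * σ²)) 2m+2≡ (ι-suc m)) (eq (pair (suc
        (suc (2 ℕ.* m)))) (ι m) σ²)))
      (≤-trans (+-monoˡ-≤ (2ℚ * (ι m * σ²)) (descent (2 ℕ.* m)
        (upper (suc (2 ℕ.* m)) (ℕ.≤-trans (ℕ.n≤1+n _) below)) (upper (suc (suc (2 ℕ.* m))) below)))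
        (descents m (λ i i< → upper i (ℕ.≤-trans i< (ℕ.≤-trans (ℕ.n≤1+n _) below)))))
      where
      2m+2≡ : 2 ℕ.* suc m ≡ suc (suc (2 ℕ.* m))
      2m+2≡ = ℕ.*-suc 2 m
      below : suc (suc (suc (2 ℕ.* m))) ℕ.≤ suc (suc (2 ℕ.* suc m))
      below = subst (λ i → suc (suc (suc (2 ℕ.* m))) ℕ.≤ suc (suc i)) (sym 2m+2≡) (ℕ.n≤1+n _)
      eq : ∀ p m s → p + 2ℚ * ((1ℚ + m) * s) ≡ p + 2ℚ * s + 2ℚ * (m * s)
      eq = solve-∀ ring

    opaque
      -- Opaque, so that the search is never evaluated; only the two properties of L are used.
      crossing : ∃[ L ] Crossing L
      -- In the upper half plane two steps lower `pair` by at least 2σ², where T · im ζ ≥ 1. After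
      -- 3T² such double steps the loss is at least 6, but `pair` is confined to [-2, 2].
      crossing with search (suc (suc (2 ℕ.* (3 ℕ.* (T ℕ.* T)))))
      ... | inj₂ found = found
      ... | inj₁ upper = ⊥-elim (<-irrefl refl (<-≤-trans (positive⁻¹ 2ℚ) contra))
        where
        m : ℕ
        m = 3 ℕ.* (T ℕ.* T)
        ιm : ι m ≡ 3ℚ * (t * t)
        ιm = trans (ι-* 3 (T ℕ.* T)) (cong₂ _*_ ι-3 (ι-* T T))
          where
          ι-3 : ι 3 ≡ 3ℚ
          ι-3 = trans (ι-suc 2) (cong (1ℚ +_) ι-2)
        1≤tσ : 1ℚ ≤ t * im ζ
        1≤tσ = by-diff (0≤* (<⇒≤ 0<inv) (0≤* (0≤+ 0≤1 (<⇒≤ 0<t)) (0≤diff 1≤t))) (trans (eq t inv) (cong (_+ inv * ((1ℚ + t) *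
            (t - 1ℚ))) inv-spec))
          where
          eq : ∀ t i → t * (2ℚ * t * i) ≡ i * (1ℚ + t * t) + i * ((1ℚ + t) * (t - 1ℚ))
          eq = solve-∀ ring
        contra : 2ℚ ≤ 0ℚ
        contra = by-diff
          (0≤+ (0≤diff (descents m upper)) (0≤+ (0≤+ (0≤diff (proj₂ (re-bounds (2 ℕ.* m)))) (0≤diff (proj₂ (re-bounds (suc
              (2 ℕ.* m))))))
            (0≤* (nonNegative⁻¹ (ℤ.+ 6 / 1)) (0≤diff (*-mono {1ℚ} {z = 1ℚ} 0≤1 (≤-trans 0≤1 1≤tσ) 1≤tσ 1≤tσ)))))
          (trans (eq (re (ζ ^ (2 ℕ.* m))) (re (ζ ^ suc (2 ℕ.* m))) t (im ζ))
            (cong (λ z → 2ℚ + (2ℚ - (pair (2 ℕ.* m) + 2ℚ * (z * σ²)) + ((re (ζ ^ (2 ℕ.* m)) - - 1ℚ + (re (ζ ^ suc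
                (2 ℕ.* m)) - - 1ℚ)) + ℤ.+ 6 / 1 * (t * im ζ * (t * im ζ) - 1ℚ * 1ℚ)))) (sym ιm)))
          where
          eq : ∀ a b t s → 0ℚ ≡ 2ℚ + (2ℚ - (a + b + 2ℚ * (3ℚ * (t * t) * (s * s))) + ((a - - 1ℚ + (b - - 1ℚ)) + ℤ.+ 6 / 1 *
              (t * s * (t * s) - 1ℚ * 1ℚ)))
          eq = solve-∀ ring

    L : ℕ
    L = proj₁ crossing

    upper-half : UpperHalf L
    upper-half = proj₁ (proj₂ crossing)

    im-L<0 : im (ζ ^ L) < 0ℚ
    im-L<0 = proj₂ (proj₂ crossing)

    T<2L : T ℕ.< 2 ℕ.* L
    T<2L = ℕ.≰⇒> (λ 2L≤T → <-irrefl refl (<-≤-trans im-L<0 (0≤im L 2L≤T)))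

    -- The preceding power is still in the closed upper half plane, so the overshoot below the axis
    -- is at most the length |ζ - 1| of one step.
    im-L²≤ρ : im (ζ ^ L) * im (ζ ^ L) ≤ ρ
    im-L²≤ρ = go L upper-half im-L<0
      where
      eq₁ : ∀ x y → (x - y) * (x - y) ≡ y * y + (x * x + 2ℚ * (x * (0ℚ - y)))
      eq₁ = solve-∀ ring
      eq₂ : ∀ c s a b → (b - (c * b + s * a)) * (b - (c * b + s * a)) + (((c - 1ℚ) * a - (s - 0ℚ) * b) * ((c - 1ℚ) * a - (s - 0ℚ) * b))
        ≡ ((c - 1ℚ) * a - (s - 0ℚ) * b) * ((c - 1ℚ) * a - (s - 0ℚ) * b) + ((c - 1ℚ) * b + (s - 0ℚ) * a) * ((c - 1ℚ) * b + (s - 0ℚ) * a)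
      eq₂ = solve-∀ ring
      go : ∀ n → UpperHalf n → im (ζ ^ n) < 0ℚ → im (ζ ^ n) * im (ζ ^ n) ≤ ρ
      go zero    _     im<0 = ⊥-elim (<-irrefl refl im<0)
      go (suc n) upper im<0 = ≤-trans
        (by-diff (0≤+ (0≤² x) (0≤* 0≤2 (0≤* (upper n ℕ.≤-refl) (0≤diff (<⇒≤ im<0))))) (eq₁ x y))
        (≤-trans (by-diff (0≤² (re ((ζ ⊖ 𝟙) ⊗ ζ ^ n))) (sym (eq₂ (re ζ) (im ζ) (re (ζ ^ n)) (im (ζ ^ n)))))
          (≤-reflexive (trans (norm-⊗ (ζ ⊖ 𝟙) (ζ ^ n)) (trans (cong (ρ *_) (ζ^-unit n)) (*-identityʳ ρ)))))
        where
        x = im (ζ ^ n)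
        y = im (ζ ^ suc n)

    -- For |v| = 1, v² - 1 = v (v - v̄) = 2i (im v) v, applied to v = ζ^L.
    full-turn : norm (ζ ^ (L ℕ.+ L) ⊖ 𝟙) ≤ 4ℚ * ρ
    full-turn = ≤-trans (≤-reflexive (trans (cong (λ z → norm (z ⊖ 𝟙)) (^-+ ζ L L))
        (≡-by (ζ^-unit L) (norm v - 1ℚ) (eq (re v) (im v)))))
      (*-monoˡ (nonNegative⁻¹ 4ℚ) im-L²≤ρ)
      where
      v = ζ ^ L
      eq : ∀ a b → (a * a - b * b - 1ℚ) * (a * a - b * b - 1ℚ) + (a * b + b * a - 0ℚ) * (a * b + b * a - 0ℚ)
        ≡ 4ℚ * (b * b) + (a * a + b * b - 1ℚ) * (a * a + b * b - 1ℚ)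
      eq = solve-∀ ring

    1≤re-geom : ∀ l → 1 ℕ.≤ l → 2 ℕ.* l ℕ.≤ T → 1ℚ ≤ re (geom ζ l)
    1≤re-geom (suc l) _ 2l≤T = by-diff (go l (λ i i<l → 0≤re (suc i) (ℕ.≤-trans (ℕ.*-monoʳ-≤ 2 (ℕ.s≤s (ℕ.<⇒≤ i<l))) 2l≤T))) refl
      where
      go : ∀ n {f : ℕ → ℚ} → (∀ i → i ℕ.< n → 0ℚ ≤ f i) → 0ℚ ≤ ∑ n f
      go zero    _   = ≤-refl
      go (suc n) 0≤f = 0≤+ (0≤f 0 (ℕ.s≤s ℕ.z≤n)) (go n (λ i i<n → 0≤f (suc i) (ℕ.s≤s i<n)))

    -- Stands in for the vanishing of geometric sums over roots of unity. The numerator ζ^(2Ll) - 1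
    -- has length at most 2l √ρ by `full-turn`; the denominator ζ^l - 1 has length at least √ρ,
    -- because 1 + ζ + ... + ζ^(l-1) has real part at least 1.
    geom-L : ∀ l → 1 ℕ.≤ l → 2 ℕ.* l ℕ.≤ T → norm (geom (ζ ^ l) (L ℕ.+ L)) ≤ 2ℚ * ι l * (2ℚ * ι l)
    geom-L l 1≤l 2l≤T = *-cancelˡ 0<ρ (begin
      ρ * norm Γ                            ≤⟨ *-monoʳ-≤-nonNeg (norm Γ) {{nonNegative (0≤norm Γ)}} ρ≤chord ⟩
      norm (ζ ^ l ⊖ 𝟙) * norm Γ             ≡⟨ norm-⊗ (ζ ^ l ⊖ 𝟙) Γ ⟨
      norm ((ζ ^ l ⊖ 𝟙) ⊗ Γ)                ≡⟨ cong norm (geom-telescope (ζ ^ l) (L ℕ.+ L)) ⟩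
      norm ((ζ ^ l) ^ (L ℕ.+ L) ⊖ 𝟙)        ≡⟨ cong (λ z → norm (z ⊖ 𝟙)) (trans (sym (^-* ζ (L ℕ.+ L) l)) (trans (cong (ζ ^_)
          (ℕ.*-comm (L ℕ.+ L) l)) (^-* ζ l (L ℕ.+ L)))) ⟩
      norm ((ζ ^ (L ℕ.+ L)) ^ l ⊖ 𝟙)        ≤⟨ norm-chord (ζ^-unit (L ℕ.+ L)) l ⟩
      ι l * ι l * norm (ζ ^ (L ℕ.+ L) ⊖ 𝟙)  ≤⟨ *-monoˡ (0≤² (ι l)) full-turn ⟩
      ι l * ι l * (4ℚ * ρ)                  ≡⟨ eq (ι l) ρ ⟩
      ρ * (2ℚ * ι l * (2ℚ * ι l))           ∎)
      where
      open ≤-Reasoning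
      Γ = geom (ζ ^ l) (L ℕ.+ L)
      eq : ∀ l r → l * l * (4ℚ * r) ≡ r * (2ℚ * l * (2ℚ * l))
      eq = solve-∀ ring
      1≤norm-geom : 1ℚ ≤ norm (geom ζ l)
      1≤norm-geom = ≤-trans (*-mono {1ℚ} {z = 1ℚ} 0≤1 (≤-trans 0≤1 (1≤re-geom l 1≤l 2l≤T)) (1≤re-geom l 1≤l 2l≤T)
          (1≤re-geom l 1≤l 2l≤T))
        (re²≤norm (geom ζ l))
      ρ≤chord : ρ ≤ norm (ζ ^ l ⊖ 𝟙)
      ρ≤chord = subst₂ _≤_ (*-identityʳ ρ) (trans (sym (norm-⊗ (ζ ⊖ 𝟙) (geom ζ l))) (cong norm (geom-telescope ζ l)))
        (*-monoˡ (<⇒≤ 0<ρ) 1≤norm-geom)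

  -- The asymptotic bound

  U-decreasing : ∀ j → U (suc j) ≤ U j
  U-decreasing j = by-diff (0≤* (0≤diff (C-decreasing j)) (<⇒≤ (0<C (suc j)))) (eq (U j) (U (suc j)) (U-step j))
    where
    eq₁ : ∀ u v → u ≡ v + (u - v)
    eq₁ = solve-∀ ring
    eq : ∀ u v {t} → t ≡ u - v → u ≡ v + t
    eq u v refl = eq₁ u v

  U≤1 : ∀ j → U j ≤ 1ℚ
  U≤1 zero    = ≤-reflexive (trans (*-identityʳ (odd 0)) ι-1)
  U≤1 (suc j) = ≤-trans (U-decreasing j) (U≤1 j)

  -- `wallis` against the first Leibniz sum, which is 4.
  ½≤U : ∀ j → 1ℚ ≤ 2ℚ * U j
  ½≤U j = *-cancelˡ 0<2 (≤-trans (wallis 0 j) (≤-reflexive (eq (C j) (odd j))))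
    where
    eq : ∀ c o → c * c * o * 4ℚ ≡ 2ℚ * (2ℚ * (o * (c * c)))
    eq = solve-∀ ring

  -- `C j` decays like j^(-1/2), because (2j + 1) C_j² = U_j ≤ 1.
  C-small : ∀ E j → E ℕ.* E ℕ.≤ suc (2 ℕ.* j) → ι E * C j ≤ 1ℚ
  C-small E j E²≤ = ≤-from-² 0≤1 (begin
    ι E * C j * (ι E * C j)  ≡⟨ eq (ι E) (C j) ⟩
    C j * C j * (ι E * ι E)  ≡⟨ cong (C j * C j *_) (ι-* E E) ⟨
    C j * C j * ι (E ℕ.* E)  ≤⟨ *-monoˡ (0≤² (C j)) (ι-mono E²≤) ⟩
    C j * C j * odd j        ≡⟨ *-comm (C j * C j) (odd j) ⟩
    U j                      ≤⟨ U≤1 j ⟩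
    1ℚ * 1ℚ                  ∎)
    where
    open ≤-Reasoning
    eq : ∀ e c → e * c * (e * c) ≡ c * c * (e * e)
    eq = solve-∀ ring

  module Exponent (a b : ℕ) where

    d : ℕ
    d = 2 ℕ.* suc b ℕ.+ a

    γ q : ℚ
    γ = (ℤ.+ suc b) / d
    q = (ℤ.+ a) / suc b

    γ*d : γ * ι d ≡ ι (suc b)
    γ*d = trans (/-*-ι (ℤ.+ suc b) (b ℕ.+ suc (b ℕ.+ 0) ℕ.+ a)) (sym (ι≡ℕtoℚ (suc b)))

    q*b : q * ι (suc b) ≡ ι a
    q*b = trans (/-*-ι (ℤ.+ a) b) (sym (ι≡ℕtoℚ a))

    0<d : 0ℚ < ι d
    0<d = 0<ι-suc (b ℕ.+ suc (b ℕ.+ 0) ℕ.+ a)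

    γ-spec : γ * (2ℚ + q) ≡ 1ℚ
    γ-spec = ≤-antisym (*-cancelˡ (0<ι-suc b) (≤-reflexive eq)) (*-cancelˡ (0<ι-suc b) (≤-reflexive (sym eq)))
      where
      eq₁ : ∀ s g q → s * (g * (2ℚ + q)) ≡ g * (2ℚ * s + q * s)
      eq₁ = solve-∀ ring
      eq : ι (suc b) * (γ * (2ℚ + q)) ≡ ι (suc b) * 1ℚ
      eq = trans (eq₁ (ι (suc b)) γ q) (trans (cong (λ t → γ * (2ℚ * ι (suc b) + t)) q*b)
        (trans (cong (λ t → γ * (t + ι a)) (sym (trans (ι-* 2 (suc b)) (cong (_* ι (suc b)) ι-2))))
        (trans (cong (γ *_) (sym (ι-+ (2 ℕ.* suc b) a))) (trans γ*d (sym (*-identityʳ (ι (suc b))))))))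

    invSq≡γ² : invSqPlus2 a b ≡ γ * γ
    invSq≡γ² = ≤-antisym (*-cancelˡ 0<d² (≤-reflexive eq)) (*-cancelˡ 0<d² (≤-reflexive (sym eq)))
      where
      0<d² : 0ℚ < ι d * ι d
      0<d² = 0<* 0<d 0<d
      eq₁ : ∀ d g → d * d * (g * g) ≡ g * d * (g * d)
      eq₁ = solve-∀ ring
      d′ : ℕ
      d′ = b ℕ.+ suc (b ℕ.+ 0) ℕ.+ a
      eq : ι d * ι d * invSqPlus2 a b ≡ ι d * ι d * (γ * γ)
      eq = trans (trans (*-comm (ι d * ι d) (invSqPlus2 a b)) (trans (cong (invSqPlus2 a b *_) (sym (ι-* d d)))
          (trans (/-*-ι (ℤ.+ (suc b ℕ.* suc b)) (d′ ℕ.+ d′ ℕ.* suc d′)) (sym (ι≡ℕtoℚ (suc b ℕ.* suc b))))))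
        (trans (ι-* (suc b) (suc b)) (trans (cong₂ _*_ (sym γ*d) (sym γ*d)) (sym (eq₁ (ι d) γ))))

    0<γ : 0ℚ < γ
    0<γ = *-cancelˡ-< (<⇒≤ 0<d) (subst₂ _<_ (sym (*-zeroʳ (ι d))) (trans (sym γ*d) (*-comm γ (ι d))) (0<ι-suc b))

    0≤q : 0ℚ ≤ q
    0≤q = *-cancelˡ (0<ι-suc b) (subst₂ _≤_ (sym (*-zeroʳ (ι (suc b)))) (trans (sym q*b) (*-comm q (ι (suc b)))) (0≤ι a))

    2γ≤1 : 2ℚ * γ ≤ 1ℚ
    2γ≤1 = by-diff (0≤* (<⇒≤ 0<γ) 0≤q) (trans (sym γ-spec) (eq γ q))
      where
      eq : ∀ g q → g * (2ℚ + q) ≡ 2ℚ * g + g * q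
      eq = solve-∀ ring

    -- Since 1 - 2γ = γ q, the claim amounts to U_j q ≥ 2, which is `wallis` at the Leibniz sum
    -- witnessing q > π.
    threshold : ∀ j → GreaterThanπ q → 2ℚ * γ * (1ℚ + U j) ≤ U j
    threshold j (m , leibniz<q) = by-diff (0≤* (<⇒≤ 0<γ) (0≤diff 2≤Uq)) (eq γ q (U j) γ-spec)
      where
      2≤Uq : 2ℚ ≤ U j * q
      2≤Uq = ≤-trans (wallis m j) (≤-trans (≤-reflexive (cong (_* leibniz (suc (2 ℕ.* m))) (*-comm (C j * C j) (odd j))))
        (*-monoˡ (0≤* (0≤odd j) (0≤² (C j))) (<⇒≤ leibniz<q)))
      eq₁ : ∀ g q u → u ≡ 2ℚ * g * (1ℚ + u) + g * (u * q - 2ℚ) + (- u) * (g * (2ℚ + q) - 1ℚ)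
      eq₁ = solve-∀ ring
      eq : ∀ g q u → g * (2ℚ + q) ≡ 1ℚ → u ≡ 2ℚ * g * (1ℚ + u) + g * (u * q - 2ℚ)
      eq g q u h = ≡-by h (- u) (eq₁ g q u)

  positive-witness : ∀ ε → 0ℚ < ε → ∃[ e ] (ℤ.+ 1) / suc e ≤ ε
  positive-witness (mkℚ (ℤ.+ zero) d _) (*<* (ℤ.+<+ ()))
  positive-witness (mkℚ ℤ.-[1+ n ] d _) (*<* ())
  -- The denominator of ε itself serves, as the numerator is at least 1.
  positive-witness ε@(mkℚ (ℤ.+ suc n) d _) _ = d , *-cancelˡ (0<ι-suc d) (subst₂ _≤_
    (trans (sym (/-*-ι (ℤ.+ 1) d)) (*-comm ((ℤ.+ 1) / suc d) (ι (suc d))))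
    (trans (ι≡ℕtoℚ (suc n)) (trans (sym (/-*-ι (ℤ.+ suc n) d)) (trans (cong (_* ι (suc d)) (↥p/↧p≡p ε)) (*-comm ε (ι (suc d))))))
    (subst (_≤ ι (suc n)) ι-1 (ι-mono (ℕ.s≤s ℕ.z≤n))))

  -- γ = 1 / (q + 2), and K · 2γ · (1 - 2c) is chosen just small enough to contradict dual-bound; c = C J absorbs the error
  -- of the Taylor polynomial.
  budget : ∀ K S ν γ ε m ℓ l j τ φ c → 0ℚ ≤ K → 0ℚ ≤ m → 0ℚ ≤ j → 0ℚ ≤ τ → 0ℚ ≤ γ → 2ℚ * γ ≤ 1ℚ → 0ℚ ≤ c →
    4ℚ * ν + K * K * (1ℚ - 4ℚ * (γ * γ) + 4ℚ * ε) ≤ 4ℚ * S →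
    m * ℓ ≤ ν → l ≤ 2ℚ * j → m ≤ 2ℚ * τ * (K * K) → ℤ.+ 20 / 1 * j * τ ≤ φ →
    2ℚ * K ≤ φ * (K * K) → 4ℚ * ℓ + ℤ.+ 8 / 1 * j ≤ φ * (K * K) → φ ≤ ε → 4ℚ * c ≤ φ →
    K * K + 2ℚ * K + 2ℚ * (2ℚ * ℓ * (1ℚ + m)) - 4ℚ * S + (2ℚ * ((1ℚ + m) * (2ℚ * l)) + l * (2ℚ * τ) * (K * K))
      ≤ K * (2ℚ * γ) * (1ℚ - 2ℚ * c) * (K * (2ℚ * γ) * (1ℚ - 2ℚ * c))
  budget K S ν γ ε m ℓ l j τ φ c 0≤K 0≤m 0≤j 0≤τ 0≤γ 2γ≤1 0≤c h₁ h₂ h₃ h₄ h₅ h₆ h₇ h₈ h₉ = by-diff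
    (0≤+ (0≤diff h₁) (0≤+ (0≤* 0≤4 (0≤diff h₂)) (0≤+ (0≤* (0≤diff h₃) (0≤+ (0≤* 0≤4 (0≤+ 0≤1 0≤m)) (0≤* (0≤* 0≤2 0≤τ) 0≤K²)))
    (0≤+ (0≤* (0≤* (nonNegative⁻¹ (ℤ.+ 8 / 1)) 0≤j) (0≤diff h₄)) (0≤+ (0≤* 0≤K² (0≤diff h₅)) (0≤+ (0≤diff h₆) (0≤+ (0≤diff h₇)
    (0≤+ (0≤* (0≤* 0≤4 0≤K²) (0≤diff h₈)) (0≤+ (0≤* 0≤K² (0≤diff h₉))
    (0≤+ (0≤* (0≤* (0≤* 0≤4 0≤K²) 0≤c) (0≤* (0≤diff 2γ≤1) (0≤+ 0≤1 (0≤* 0≤2 0≤γ)))) (0≤² (4ℚ * K * γ * c))))))))))))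
    (eq K S ν γ ε m ℓ l j τ φ c)
    where
    0≤4 : 0ℚ ≤ 4ℚ
    0≤4 = nonNegative⁻¹ 4ℚ
    0≤K² : 0ℚ ≤ K * K
    0≤K² = 0≤² K
    eq : ∀ K S ν γ ε m ℓ l j τ φ c →
      K * (2ℚ * γ) * (1ℚ - 2ℚ * c) * (K * (2ℚ * γ) * (1ℚ - 2ℚ * c)) ≡
      K * K + 2ℚ * K + 2ℚ * (2ℚ * ℓ * (1ℚ + m)) - 4ℚ * S + (2ℚ * ((1ℚ + m) * (2ℚ * l)) + l * (2ℚ * τ) * (K * K))
      + (4ℚ * S - (4ℚ * ν + K * K * (1ℚ - 4ℚ * (γ * γ) + 4ℚ * ε)) + (4ℚ * (ν - m * ℓ) + ((2ℚ * j - l) * (4ℚ * (1ℚ + m) + 2ℚ * τ *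
          (K * K))
      + (ℤ.+ 8 / 1 * j * (2ℚ * τ * (K * K) - m) + (K * K * (φ - ℤ.+ 20 / 1 * j * τ) + (φ * (K * K) - 2ℚ * K + (φ * (K * K) -
          (4ℚ * ℓ + ℤ.+ 8 / 1 * j)
      + (4ℚ * (K * K) * (ε - φ) + (K * K * (φ - 4ℚ * c)
      + (4ℚ * (K * K) * c * ((1ℚ - 2ℚ * γ) * (1ℚ + 2ℚ * γ)) + 4ℚ * K * γ * c * (4ℚ * K * γ * c)))))))))))
    eq = solve-∀ ring

  -- As u ≥ 1/2, u - c ≥ (1 - 2c) u: this is the origin of the factor 1 - 2c. Strictness comes from
  -- 1 + u - c < 1 + u.
  dual-contradiction : ∀ K γ u c → 0ℚ < K → 0ℚ < γ → 0ℚ < c → 4ℚ * c ≤ 1ℚ → 1ℚ ≤ 2ℚ * u → 2ℚ * γ * (1ℚ + u) ≤ u →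
    ¬ K * (u - c) ≤ K * (2ℚ * γ) * (1ℚ - 2ℚ * c) * (1ℚ + (u - c))
  dual-contradiction K γ u c 0<K 0<γ 0<c 4c≤1 1≤2u h dual = <-irrefl refl (<-≤-trans strict dual)
    where
    0<λ : 0ℚ < 1ℚ - 2ℚ * c
    0<λ = *-cancelˡ-< 0≤2 (subst (0ℚ <_) (sym (eq₀ c)) (0<+ 0<1 (0≤diff 4c≤1)))
      where
      eq₀ : ∀ c → 2ℚ * (1ℚ - 2ℚ * c) ≡ 1ℚ + (1ℚ - 4ℚ * c)
      eq₀ = solve-∀ ring
    eq : ∀ K g u c → K * (u - c) ≡ K * (2ℚ * g) * (1ℚ - 2ℚ * c) * (1ℚ + (u - c)) +
      (K * (2ℚ * g) * (1ℚ - 2ℚ * c) * c + (K * (c * (2ℚ * u - 1ℚ)) + K * ((1ℚ - 2ℚ * c) * (u - 2ℚ * g * (1ℚ + u)))))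
    eq = solve-∀ ring
    strict : K * (2ℚ * γ) * (1ℚ - 2ℚ * c) * (1ℚ + (u - c)) < K * (u - c)
    strict = by-diff< (0<+ (0<* (0<* (0<* 0<K (0<* 0<2 0<γ)) 0<λ) 0<c)
      (0≤+ (0≤* (<⇒≤ 0<K) (0≤* (<⇒≤ 0<c) (0≤diff 1≤2u))) (0≤* (<⇒≤ 0<K) (0≤* (<⇒≤ 0<λ) (0≤diff h))))) (eq K γ u c)

  length-sums : ∀ A → length (sums A) ≡ length A ℕ.* length A
  length-sums A = go A
    where
    go : ∀ B → length (concatMap (λ x → map (x ℕ.+_) A) B) ≡ length B ℕ.* length A
    go []      = refl
    go (b ∷ B) = trans (length-++ (map (b ℕ.+_) A)) (cong₂ ℕ._+_ (length-map (b ℕ.+_) A) (go B))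

  sumsetCard≤ : ∀ A → sumsetCard A ℕ.≤ length A ℕ.* length A
  sumsetCard≤ A = ℕ.≤-trans (length-deduplicate ℕ._≟_ (sums A)) (ℕ.≤-reflexive (length-sums A))

  module Asymptotics (e : ℕ) where

    -- With J = 8E² one has (4E)² = 2J, so `C-small` yields 4 C_J ≤ 1 / E.
    E J : ℕ
    E = suc e
    J = 8 ℕ.* (E ℕ.* E)

    -- With l ≤ 2J and m ≤ 2τk², the errors 4lm and 2lτk² are at most 16Jτk² and 4Jτk². Their sum
    -- 20Jτk² is at most k² / E because T exceeds 20JE.
    open Rotation (20 ℕ.* (J ℕ.* E)) public

    -- Used together with n < k²: the first summand forces k ≥ 2E, hence 2k ≤ k² / E, and the second
    -- gives 4L + 8J ≤ k² / E.
    threshold-n : ℕ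
    threshold-n = (2 ℕ.* E) ℕ.* (2 ℕ.* E) ℕ.+ E ℕ.* (4 ℕ.* L ℕ.+ 8 ℕ.* J)

    -- The surplus 4εk² is spent in four shares of φk²: on 2k, on 4L + 8J, on 20Jτk², and on the
    -- factor (1 - 2c)².
    φ : ℚ
    φ = (ℤ.+ 1) / E

    φ-spec : φ * ι E ≡ 1ℚ
    φ-spec = /-*-ι (ℤ.+ 1) e

    ι-closed : ∀ c x → ι (c ℕ.* x) ≡ (ℤ.+ c / 1) * ι x
    ι-closed c x = trans (ι-* c x) (cong (_* ι x) (ι≡ℕtoℚ c))

    0<E : 0ℚ < ι E
    0<E = 0<ι-suc e

    by-E : ∀ {x} → ι E * x ≤ 1ℚ → x ≤ φ
    by-E {x} h = *-cancelˡ 0<E (≤-trans h (≤-reflexive (trans (sym φ-spec) (*-comm φ (ι E)))))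

    0<φ : 0ℚ < φ
    0<φ = *-cancelˡ-< (<⇒≤ 0<E) (subst₂ _<_ (sym (*-zeroʳ (ι E))) (trans (sym φ-spec) (*-comm φ (ι E))) 0<1)

    φ≤1 : φ ≤ 1ℚ
    φ≤1 = *-cancelˡ 0<E (subst₂ _≤_ (trans (sym φ-spec) (*-comm φ (ι E))) (sym (*-identityʳ (ι E)))
      (subst (_≤ ι E) ι-1 (ι-mono (ℕ.s≤s ℕ.z≤n))))

    4C≤φ : 4ℚ * C J ≤ φ
    4C≤φ = by-E (≤-trans (≤-reflexive (trans (eq (ι E) (C J)) (cong (_* C J) (sym (ι-closed 4 E))))) (C-small (4 ℕ.* E) J bound))
      where
      eq : ∀ e c → e * (4ℚ * c) ≡ 4ℚ * e * c
      eq = solve-∀ ring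
      eq₂ : ∀ x → (4 ℕ.* x) ℕ.* (4 ℕ.* x) ≡ 2 ℕ.* (8 ℕ.* (x ℕ.* x))
      eq₂ = ℕ-RingSolver.solve-∀
      bound : (4 ℕ.* E) ℕ.* (4 ℕ.* E) ℕ.≤ suc (2 ℕ.* J)
      bound = ℕ.≤-trans (ℕ.≤-reflexive (eq₂ E)) (ℕ.n≤1+n (2 ℕ.* J))

    20jτ≤φ : ℤ.+ 20 / 1 * ι J * τ ≤ φ
    20jτ≤φ = by-E (begin
      ι E * (ℤ.+ 20 / 1 * ι J * τ)      ≡⟨ eq (ι E) (ι J) τ ⟩
      τ * (ℤ.+ 20 / 1 * (ι J * ι E))    ≡⟨ cong (τ *_) (trans (cong (ℤ.+ 20 / 1 *_) (sym (ι-* J E))) (sym (ι-closed 20 (J ℕ.* E)))) ⟩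
      τ * ι (20 ℕ.* (J ℕ.* E))          ≤⟨ *-monoˡ (<⇒≤ 0<τ) (ι-mono (ℕ.n≤1+n (20 ℕ.* (J ℕ.* E)))) ⟩
      τ * t                             ≡⟨ τ-spec ⟩
      1ℚ                                ∎)
      where
      open ≤-Reasoning
      eq : ∀ e j s → e * (ℤ.+ 20 / 1 * j * s) ≡ s * (ℤ.+ 20 / 1 * (j * e))
      eq = solve-∀ ring

    4J≤T : 2 ℕ.* (J ℕ.+ J) ℕ.≤ T
    4J≤T = ℕ.≤-trans (ℕ.≤-reflexive (eq J)) (ℕ.≤-trans (ℕ.*-mono-≤ {4} {20} (ℕ.m≤m+n 4 16) (ℕ.m≤m*n J E)) (ℕ.n≤1+n (20 ℕ.* (J ℕ.* E))))
      where
      eq : ∀ x → 2 ℕ.* (x ℕ.+ x) ≡ 4 ℕ.* x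
      eq = ℕ-RingSolver.solve-∀

    1≤J : 1 ℕ.≤ J
    1≤J = ℕ.s≤s ℕ.z≤n

    instance
      L-nonZero : ℕ.NonZero L
      L-nonZero = ℕ.≢-nonZero (λ L≡0 → ℕ.n≮0 (subst (λ i → T ℕ.< 2 ℕ.* i) L≡0 T<2L))

    module _ (n : ℕ) (A : List ℕ) (A≤n : ∀ {a} → a ∈ A → a ℕ.≤ n) (n<k² : n ℕ.< length A ℕ.* length A) (large : threshold-n ℕ.≤ n)
      (a b : ℕ) (q>π : GreaterThanπ ((ℤ.+ a) / suc b)) (ε : ℚ) (φ≤ε : φ ≤ ε) where

      open Exponent a b
      -- The block length is ⌊n / L⌋ + 1. Thus A occupies the first L blocks, where the powers of ζ
      -- lie in the upper half plane, and A + A stays within 2L blocks, about one full turn.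
      open Blocks (n ℕ./ L)

      private
        k : ℕ
        k = length A
        K m r : ℚ
        K = ι k
        m = ι (n ℕ./ L)
        r = K * (2ℚ * γ) * (1ℚ - 2ℚ * C J)

      n<Lh : n ℕ.< L ℕ.* h
      n<Lh = ℕ.<-≤-trans (subst (ℕ._< L ℕ.+ n ℕ./ L ℕ.* L) (sym (ℕ.m≡m%n+[m/n]*n n L)) (ℕ.+-monoˡ-< (n ℕ./ L ℕ.* L) (ℕ.m%n<n n L)))
        (ℕ.≤-reflexive (trans (cong (L ℕ.+_) (ℕ.*-comm (n ℕ./ L) L)) (sym (ℕ.*-suc L (n ℕ./ L)))))

      sums-bound : ∀ {x y} → x ∈ A → y ∈ A → x ℕ.+ y ℕ.< (L ℕ.+ L) ℕ.* h
      sums-bound x∈A y∈A = ℕ.<-≤-trans (ℕ.+-mono-< (ℕ.≤-<-trans (A≤n x∈A) n<Lh) (ℕ.≤-<-trans (A≤n y∈A) n<Lh))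
        (ℕ.≤-reflexive (sym (ℕ.*-distribʳ-+ h L L)))

      block<L : ∀ {x} → x ∈ A → block x ℕ.< L
      block<L x∈A = ℕ.m<n*o⇒m/o<n {n = L} (ℕ.≤-<-trans (A≤n x∈A) n<Lh)

      mℓ≤n : m * ι L ≤ ι n
      mℓ≤n = ≤-trans (≤-reflexive (sym (ι-* (n ℕ./ L) L))) (ι-mono (ℕ.m/n*n≤m n L))

      ιk² : ι (k ℕ.* k) ≡ K * K
      ιk² = ι-* k k

      -- Since 2L > T and n < k², n / L is at most 2k² / T.
      m≤2τk² : m ≤ 2ℚ * τ * (K * K)
      m≤2τk² = *-cancelˡ 0<t (begin
        t * m                        ≡⟨ ι-* T (n ℕ./ L) ⟨
        ι (T ℕ.* (n ℕ./ L))          ≤⟨ ι-mono bound ⟩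
        ι (2 ℕ.* (k ℕ.* k))          ≡⟨ trans (ι-closed 2 (k ℕ.* k)) (cong (2ℚ *_) ιk²) ⟩
        2ℚ * (K * K)                 ≡⟨ trans (sym (*-identityˡ (2ℚ * (K * K)))) (cong (_* (2ℚ * (K * K))) (sym τ-spec)) ⟩
        τ * t * (2ℚ * (K * K))       ≡⟨ eq τ t (K * K) ⟩
        t * (2ℚ * τ * (K * K))       ∎)
        where
        open ≤-Reasoning
        eq : ∀ s t x → s * t * (2ℚ * x) ≡ t * (2ℚ * s * x)
        eq = solve-∀ ring
        bound : T ℕ.* (n ℕ./ L) ℕ.≤ 2 ℕ.* (k ℕ.* k)
        bound = ℕ.≤-trans (ℕ.*-monoˡ-≤ (n ℕ./ L) (ℕ.<⇒≤ T<2L)) (ℕ.≤-trans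
          (ℕ.≤-reflexive (trans (ℕ.*-assoc 2 L (n ℕ./ L)) (cong (2 ℕ.*_) (ℕ.*-comm L (n ℕ./ L)))))
          (ℕ.*-monoʳ-≤ 2 (ℕ.≤-trans (ℕ.m/n*n≤m n L) (ℕ.<⇒≤ n<k²))))

      2K≤φK² : 2ℚ * K ≤ φ * (K * K)
      2K≤φK² = by-diff (0≤* (<⇒≤ 0<φ) (0≤* (0≤ι k) (0≤diff (ι-mono 2E≤k))))
        (eq φ K (ι E) φ-spec (ι-closed 2 E))
        where
        2E≤k : 2 ℕ.* E ℕ.≤ k
        2E≤k = ℕ.≮⇒≥ (λ k<2E → ℕ.<-irrefl refl (ℕ.<-≤-trans n<k² (ℕ.≤-trans (ℕ.*-mono-≤ (ℕ.<⇒≤ k<2E) (ℕ.<⇒≤ k<2E))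
          (ℕ.≤-trans (ℕ.m≤m+n ((2 ℕ.* E) ℕ.* (2 ℕ.* E)) (E ℕ.* (4 ℕ.* L ℕ.+ 8 ℕ.* J))) large))))
        eq₁ : ∀ p k e → p * (k * k) ≡ 2ℚ * k + p * (k * (k - 2ℚ * e)) + 2ℚ * k * (p * e - 1ℚ)
        eq₁ = solve-∀ ring
        eq : ∀ p k e {z} → p * e ≡ 1ℚ → z ≡ 2ℚ * e → p * (k * k) ≡ 2ℚ * k + p * (k * (k - z))
        eq p k e h refl = ≡-by h (2ℚ * k) (eq₁ p k e)

      4ℓ+8j≤φK² : 4ℚ * ι L + ℤ.+ 8 / 1 * ι J ≤ φ * (K * K)
      4ℓ+8j≤φK² = by-diff (0≤* (<⇒≤ 0<φ) (0≤diff (subst₂ _≤_ split ιk² (ι-mono bound))))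
        (eq φ (ι E) (K * K) (4ℚ * ι L + ℤ.+ 8 / 1 * ι J) φ-spec)
        where
        bound : E ℕ.* (4 ℕ.* L ℕ.+ 8 ℕ.* J) ℕ.≤ k ℕ.* k
        bound = ℕ.≤-trans (ℕ.m≤n+m (E ℕ.* (4 ℕ.* L ℕ.+ 8 ℕ.* J)) ((2 ℕ.* E) ℕ.* (2 ℕ.* E))) (ℕ.≤-trans large (ℕ.<⇒≤ n<k²))
        split : ι (E ℕ.* (4 ℕ.* L ℕ.+ 8 ℕ.* J)) ≡ ι E * (4ℚ * ι L + ℤ.+ 8 / 1 * ι J)
        split = trans (ι-* E (4 ℕ.* L ℕ.+ 8 ℕ.* J)) (cong (ι E *_) (trans (ι-+ (4 ℕ.* L) (8 ℕ.* J)) (cong₂ _+_ (ι-closed 4 L)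
            (ι-closed 8 J))))
        eq₁ : ∀ p e x y → p * x ≡ y + p * (x - e * y) + y * (p * e - 1ℚ)
        eq₁ = solve-∀ ring
        eq : ∀ p e x y → p * e ≡ 1ℚ → p * x ≡ y + p * (x - e * y)
        eq p e x y h = ≡-by h y (eq₁ p e x y)

      0≤r : 0ℚ ≤ r
      0≤r = 0≤* (0≤* (0≤ι k) (0≤* 0≤2 (<⇒≤ 0<γ))) (*-cancelˡ 0<2 (by-diff (0≤+ 0≤1 (0≤diff (≤-trans 4C≤φ φ≤1))) (eq (C J))))
        where
        eq : ∀ c → 2ℚ * (1ℚ - 2ℚ * c) ≡ 2ℚ * 0ℚ + (1ℚ + (1ℚ - 4ℚ * c))
        eq = solve-∀ ring

      module _ (excess : 4ℚ * ι n + K * K * (1ℚ - 4ℚ * (γ * γ) + 4ℚ * ε) ≤ 4ℚ * ι (sumsetCard A)) where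

        coefficient : ∀ l → 1 ℕ.≤ l → l ℕ.≤ J ℕ.+ J → norm (∑𝔾 A (λ s → (ζ ^ l) ^ block s)) ≤ r * r
        coefficient l 1≤l l≤2J = ≤-trans
          (Fourier.norm-bound A (L ℕ.+ L) sums-bound (ζ ^ l) (ζ^-unit l) (ι l * (2ℚ * τ)) (2ℚ * ι l)
            (0≤* (0≤ι l) (0≤* 0≤2 (<⇒≤ 0<τ))) (0≤* 0≤2 (0≤ι l))
            (≤-trans (≤-reflexive (eq₁ (re (ζ ^ l)) (im (ζ ^ l)))) (chord l)) (geom-L l 1≤l 2l≤T))
          (≤-trans (≤-reflexive (cong₂ (λ x y → K * K + 2ℚ * K + 2ℚ * x - 4ℚ * ι (sumsetCard A) + (2ℚ * (y * (2ℚ * ι l)) + ι l *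
              (2ℚ * τ) * (K * K)))
              (trans (ι-* (L ℕ.+ L) h) (cong₂ _*_ (trans (ι-+ L L) (eq₂ (ι L))) (ι-suc (n ℕ./ L)))) (ι-suc (n ℕ./ L))))
            (budget K (ι (sumsetCard A)) (ι n) γ ε m (ι L) (ι l) (ι J) τ φ (C J) (0≤ι k) (0≤ι (n ℕ./ L)) (0≤ι J) (<⇒≤ 0<τ)
                (<⇒≤ 0<γ) 2γ≤1 (<⇒≤ (0<C J))
              excess mℓ≤n l≤2j m≤2τk² 20jτ≤φ 2K≤φK² 4ℓ+8j≤φK² φ≤ε 4C≤φ))
          where
          eq₁ : ∀ a b → (1ℚ - a) * (1ℚ - a) + (0ℚ - b) * (0ℚ - b) ≡ (a - 1ℚ) * (a - 1ℚ) + (b - 0ℚ) * (b - 0ℚ)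
          eq₁ = solve-∀ ring
          eq₂ : ∀ x → x + x ≡ 2ℚ * x
          eq₂ = solve-∀ ring
          2l≤T : 2 ℕ.* l ℕ.≤ T
          2l≤T = ℕ.≤-trans (ℕ.*-monoʳ-≤ 2 l≤2J) 4J≤T
          l≤2j : ι l ≤ 2ℚ * ι J
          l≤2j = ≤-trans (ι-mono l≤2J) (≤-reflexive (trans (ι-+ J J) (eq₂ (ι J))))

        power-swap : ∀ l s → (ζ ^ block s) ^ l ≡ (ζ ^ l) ^ block s
        power-swap l s = trans (sym (^-* ζ l (block s))) (trans (cong (ζ ^_) (ℕ.*-comm l (block s))) (^-* ζ (block s) l))

        re-bound : ∀ l → 1 ℕ.≤ l → l ℕ.≤ J ℕ.+ J → ∑ₗ A (λ s → re ((ζ ^ block s) ^ l)) ≤ r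
        re-bound l 1≤l l≤2J = subst (_≤ r) (∑ₗ-cong A (λ s → cong re (sym (power-swap l s))))
          (≤-from-² 0≤r (≤-trans (re²≤norm (∑𝔾 A (λ s → (ζ ^ l) ^ block s))) (coefficient l 1≤l l≤2J)))

        im-bound : ∑ₗ A (λ s → im (ζ ^ block s)) ≤ r
        im-bound = subst (_≤ r) (∑ₗ-cong A (λ s → cong im (trans (sym (power-swap 1 s)) (^-1 (ζ ^ block s)))))
          (≤-from-² 0≤r (≤-trans (im²≤norm (∑𝔾 A (λ s → (ζ ^ 1) ^ block s))) (coefficient 1 ℕ.≤-refl (ℕ.≤-trans 1≤J (ℕ.m≤m+n J J)))))
          where
          ^-1 : ∀ u → u ^ 1 ≡ u
          ^-1 u = trans (⊗-comm u 𝟙) (⊗-identityˡ u)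

        excess-impossible : ⊥
        excess-impossible = dual-contradiction K γ (U J) (C J) 0<K 0<γ (0<C J) (≤-trans 4C≤φ φ≤1) (½≤U J) (threshold J q>π)
          (Dual.dual-bound A (λ s → ζ ^ block s) (λ s → ζ^-unit (block s)) J r re-bound (λ {s} s∈A → upper-half (block s)
              (block<L s∈A)) im-bound)
          where
          0<K : 0ℚ < K
          0<K = positive-length A n<k²
            where
            positive-length : ∀ (B : List ℕ) → n ℕ.< length B ℕ.* length B → 0ℚ < ι (length B)
            positive-length (_ ∷ B) _ = 0<ι-suc (length B)

  sumset-bound : ∀ e ε → (ℤ.+ 1) / suc e ≤ ε → ∀ n A → Asymptotics.threshold-n e ℕ.≤ n → (∀ {a} → a ∈ A → a ℕ.≤ n) →
    ∀ a b → GreaterThanπ ((ℤ.+ a) / suc b) →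
    ι (sumsetCard A) ≤ ι n + ι (length A ℕ.* length A) * ((ℤ.+ 1) / 4 - invSqPlus2 a b + ε)
  sumset-bound e ε φ≤ε n A large A≤n a b q>π = decide (ι (sumsetCard A) ≤? bound) (length A ℕ.* length A ℕ.≤? n)
    where
    open Exponent a b
    open Asymptotics e using (0<φ; excess-impossible)
    K coefficient bound : ℚ
    K = ι (length A)
    coefficient = (ℤ.+ 1) / 4 - invSqPlus2 a b + ε
    bound = ι n + ι (length A ℕ.* length A) * coefficient
    0≤coefficient : 0ℚ ≤ coefficient
    0≤coefficient = by-diff (0≤+ (0≤* (nonNegative⁻¹ ((ℤ.+ 1) / 4)) (0≤* (0≤diff 2γ≤1) (0≤+ 0≤1 (0≤* 0≤2 (<⇒≤ 0<γ))))) (≤-trans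
        (<⇒≤ 0<φ) φ≤ε))
      (trans (cong (λ z → (ℤ.+ 1) / 4 - z + ε) invSq≡γ²) (eq γ ε))
      where
      eq : ∀ g x → (ℤ.+ 1) / 4 - g * g + x ≡ 0ℚ + ((ℤ.+ 1) / 4 * ((1ℚ - 2ℚ * g) * (1ℚ + 2ℚ * g)) + x)
      eq = solve-∀ ring
    excess : bound < ι (sumsetCard A) → 4ℚ * ι n + K * K * (1ℚ - 4ℚ * (γ * γ) + 4ℚ * ε) ≤ 4ℚ * ι (sumsetCard A)
    excess bound< = ≤-trans (≤-reflexive (trans (eq (ι n) (K * K) γ ε)
      (cong₂ (λ x y → 4ℚ * (ι n + x * ((ℤ.+ 1) / 4 - y + ε))) (sym (ι-* (length A) (length A))) (sym invSq≡γ²)))) (*-monoˡ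
          (nonNegative⁻¹ 4ℚ) (<⇒≤ bound<))
      where
      eq : ∀ n x g e → 4ℚ * n + x * (1ℚ - 4ℚ * (g * g) + 4ℚ * e) ≡ 4ℚ * (n + x * ((ℤ.+ 1) / 4 - g * g + e))
      eq = solve-∀ ring
    decide : Dec (ι (sumsetCard A) ≤ bound) → Dec (length A ℕ.* length A ℕ.≤ n) → ι (sumsetCard A) ≤ bound
    decide (yes holds) _ = holds
    -- Here |A + A| ≤ k² ≤ n, and the coefficient of k² is nonnegative because 1/4 - γ² = (1 - 2γ)(1
    -- + 2γ) / 4.
    decide (no _) (yes k²≤n) = ≤-trans (ι-mono (ℕ.≤-trans (sumsetCard≤ A) k²≤n))
      (by-diff (0≤* (0≤ι (length A ℕ.* length A)) 0≤coefficient) refl)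
    decide (no fails) (no k²≰n) = ⊥-elim (excess-impossible n A A≤n (ℕ.≰⇒> k²≰n) large a b q>π ε φ≤ε (excess (≰⇒> fails)))

open import Data.Nat using (ℕ; suc; _≤_; _*_)
open import Data.Integer using (+_)
open import Data.Rational as ℚ using (ℚ; 0ℚ)
open import Data.List using (List; length)
open import Data.List.Relation.Unary.All as All using (All)
open import Data.List.Relation.Unary.Unique.Propositional using (Unique)
open import Data.Product using (_×_; _,_; ∃-syntax; proj₂)
open import Relation.Binary.PropositionalEquality using (_≡_; refl; cong₂; subst₂)

theorem2 : (ε : ℚ) → 0ℚ ℚ.< ε →
  ∃[ N ] ((n k : ℕ) (A : List ℕ) → N ≤ n → 1 ≤ k → k ≤ n →
    Unique A → All (λ x → 1 ≤ x × x ≤ n) A → length A ≡ k →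
    (a b : ℕ) → GreaterThanπ ((+ a) ℚ./ (suc b)) →
    ℕtoℚ (sumsetCard A) ℚ.≤
      ℕtoℚ n ℚ.+ ℕtoℚ (k * k) ℚ.* ((((+ 1) ℚ./ 4) ℚ.- invSqPlus2 a b) ℚ.+ ε))
theorem2 ε 0<ε with Lemmas.positive-witness ε 0<ε
... | e , 1/[1+e]≤ε = Lemmas.Asymptotics.threshold-n e , bound
  where
  open Lemmas using (ι; ι≡ℕtoℚ; sumset-bound)
  bound : (n k : ℕ) (A : List ℕ) → Lemmas.Asymptotics.threshold-n e ≤ n → 1 ≤ k → k ≤ n →
    Unique A → All (λ x → 1 ≤ x × x ≤ n) A → length A ≡ k →
    (a b : ℕ) → GreaterThanπ ((+ a) ℚ./ (suc b)) →
    ℕtoℚ (sumsetCard A) ℚ.≤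
      ℕtoℚ n ℚ.+ ℕtoℚ (k * k) ℚ.* ((((+ 1) ℚ./ 4) ℚ.- invSqPlus2 a b) ℚ.+ ε)
  bound n _ A large _ _ _ A⊆[n] refl a b q>π = subst₂ ℚ._≤_ (ι≡ℕtoℚ (sumsetCard A))
    (cong₂ (λ x y → x ℚ.+ y ℚ.* ((((+ 1) ℚ./ 4) ℚ.- invSqPlus2 a b) ℚ.+ ε)) (ι≡ℕtoℚ n) (ι≡ℕtoℚ (length A * length A)))
    (sumset-bound e ε 1/[1+e]≤ε n A large (λ a∈A → proj₂ (All.lookup A⊆[n] a∈A)) a b q>π)
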